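{- (i) For $6\le n\le 12$: $\mathrm{ex}_3(n;P\mid M)=20+\binom{n-6}{3}$ and $\mathrm{Ex}_3(n;P\mid M)=\{K^3_6\cup K^3_{n-6}\}$. (ii) For $n=13$: $\mathrm{ex}_3(13;P\mid M)=40$ and $\mathrm{Ex}_3(13;P\mid M)=\{K^3_6\cup K^3_6\cup K^3_1,\ \mathrm{Co}(13)\}$. (iii) For $n\ge 14$: $\mathrm{ex}_3(n;P\mid M)=4+\binom{n-4}{2}$ and $\mathrm{Ex}_3(n;P\mid M)=\{\mathrm{Co}(n)\}$.
   Context: All hypergraphs are 3-uniform; containment means containing an isomorphic copy. $P$ is the loose 3-uniform path of length 3: vertices $a,b,c,d,e,f,g$, edges $\{a,b,c\},\{c,d,e\},\{e,f,g\}$. $M$ is the 3-graph consisting of two disjoint edges. $K^3_m$ is the complete 3-graph on $m$ vertices ($K^3_0$ is empty, $K^3_1$ an isolated vertex) and $\cup$ denotes vertex-disjoint union. The comet $\mathrm{Co}(n)$ is the $n$-vertex 3-graph with vertex set $\{c,h_1,h_2,h_3\}\cup R$, $|R|=n-4$, whose edges are the four triples of $\{c,h_1,h_2,h_3\}$ together with all triples $\{c,u,v\}$ with $u,v\in R$. Conditional Turán number: for a family $\mathcal F$ and a family $\mathcal G$ of $\mathcal F$-free 3-graphs, $\mathrm{ex}_3(n;\mathcal F\mid\mathcal G)$ is the maximum number of edges of an $n$-vertex $\mathcal F$-free 3-graph $H$ that contains some $G\in\mathcal G$; $\mathrm{Ex}_3(n;\mathcal F\mid\mathcal G)$ is the family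 (up to isomorphism) of such $H$ attaining this maximum. -}

module Defs where

open import Data.Bool.Properties using () renaming (_≟_ to _≟ᵇ_)
open import Data.Fin.Base using (Fin)
open import Data.Fin.Patterns
open import Data.Fin.Permutation using (Permutation; _⟨$⟩ʳ_)
open import Data.Fin.Properties using (any?) renaming (_≟_ to _≟ᶠ_)
open import Data.Fin.Subset
open import Data.Fin.Subset.Properties using (_∈?_; _⊆?_; ∣⊥∣≡0)
open import Data.List.Base as List using (List; []; _∷_)
import Data.List.Membership.DecPropositional as DecMembership
import Data.List.Membership.Propositional as Membership
open import Data.List.Relation.Unary.All as All using (All; []; _∷_)
open import Data.Nat.Base using (ℕ; zero; suc; _+_; _∸_; _≤_)
open import Data.Nat.Properties using () renaming (_≟_ to _≟ⁿ_)
open import Data.Product.Base using (Σ; ∃; _×_; _,_; proj₁; proj₂)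
open import Data.Sum.Base using (_⊎_; inj₁; inj₂)
open import Data.Vec.Base using ([]; _∷_; _++_; take; drop; tabulate)
open import Data.Vec.Properties using (≡-dec; take++drop≡id)
open import Function.Bundles using (_⇔_)
open import Function.Definitions using (Injective)
open import Level using (0ℓ) renaming (suc to lsuc)
open import Relation.Binary.PropositionalEquality
open import Relation.Nullary using (¬_; does)
open import Relation.Nullary.Decidable using (_×-dec_; _⊎-dec_)
open import Relation.Unary using (Pred; Decidable)

-- 3-uniform hypergraphs on the vertex set Fin n.  Decidability of Edge makes
-- the edge set a (finite) set of subsets in the classical sense.
record Graph³ (n : ℕ) : Set₁ where
  field
    Edge    : Pred (Subset n) 0ℓ
    edge?   : Decidable Edge
    uniform : ∀ {e} → Edge e → ∣ e ∣ ≡ 3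

open Graph³ public

-- Every subset of Fin n, listed exactly once.
subsets : ∀ n → List (Subset n)
subsets zero    = [] ∷ []
subsets (suc n) = List.map (outside ∷_) (subsets n) List.++ List.map (inside ∷_) (subsets n)

size : ∀ {n} → Graph³ n → ℕ
size {n} H = List.length (List.filter (edge? H) (subsets n))

image : ∀ {m n} → (Fin m → Fin n) → Subset m → Subset n
image f e = tabulate λ y → does (any? λ x → (x ∈? e) ×-dec (f x ≟ᶠ y))

-- H contains a (not necessarily induced) copy of G.
_Contains_ : ∀ {n m} → Graph³ n → Graph³ m → Set
_Contains_ {n} {m} H G =
  Σ (Fin m → Fin n) λ f → Injective _≡_ _≡_ f × (∀ {e} → Edge G e → Edge H (image f e))

infix 4 _≅_

_≅_ : ∀ {m n} → Graph³ m → Graph³ n → Set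
_≅_ {m} {n} G H =
  Σ (Permutation m n) λ σ → ∀ e → Edge G e ⇔ Edge H (image (σ ⟨$⟩ʳ_) e)

Family : Set₂
Family = Pred (∃ Graph³) (lsuc 0ℓ)

_-Free_ : ∀ {n} → Family → Graph³ n → Set₁
ℱ -Free H = ∀ {m} (F : Graph³ m) → ℱ (m , F) → ¬ (H Contains F)

-- The 3-graphs over which ex₃(n; ℱ | 𝒢) is the maximum.  The usual proviso that
-- every member of 𝒢 is ℱ-free only avoids vacuity and is not imposed here.
Admissible : ∀ {n} → Family → Family → Graph³ n → Set₁
Admissible ℱ 𝒢 H = ℱ -Free H × ∃ λ m → Σ (Graph³ m) λ G → 𝒢 (m , G) × H Contains G

-- ex₃(n; ℱ | 𝒢) = k, i.e. the maximum exists and equals k.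
ex₃[_,_∣_]≡_ : ℕ → Family → Family → ℕ → Set₁
ex₃[ n , ℱ ∣ 𝒢 ]≡ k =
    (Σ (Graph³ n) λ H → Admissible ℱ 𝒢 H × size H ≡ k)
  × (∀ (H : Graph³ n) → Admissible ℱ 𝒢 H → size H ≤ k)

Ex₃[_,_∣_] : (n : ℕ) → Family → Family → Pred (Graph³ n) (lsuc 0ℓ)
Ex₃[ n , ℱ ∣ 𝒢 ] H = Admissible ℱ 𝒢 H × ex₃[ n , ℱ ∣ 𝒢 ]≡ size H

fromEdges : ∀ {n} (es : List (Subset n)) → All (λ e → ∣ e ∣ ≡ 3) es → Graph³ n
fromEdges es u = record
  { Edge    = Membership._∈ es
  ; edge?   = λ e → DecMembership._∈?_ (≡-dec _≟ᵇ_) e es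
  ; uniform = All.lookup u
  }

triple : ∀ {n} → Fin n → Fin n → Fin n → Subset n
triple x y z = ⁅ x ⁆ ∪ ⁅ y ⁆ ∪ ⁅ z ⁆

P : Graph³ 7
P = fromEdges (triple 0F 1F 2F ∷ triple 2F 3F 4F ∷ triple 4F 5F 6F ∷ [])
              (refl ∷ refl ∷ refl ∷ [])

M : Graph³ 6
M = fromEdges (triple 0F 1F 2F ∷ triple 3F 4F 5F ∷ []) (refl ∷ refl ∷ [])

K³ : ∀ m → Graph³ m
K³ m = record
  { Edge    = λ e → ∣ e ∣ ≡ 3
  ; edge?   = λ e → ∣ e ∣ ≟ⁿ 3
  ; uniform = λ ∣e∣≡3 → ∣e∣≡3
  }

∣++∣ : ∀ {m n} (p : Subset m) (q : Subset n) → ∣ p ++ q ∣ ≡ ∣ p ∣ + ∣ q ∣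
∣++∣ []            q = refl
∣++∣ (inside  ∷ p) q = cong suc (∣++∣ p q)
∣++∣ (outside ∷ p) q = ∣++∣ p q

∣take∣+∣drop∣ : ∀ m {n} (e : Subset (m + n)) → ∣ e ∣ ≡ ∣ take m e ∣ + ∣ drop m e ∣
∣take∣+∣drop∣ m e =
  trans (cong ∣_∣ (sym (take++drop≡id m e))) (∣++∣ (take m e) (drop m e))

infixl 6 _∪ᴳ_

-- Vertex-disjoint union: G lives on the first m vertices, H on the last n.
_∪ᴳ_ : ∀ {m n} → Graph³ m → Graph³ n → Graph³ (m + n)
_∪ᴳ_ {m} {n} G H = record
  { Edge    = λ e → (Edge G (take m e) × drop m e ≡ ⊥) ⊎ (take m e ≡ ⊥ × Edge H (drop m e))
  ; edge?   = λ e → (edge? G (take m e) ×-dec ≡-dec _≟ᵇ_ (drop m e) ⊥)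
              ⊎-dec (≡-dec _≟ᵇ_ (take m e) ⊥ ×-dec edge? H (drop m e))
  ; uniform = λ {e} → λ where
      (inj₁ (g , d)) → trans (∣take∣+∣drop∣ m e)
        (cong₂ _+_ (uniform G g) (trans (cong ∣_∣ d) (∣⊥∣≡0 n)))
      (inj₂ (t , h)) → trans (∣take∣+∣drop∣ m e)
        (cong₂ _+_ (trans (cong ∣_∣ t) (∣⊥∣≡0 m)) (uniform H h))
  }

-- The comet on 4 + r vertices: c = 0, {h₁, h₂, h₃} = {1, 2, 3}, R = {4, …, 3 + r}.
comet : ∀ r → Graph³ (4 + r)
comet r = record
  { Edge    = λ e → ∣ e ∣ ≡ 3 × (e ⊆ head ⊎ (0F ∈ e × e ⊆ c∪R))
  ; edge?   = λ e → (∣ e ∣ ≟ⁿ 3) ×-dec ((e ⊆? head) ⊎-dec ((0F ∈? e) ×-dec (e ⊆? c∪R)))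
  ; uniform = proj₁
  }
  where
  head c∪R : Subset (4 + r)
  head = ⊤ {4} ++ ⊥ {r}
  c∪R  = ⁅ 0F ⁆ ++ ⊤ {r}

-- An n-vertex 3-graph for n ≥ 4 (for smaller n it has 4 vertices).
Co : ∀ n → Graph³ (4 + (n ∸ 4))
Co n = comet (n ∸ 4)

{-# OPTIONS --safe #-}

-- Induction on the number of vertices.  Two disjoint edges A and B of a path-free 3-graph are never
-- joined by an edge meeting each of them in one vertex only.  If no disjoint edges at all are met by
-- a common edge, then every component is an intersecting family, and such unions are too small.
-- Otherwise some edges 123, 456 are joined by 234 (the labels are shifted down by one below).
--   * If a further edge 4xy leaves these six vertices, then 4 is the centre of a comet up to
--     edges which cost more than they bring.
--   * If instead a further edge 1xy leaves them, there are only few edges at all.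
--   * Otherwise an outside vertex can be joined to the six vertices through the pairs 23, 45, 46
--     and 56 only, each of which destroys many edges among the six.  If none of these pairs is
--     used, then the six vertices form a component, and this is where K₆ comes from.
-- In each case the edges are counted by the number of their vertices outside the labelled ones: the
-- edges inside and the links of the outside vertices are bounded by listing the pairs of triples that
-- would complete a path, which is a computation on labels, and the edges outside by induction.
module Submission where

open import Data.Bool.Base using (Bool; true; false; T; not; _∧_; _∨_; if_then_else_)
open import Data.Bool.ListAction using (any; all)
open import Data.Bool.Properties using (T-≡; T-∧; T-∨; ¬-not) renaming (_≟_ to _≟ᵇ_)
open import Data.Empty using (⊥; ⊥-elim)
open import Data.Fin.Base using (Fin; zero; suc; toℕ; _↑ˡ_; _↑ʳ_)
open import Data.Fin.Patterns
open import Data.Fin.Permutation using (Permutation; permutation; _⟨$⟩ʳ_; _⟨$⟩ˡ_; inverseˡ; inverseʳ)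
open import Data.Fin.Properties as Finₚ using (any?; toℕ-injective) renaming (_≟_ to _≟ᶠ_)
open import Data.Fin.Subset using (Subset; ⊤; ⁅_⁆; _∪_; ∣_∣; inside; outside)
  renaming (⊥ to ∅; _∈_ to _∈ˢ_; _∉_ to _∉ˢ_; _⊆_ to _⊆ˢ_)
open import Data.Fin.Subset.Properties
  using (x∈⁅x⁆; x∈⁅y⁆⇒x≡y; ∪-identityˡ; ∪-comm; ∪-assoc; ∪-idem; ∣⁅x⁆∣≡1; ∣⊥∣≡0; x∈p∪q⁻; x∈p∪q⁺; ⊆-antisym; ∉⊥; ∈⊤)
  renaming (_∈?_ to _∈ˢ?_)
open import Data.List.Base using (List; []; _∷_; _++_; length; map; filter; filterᵇ; allFin; tabulate; upTo)
import Data.List.Membership.DecPropositional as DecMembership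
open import Data.List.Membership.Propositional as Membership using (_∈_)
open import Data.List.Membership.Propositional.Properties
  using (∈-∃++; ∈-++⁺ˡ; ∈-++⁺ʳ; ∈-++⁻; ∈-upTo⁺; ∈-filter⁺; ∈-filter⁻; ∈-allFin; ∈-map⁺; ∈-map⁻)
open import Data.List.Properties
  using (length-++; length-map; length-tabulate; map-tabulate; map-cong; map-id; filter-++)
  renaming (++-identityʳ to ++-identityʳᴸ; ++-assoc to ++-assocᴸ)
open import Data.List.Relation.Binary.Permutation.Propositional
  using (_↭_; refl; prep; swap; ↭-sym; ↭-refl; ↭-trans) renaming (trans to ↭trans)
open import Data.List.Relation.Binary.Permutation.Propositional.Properties as Permutationₚ
  using (shift; ↭-length; ∈-resp-↭; All-resp-↭; ↭-reverse)
open import Data.List.Relation.Unary.All as All using (All; []; _∷_)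
import Data.List.Relation.Unary.All.Properties as Allₚ
open import Data.List.Relation.Unary.AllPairs using ([]; _∷_)
open import Data.List.Relation.Unary.Any as Any using (Any; here; there)
open import Data.List.Relation.Unary.Any.Properties using (any⁻)
import Data.List.Relation.Unary.Unique.DecPropositional as DecUnique
open import Data.List.Relation.Unary.Unique.Propositional using (Unique)
import Data.List.Relation.Unary.Unique.Propositional.Properties as Uniqueₚ
open import Data.Nat.Base
open import Data.Nat.Combinatorics using (_C_; nCk+nC[k+1]≡[n+1]C[k+1]; nC1≡n)
open import Data.Nat.Induction using (<-wellFounded)
open import Data.Nat.Properties
open import Data.Nat.Solver using (module +-*-Solver)
open import Data.Nat.Tactic.RingSolver using (solve-∀)
open import Data.Product.Base using (∃; ∃-syntax; _×_; _,_; proj₁; proj₂)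
open import Data.Sum.Base using (_⊎_; inj₁; inj₂; [_,_]′)
open import Data.Unit.Base using (tt)
open import Data.Vec.Base as Vec using (Vec; []; _∷_; lookup; toList)
open import Data.Vec.Properties
  using (length-toList; toList-map; toList-++; toList∘fromList; lookup∘tabulate; lookup-map; lookup-++ˡ; lookup-++ʳ;
         []=⇒lookup; lookup⇒[]=; zipWith-++; take++drop≡id; ++-injective)
open import Defs
open import Function.Base using (_∘_; id; case_of_)
open import Function.Bundles using (_⇔_; mk⇔; Equivalence)
open import Induction.WellFounded using (Acc; acc)
open import Level using (0ℓ)
open import Relation.Binary.PropositionalEquality
open import Relation.Nullary using (¬_; Dec; yes; no; does)
open import Relation.Nullary.Decidable using (_×-dec_; _⊎-dec_; ¬?; True; toWitness; map′; dec-true; dec-false; does-⇔)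
open import Relation.Unary using (Pred; Decidable; ｛_｝)
open +-*-Solver using (solve; _:=_; _:+_)

-- Bound and uniqueness come from one case analysis: each case either falls strictly short of
-- `condTurán` or yields a vertex partition which makes the 3-graph a subgraph of an extremal one.
-- At the maximum only the latter remains, and comparing numbers of edges turns the inclusion into
-- an isomorphism. The induction cannot stay among 3-graphs with two disjoint edges: a smaller
-- vertex set may have lost them, and then a full star, with C(n-1,2) edges, may beat the
-- conditional maximum. The hypothesis handed to the cases is therefore the weaker bound
-- `freeTurán`, valid in both situations. At n = 13 a block of six leaves seven vertices with at
-- most 20 edges, and 20 + 20 equals the 4 + 36 edges of the comet. This tie is why the remainder of
-- size seven needs more than the numerical hypothesis. Since `condTurán` changes shape there,
-- inequalities with it are checked in a finite box and continued by comparing increments.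

private variable
  A B : Set
  m n : ℕ

-- Sums over the entries, pairs and triples of a list.

sum1 : (A → ℕ) → List A → ℕ
sum1 f []       = 0
sum1 f (x ∷ xs) = f x + sum1 f xs

sum2 : (A → A → ℕ) → List A → ℕ
sum2 f []       = 0
sum2 f (x ∷ xs) = sum1 (f x) xs + sum2 f xs

sum3 : (A → A → A → ℕ) → List A → ℕ
sum3 f []       = 0
sum3 f (x ∷ xs) = sum2 (f x) xs + sum3 f xs

binom2 binom3 : ℕ → ℕ
binom2 zero    = 0
binom2 (suc n) = n + binom2 n
binom3 zero    = 0
binom3 (suc n) = binom2 n + binom3 n

record Sym3 {B : Set} (f : A → A → A → B) : Set where
  field
    swap12 : ∀ x y z → f x y z ≡ f y x z
    swap23 : ∀ x y z → f x y z ≡ f x z y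
open Sym3 public

sum1-mono : ∀ {f g : A → ℕ} xs → (∀ {x} → x ∈ xs → f x ≤ g x) → sum1 f xs ≤ sum1 g xs
sum1-mono []       le = z≤n
sum1-mono (x ∷ xs) le = +-mono-≤ (le (here refl)) (sum1-mono xs (le ∘ there))

sum2-mono : ∀ {f g : A → A → ℕ} {xs} → Unique xs →
            (∀ {x y} → x ∈ xs → y ∈ xs → x ≢ y → f x y ≤ g x y) → sum2 f xs ≤ sum2 g xs
sum2-mono []       le = z≤n
sum2-mono {xs = x ∷ xs} (x∉ ∷ u) le =
  +-mono-≤ (sum1-mono xs λ y∈ → le (here refl) (there y∈) (All.lookup x∉ y∈))
           (sum2-mono u λ y∈ z∈ → le (there y∈) (there z∈))

sum3-mono : ∀ {f g : A → A → A → ℕ} {xs} → Unique xs →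
            (∀ {x y z} → x ∈ xs → y ∈ xs → z ∈ xs → x ≢ y → x ≢ z → y ≢ z → f x y z ≤ g x y z) →
            sum3 f xs ≤ sum3 g xs
sum3-mono []       le = z≤n
sum3-mono {xs = x ∷ xs} (x∉ ∷ u) le =
  +-mono-≤ (sum2-mono u λ y∈ z∈ y≢z → le (here refl) (there y∈) (there z∈) (All.lookup x∉ y∈) (All.lookup x∉ z∈) y≢z)
           (sum3-mono u λ y∈ z∈ w∈ → le (there y∈) (there z∈) (there w∈))

sum1-const : ∀ c (xs : List A) → sum1 (λ _ → c) xs ≡ c * length xs
sum1-const c []       = sym (*-zeroʳ c)
sum1-const c (x ∷ xs) = trans (cong (c +_) (sum1-const c xs)) (sym (*-suc c (length xs)))

sum2-const1 : ∀ (xs : List A) → sum2 (λ _ _ → 1) xs ≡ binom2 (length xs)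
sum2-const1 []       = refl
sum2-const1 (x ∷ xs) = cong₂ _+_ (trans (sum1-const 1 xs) (*-identityˡ _)) (sum2-const1 xs)

sum3-const1 : ∀ (xs : List A) → sum3 (λ _ _ _ → 1) xs ≡ binom3 (length xs)
sum3-const1 []       = refl
sum3-const1 (x ∷ xs) = cong₂ _+_ (sum2-const1 xs) (sum3-const1 xs)

sum2-const0 : ∀ (xs : List A) → sum2 (λ _ _ → 0) xs ≡ 0
sum2-const0 []       = refl
sum2-const0 (x ∷ xs) = cong₂ _+_ (sum1-const 0 xs) (sum2-const0 xs)

sum3-const0 : ∀ (xs : List A) → sum3 (λ _ _ _ → 0) xs ≡ 0
sum3-const0 []       = refl
sum3-const0 (x ∷ xs) = cong₂ _+_ (sum2-const0 xs) (sum3-const0 xs)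

sum1-≤ : ∀ {f : A → ℕ} c xs → (∀ {x} → x ∈ xs → f x ≤ c) → sum1 f xs ≤ c * length xs
sum1-≤ c xs le = ≤-trans (sum1-mono xs le) (≤-reflexive (sum1-const c xs))

sum2-≤1 : ∀ {f : A → A → ℕ} {xs} → Unique xs →
          (∀ {x y} → x ∈ xs → y ∈ xs → x ≢ y → f x y ≤ 1) → sum2 f xs ≤ binom2 (length xs)
sum2-≤1 {xs = xs} u le = ≤-trans (sum2-mono u le) (≤-reflexive (sum2-const1 xs))

sum1-0 : ∀ {f : A → ℕ} xs → (∀ {x} → x ∈ xs → f x ≡ 0) → sum1 f xs ≡ 0
sum1-0 xs eq = n≤0⇒n≡0 (sum1-≤ 0 xs (≤-reflexive ∘ eq))

sum2-0 : ∀ {f : A → A → ℕ} {xs} → Unique xs →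
         (∀ {x y} → x ∈ xs → y ∈ xs → x ≢ y → f x y ≡ 0) → sum2 f xs ≡ 0
sum2-0 {xs = xs} u eq =
  n≤0⇒n≡0 (≤-trans (sum2-mono u λ x∈ y∈ x≢y → ≤-reflexive (eq x∈ y∈ x≢y)) (≤-reflexive (sum2-const0 xs)))

sum3-0 : ∀ {f : A → A → A → ℕ} {xs} → Unique xs →
         (∀ {x y z} → x ∈ xs → y ∈ xs → z ∈ xs → x ≢ y → x ≢ z → y ≢ z → f x y z ≡ 0) → sum3 f xs ≡ 0
sum3-0 {xs = xs} u eq =
  n≤0⇒n≡0 (≤-trans (sum3-mono u λ a b c d e f → ≤-reflexive (eq a b c d e f)) (≤-reflexive (sum3-const0 xs)))

sum1-cong : ∀ {f g : A → ℕ} xs → (∀ x → f x ≡ g x) → sum1 f xs ≡ sum1 g xs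
sum1-cong []       eq = refl
sum1-cong (x ∷ xs) eq = cong₂ _+_ (eq x) (sum1-cong xs eq)

sum2-cong : ∀ {f g : A → A → ℕ} xs → (∀ x y → f x y ≡ g x y) → sum2 f xs ≡ sum2 g xs
sum2-cong []       eq = refl
sum2-cong (x ∷ xs) eq = cong₂ _+_ (sum1-cong xs (eq x)) (sum2-cong xs eq)

sum3-cong : ∀ {f g : A → A → A → ℕ} xs → (∀ x y z → f x y z ≡ g x y z) → sum3 f xs ≡ sum3 g xs
sum3-cong []       eq = refl
sum3-cong (x ∷ xs) eq = cong₂ _+_ (sum2-cong xs (eq x)) (sum3-cong xs eq)

sum1-map : ∀ (f : B → ℕ) (g : A → B) xs → sum1 f (map g xs) ≡ sum1 (f ∘ g) xs
sum1-map f g []       = refl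
sum1-map f g (x ∷ xs) = cong (f (g x) +_) (sum1-map f g xs)

sum2-map : ∀ (f : B → B → ℕ) (g : A → B) xs → sum2 f (map g xs) ≡ sum2 (λ x y → f (g x) (g y)) xs
sum2-map f g []       = refl
sum2-map f g (x ∷ xs) = cong₂ _+_ (sum1-map (f (g x)) g xs) (sum2-map f g xs)

sum3-map : ∀ (f : B → B → B → ℕ) (g : A → B) xs → sum3 f (map g xs) ≡ sum3 (λ x y z → f (g x) (g y) (g z)) xs
sum3-map f g []       = refl
sum3-map f g (x ∷ xs) = cong₂ _+_ (sum2-map (f (g x)) g xs) (sum3-map f g xs)

private
  interchange : ∀ a b c d → (a + b) + (c + d) ≡ (a + c) + (b + d)
  interchange = solve 4 (λ a b c d → (a :+ b) :+ (c :+ d) := (a :+ c) :+ (b :+ d)) refl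

sum1-+ : ∀ (f g : A → ℕ) xs → sum1 (λ x → f x + g x) xs ≡ sum1 f xs + sum1 g xs
sum1-+ f g []       = refl
sum1-+ f g (x ∷ xs) = trans (cong (f x + g x +_) (sum1-+ f g xs)) (interchange (f x) (g x) _ _)

sum2-+ : ∀ (f g : A → A → ℕ) xs → sum2 (λ x y → f x y + g x y) xs ≡ sum2 f xs + sum2 g xs
sum2-+ f g []       = refl
sum2-+ f g (x ∷ xs) =
  trans (cong₂ _+_ (sum1-+ (f x) (g x) xs) (sum2-+ f g xs)) (interchange (sum1 (f x) xs) _ _ _)

sum1-swap : ∀ (f : A → B → ℕ) xs ys → sum1 (λ x → sum1 (f x) ys) xs ≡ sum1 (λ y → sum1 (λ x → f x y) xs) ys
sum1-swap f []       ys = sym (sum1-const 0 ys)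
sum1-swap f (x ∷ xs) ys =
  trans (cong (sum1 (f x) ys +_) (sum1-swap f xs ys)) (sym (sum1-+ (f x) (λ y → sum1 (λ x → f x y) xs) ys))

sum1-++ : ∀ (f : A → ℕ) xs ys → sum1 f (xs ++ ys) ≡ sum1 f xs + sum1 f ys
sum1-++ f []       ys = refl
sum1-++ f (x ∷ xs) ys = trans (cong (f x +_) (sum1-++ f xs ys)) (sym (+-assoc (f x) _ _))

sum2-++ : ∀ (f : A → A → ℕ) xs ys →
          sum2 f (xs ++ ys) ≡ sum2 f xs + sum1 (λ y → sum1 (λ x → f x y) xs) ys + sum2 f ys
sum2-++ f []       ys = cong (_+ sum2 f ys) (sym (sum1-const 0 ys))
sum2-++ f (x ∷ xs) ys = begin
  sum1 (f x) (xs ++ ys) + sum2 f (xs ++ ys)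
    ≡⟨ cong₂ _+_ (sum1-++ (f x) xs ys) (sum2-++ f xs ys) ⟩
  (sum1 (f x) xs + sum1 (f x) ys) + (sum2 f xs + cross + sum2 f ys)
    ≡⟨ solve 5 (λ a b c d e → (a :+ b) :+ (c :+ d :+ e) := (a :+ c) :+ (b :+ d) :+ e) refl
         (sum1 (f x) xs) (sum1 (f x) ys) (sum2 f xs) cross (sum2 f ys) ⟩
  (sum1 (f x) xs + sum2 f xs) + (sum1 (f x) ys + cross) + sum2 f ys
    ≡⟨ cong (λ s → (sum1 (f x) xs + sum2 f xs) + s + sum2 f ys) (sym (sum1-+ (f x) _ ys)) ⟩
  sum2 f (x ∷ xs) + sum1 (λ y → sum1 (λ x → f x y) (x ∷ xs)) ys + sum2 f ys ∎
  where
  open ≡-Reasoning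
  cross = sum1 (λ y → sum1 (λ x → f x y) xs) ys

-- The four summands sort the triples by how many of their entries come from `ys`. Symmetry is
-- needed because an entry of `ys` is moved to the first place, so that the second summand is a sum
-- of links.
sum3-++ : ∀ {f : A → A → A → ℕ} → Sym3 f → ∀ xs ys →
          sum3 f (xs ++ ys) ≡ sum3 f xs + sum1 (λ y → sum2 (f y) xs) ys
                              + sum2 (λ y z → sum1 (λ x → f x y z) xs) ys + sum3 f ys
sum3-++ {f = f} s []       ys =
  cong (_+ sum3 f ys) (sym (cong₂ _+_ (sum1-const 0 ys) (sum2-const0 ys)))
sum3-++ {f = f} s (x ∷ xs) ys = begin
  sum2 (f x) (xs ++ ys) + sum3 f (xs ++ ys)
    ≡⟨ cong₂ _+_ (sum2-++ (f x) xs ys) (sum3-++ s xs ys) ⟩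
  (sum2 (f x) xs + c1 + sum2 (f x) ys) + (sum3 f xs + c2 + c3 + sum3 f ys)
    ≡⟨ solve 7 (λ a b c d e f g → (a :+ b :+ c) :+ (d :+ e :+ f :+ g) := (a :+ d) :+ (b :+ e) :+ (c :+ f) :+ g) refl
         (sum2 (f x) xs) c1 (sum2 (f x) ys) (sum3 f xs) c2 c3 (sum3 f ys) ⟩
  (sum2 (f x) xs + sum3 f xs) + (c1 + c2) + (sum2 (f x) ys + c3) + sum3 f ys
    ≡⟨ cong₂ (λ a b → (sum2 (f x) xs + sum3 f xs) + a + b + sum3 f ys)
         (sym (trans (sum1-cong ys (λ y → cong (_+ sum2 (f y) xs) (sum1-cong xs λ z → turn x y z)))
              (sum1-+ (λ y → sum1 (λ z → f x z y) xs) (λ y → sum2 (f y) xs) ys)))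
         (sym (sum2-+ (f x) _ ys)) ⟩
  sum3 f (x ∷ xs) + sum1 (λ y → sum2 (f y) (x ∷ xs)) ys
    + sum2 (λ y z → sum1 (λ x → f x y z) (x ∷ xs)) ys + sum3 f ys ∎
  where
  open ≡-Reasoning
  turn : ∀ x y z → f y x z ≡ f x z y
  turn x y z = trans (swap12 s y x z) (swap23 s x y z)
  c1 = sum1 (λ y → sum1 (λ z → f x z y) xs) ys
  c2 = sum1 (λ y → sum2 (f y) xs) ys
  c3 = sum2 (λ y z → sum1 (λ x → f x y z) xs) ys

sum1-↭ : ∀ (f : A → ℕ) {xs ys} → xs ↭ ys → sum1 f xs ≡ sum1 f ys
sum1-↭ f refl          = refl
sum1-↭ f (prep x p)    = cong (f x +_) (sum1-↭ f p)
sum1-↭ f (swap x y p)  =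
  trans (cong (λ s → f x + (f y + s)) (sum1-↭ f p))
        (solve 3 (λ a b c → a :+ (b :+ c) := b :+ (a :+ c)) refl (f x) (f y) _)
sum1-↭ f (↭trans p q)   = trans (sum1-↭ f p) (sum1-↭ f q)

sum2-↭ : ∀ {f : A → A → ℕ} → (∀ x y → f x y ≡ f y x) → ∀ {xs ys} → xs ↭ ys → sum2 f xs ≡ sum2 f ys
sum2-↭ s refl         = refl
sum2-↭ {f = f} s (prep x p)   = cong₂ _+_ (sum1-↭ (f x) p) (sum2-↭ s p)
sum2-↭ {f = f} s {xs = _ ∷ _ ∷ xs} {_ ∷ _ ∷ ys} (swap x y p) =
  trans (cong₂ _+_ (cong₂ _+_ (s x y) (sum1-↭ (f x) p)) (cong₂ _+_ (sum1-↭ (f y) p) (sum2-↭ s p)))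
        (solve 4 (λ a b c d → (a :+ b) :+ (c :+ d) := (a :+ c) :+ (b :+ d)) refl
           (f y x) (sum1 (f x) ys) (sum1 (f y) ys) (sum2 f ys))
sum2-↭ s (↭trans p q)  = trans (sum2-↭ s p) (sum2-↭ s q)

sum3-↭ : ∀ {f : A → A → A → ℕ} → Sym3 f → ∀ {xs ys} → xs ↭ ys → sum3 f xs ≡ sum3 f ys
sum3-↭ s refl         = refl
sum3-↭ {f = f} s (prep x p)   = cong₂ _+_ (sum2-↭ (swap23 s x) p) (sum3-↭ s p)
sum3-↭ {f = f} s {xs = _ ∷ _ ∷ xs} {_ ∷ _ ∷ ys} (swap x y p) =
  trans (cong₂ _+_ (cong₂ _+_ (trans (sum1-↭ (f x y) p) (sum1-cong ys (swap12 s x y))) (sum2-↭ (swap23 s x) p))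
                   (cong₂ _+_ (sum2-↭ (swap23 s y) p) (sum3-↭ s p)))
        (solve 4 (λ a b c d → (a :+ b) :+ (c :+ d) := (a :+ c) :+ (b :+ d)) refl
           (sum1 (f y x) ys) (sum2 (f x) ys) (sum2 (f y) ys) (sum3 f ys))
sum3-↭ s (↭trans p q)  = trans (sum3-↭ s p) (sum3-↭ s q)

Unique-↭ : ∀ {xs ys : List A} → xs ↭ ys → Unique xs → Unique ys
Unique-↭ refl         u              = u
Unique-↭ (prep x p)   (x∉ ∷ u)       = All-resp-↭ p x∉ ∷ Unique-↭ p u
Unique-↭ (swap x y p) ((x≢y ∷ x∉) ∷ y∉ ∷ u) =
  (x≢y ∘ sym ∷ All-resp-↭ p y∉) ∷ All-resp-↭ p x∉ ∷ Unique-↭ p u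
Unique-↭ (↭trans p q)  u              = Unique-↭ q (Unique-↭ p u)

Unique-++ˡ : ∀ (xs : List A) {ys} → Unique (xs ++ ys) → Unique xs
Unique-++ˡ []       u        = []
Unique-++ˡ (x ∷ xs) (x∉ ∷ u) = all-++ˡ xs x∉ ∷ Unique-++ˡ xs u
  where
  all-++ˡ : ∀ {P : Pred A 0ℓ} xs {ys} → All P (xs ++ ys) → All P xs
  all-++ˡ []       _        = []
  all-++ˡ (x ∷ xs) (p ∷ ps) = p ∷ all-++ˡ xs ps

Unique-++ʳ : ∀ (xs : List A) {ys} → Unique (xs ++ ys) → Unique ys
Unique-++ʳ []       u       = u
Unique-++ʳ (x ∷ xs) (_ ∷ u) = Unique-++ʳ xs u

split-off : ∀ {xs V : List A} → Unique xs → All (_∈ V) xs → ∃[ W ] V ↭ xs ++ W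
split-off {V = V} [] [] = V , ↭-refl
split-off {xs = x ∷ xs} {V} (x∉ ∷ u) (x∈ ∷ xs∈) with ∈-∃++ x∈
... | as , bs , refl =
  let V' = as ++ bs
      W , p = split-off u (All.zipWith (λ (x≢y , y∈) → drop-head x≢y (∈-resp-↭ (shift x as bs) y∈)) (x∉ , xs∈))
  in W , ↭-trans (shift x as bs) (prep x p)
  where
  drop-head : ∀ {x y} {V : List _} → x ≢ y → y ∈ x ∷ V → y ∈ V
  drop-head x≢y (here refl) = ⊥-elim (x≢y refl)
  drop-head x≢y (there y∈)  = y∈

filter-split-↭ : ∀ {P : Pred A 0ℓ} (P? : Decidable P) xs → xs ↭ filter P? xs ++ filter (¬? ∘ P?) xs
filter-split-↭ P? [] = ↭-refl
filter-split-↭ P? (x ∷ xs) with P? x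
... | yes _ = prep x (filter-split-↭ P? xs)
... | no _  = ↭-trans (prep x (filter-split-↭ P? xs)) (↭-sym (shift x (filter P? xs) _))

bit : Bool → ℕ
bit true  = 1
bit false = 0

bit-≤1 : ∀ b → bit b ≤ 1
bit-≤1 true  = ≤-refl
bit-≤1 false = z≤n

bit-false : ∀ {b} → ¬ (b ≡ true) → bit b ≡ 0
bit-false {true}  ¬b = ⊥-elim (¬b refl)
bit-false {false} ¬b = refl

private
  ≡⇒T : ∀ {b} → b ≡ true → T b
  ≡⇒T = Equivalence.from T-≡

-- An upper bound computed from conflicts between items.

Triple : Set → Set
Triple A = A × A × A

pairs : List A → List (A × A)
pairs []       = []
pairs (x ∷ xs) = map (x ,_) xs ++ pairs xs

triples : List A → List (Triple A)
triples []       = []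
triples (x ∷ xs) = map (x ,_) (pairs xs) ++ triples xs

sum2-pairs : ∀ (f : A → A → ℕ) xs → sum2 f xs ≡ sum1 (λ (x , y) → f x y) (pairs xs)
sum2-pairs f []       = refl
sum2-pairs f (x ∷ xs) =
  trans (cong₂ _+_ (sym (sum1-map _ (x ,_) xs)) (sum2-pairs f xs)) (sym (sum1-++ _ (map (x ,_) xs) _))

sum3-triples : ∀ (f : A → A → A → ℕ) xs → sum3 f xs ≡ sum1 (λ (x , y , z) → f x y z) (triples xs)
sum3-triples f []       = refl
sum3-triples f (x ∷ xs) =
  trans (cong₂ _+_ (trans (sum2-pairs (f x) xs) (sym (sum1-map _ (x ,_) (pairs xs)))) (sum3-triples f xs))
        (sym (sum1-++ _ (map (x ,_) (pairs xs)) _))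

-- An upper bound on the number of items t ∈ L with val t, when no three items in
-- the relation conf hold together, the items of K hold and those of N do not.  Items
-- which conflict with two members of K are dropped; the rest are matched greedily,
-- two items which conflict with a member of K counting only once.
module Bound {I : Set} (_==_ : I → I → Bool) (conf : I → I → I → Bool) where

  killed : List I → I → Bool
  killed K t = any (λ y → any (conf t y) K) K

  clash : List I → I → I → Bool
  clash K t s = any (conf t s) K

  removeFirst : (I → Bool) → List I → List I
  removeFirst p []       = []
  removeFirst p (x ∷ xs) = if p x then xs else x ∷ removeFirst p xs

  greedy : ℕ → List I → List I → ℕ
  -- Any bound would be sound here. The fuel is the length of the list before filtering, so the list
  -- is already exhausted when this clause is reached from `bound`.
  greedy zero    K L       = length L
  greedy (suc n) K []      = 0
  greedy (suc n) K (t ∷ L) = suc (greedy n K (removeFirst (clash K t) L))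

  alive : List I → List I → List I → List I
  alive K N = filterᵇ λ t → not (killed K t ∨ any (t ==_) N)

  bound : List I → List I → List I → ℕ
  bound K N L = greedy (length L) K (alive K N L)

  module Sound (val : I → Bool)
               (==-sound : ∀ {s t} → T (s == t) → s ≡ t)
               (conf-sound : ∀ {x y z} → T (conf x y z) → val x ≡ true → val y ≡ true → val z ≡ true → ⊥)
               {K} (K✓ : All (λ t → val t ≡ true) K) where

    private
      w : I → ℕ
      w = bit ∘ val

      find : ∀ p → T (any p K) → ∃[ y ] val y ≡ true × T (p y)
      find p h = let y , y∈ , py = Membership.find (any⁻ p K h) in y , All.lookup K✓ y∈ , py

    killed-absent : ∀ t → T (killed K t) → val t ≡ false
    killed-absent t kt with val t in eq
    ... | false = refl
    ... | true  = let y , vy , h = find _ kt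
                      z , vz , c = find _ h
                  in ⊥-elim (conf-sound c eq vy vz)

    clash-absent : ∀ t s → T (clash K t s) → w t + w s ≤ 1
    clash-absent t s c with val t in eq₁ | val s in eq₂
    ... | false | b     = bit-≤1 b
    ... | true  | false = ≤-refl
    ... | true  | true  = let z , vz , c = find _ c in ⊥-elim (conf-sound c eq₁ eq₂ vz)

    -- This is how the same computation refutes a configuration: some member of `K` conflicts with
    -- two others, although all of them hold.
    inconsistent : T (any (killed K) K) → ⊥
    inconsistent h with find _ h
    ... | t , vt , kt with trans (sym vt) (killed-absent t kt)
    ... | ()

    private
      length-bound : ∀ L → sum1 w L ≤ length L
      length-bound L = ≤-trans (sum1-≤ 1 L λ {x} _ → bit-≤1 (val x)) (≤-reflexive (*-identityˡ _))

      removeFirst-sum : ∀ t L → w t + sum1 w L ≤ 1 + sum1 w (removeFirst (clash K t) L)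
      removeFirst-sum t []      = +-monoˡ-≤ 0 (bit-≤1 (val t))
      removeFirst-sum t (s ∷ L) with clash K t s in eq
      ... | true  = ≤-trans (≤-reflexive (sym (+-assoc (w t) (w s) _)))
                            (+-monoˡ-≤ (sum1 w L) (clash-absent t s (≡⇒T eq)))
      ... | false = begin
        w t + (w s + sum1 w L) ≡⟨ +-comm (w t) _ ⟩
        (w s + sum1 w L) + w t ≡⟨ +-assoc (w s) _ _ ⟩
        w s + (sum1 w L + w t) ≡⟨ cong (w s +_) (+-comm _ (w t)) ⟩
        w s + (w t + sum1 w L) ≤⟨ +-monoʳ-≤ (w s) (removeFirst-sum t L) ⟩
        w s + suc (sum1 w (removeFirst (clash K t) L)) ≡⟨ +-suc (w s) _ ⟩
        suc (w s + sum1 w (removeFirst (clash K t) L)) ∎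
        where open ≤-Reasoning

      greedy-bound : ∀ n L → sum1 w L ≤ greedy n K L
      greedy-bound zero    L       = length-bound L
      greedy-bound (suc n) []      = z≤n
      greedy-bound (suc n) (t ∷ L) =
        ≤-trans (removeFirst-sum t L) (s≤s (greedy-bound n (removeFirst (clash K t) L)))

    module _ {N} (N✓ : All (λ t → val t ≡ false) N) where
      private
        dead : ∀ t → T (killed K t ∨ any (t ==_) N) → w t ≡ 0
        dead t h with Equivalence.to T-∨ h
        ... | inj₁ kt = cong bit (killed-absent t kt)
        ... | inj₂ t∈ = cong bit (absent (any⁻ (t ==_) N t∈) N✓)
          where
          absent : ∀ {N} → Any (T ∘ (t ==_)) N → All (λ t → val t ≡ false) N → val t ≡ false
          absent (here e)  (v ∷ _)  = trans (cong val (==-sound e)) v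
          absent (there a) (_ ∷ vs) = absent a vs

        alive-sum : ∀ L → sum1 w L ≡ sum1 w (alive K N L)
        alive-sum []      = refl
        alive-sum (t ∷ L) with killed K t ∨ any (t ==_) N in eq
        ... | true  = cong₂ _+_ (dead t (≡⇒T eq)) (alive-sum L)
        ... | false = cong (w t +_) (alive-sum L)

      bound-sound : ∀ L → sum1 w L ≤ bound K N L
      bound-sound L = ≤-trans (≤-reflexive (alive-sum L)) (greedy-bound (length L) (alive K N L))

    killed-all : ∀ {J : Set} (f : J → I) L → All (λ j → val (f j) ≡ false) (filterᵇ (killed K ∘ f) L)
    killed-all f []      = []
    killed-all f (j ∷ L) with killed K (f j) in eq
    ... | true  = killed-absent (f j) (≡⇒T eq) ∷ killed-all f L
    ... | false = killed-all f L

-- Loose paths and disjoint edges as conflicts between triples of labels.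

-- A Boolean test through natural numbers, since the bounds are evaluated during type checking and
-- carry no proofs along.
_≡ᶠ_ : Fin m → Fin m → Bool
i ≡ᶠ j = toℕ i ≡ᵇ toℕ j

≡ᶠ-sound : ∀ {i j : Fin m} → T (i ≡ᶠ j) → i ≡ j
≡ᶠ-sound {i = i} {j} h = toℕ-injective (≡ᵇ⇒≡ (toℕ i) (toℕ j) h)

≡ᶠ-refl : ∀ (i : Fin m) → T (i ≡ᶠ i)
≡ᶠ-refl i = ≡⇒≡ᵇ (toℕ i) (toℕ i) refl

_≡ᵗ_ : Triple (Fin m) → Triple (Fin m) → Bool
(a , b , c) ≡ᵗ (d , e , f) = (a ≡ᶠ d) ∧ (b ≡ᶠ e) ∧ (c ≡ᶠ f)

≡ᵗ-sound : ∀ {s t : Triple (Fin m)} → T (s ≡ᵗ t) → s ≡ t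
≡ᵗ-sound h with Equivalence.to T-∧ h
... | p , h' with Equivalence.to T-∧ h'
... | q , r = cong₂ _,_ (≡ᶠ-sound p) (cong₂ _,_ (≡ᶠ-sound q) (≡ᶠ-sound r))

distinct : List (Fin m) → Bool
distinct []       = true
distinct (x ∷ xs) = all (λ y → not (x ≡ᶠ y)) xs ∧ distinct xs

distinct-sound : ∀ (xs : List (Fin m)) → T (distinct xs) → Unique xs
distinct-sound []       _ = []
distinct-sound (x ∷ xs) h with Equivalence.to T-∧ h
... | p , q = All.map differ (Allₚ.all⁺ _ xs p) ∷ distinct-sound xs q
  where
  differ : ∀ {y} → T (not (x ≡ᶠ y)) → x ≢ y
  differ ne refl with x ≡ᶠ x | ≡ᶠ-refl x
  differ () refl | true | _

-- In a path an end edge is determined by the choice of its joint, which rotations provide. The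
-- middle edge has an ordered pair of joints, which takes all six arrangements.
arrangements rotations : Triple A → List (Triple A)
arrangements (a , b , c) = (a , b , c) ∷ (b , c , a) ∷ (c , a , b) ∷ (a , c , b) ∷ (b , a , c) ∷ (c , b , a) ∷ []
rotations    (a , b , c) = (a , b , c) ∷ (b , c , a) ∷ (c , a , b) ∷ []

joined : Triple (Fin m) → Triple (Fin m) → Bool
-- In `loosePath` the second triple is the middle edge. As paths can be reversed, `pathConf` only
-- has to choose the middle edge, which leaves three of the six orders. The conflict of two disjoint
-- edges is binary; `matchConf` ignores its third argument to fit the ternary interface, so it takes
-- effect as soon as `K` is nonempty.
loosePath loosePath′ pathConf matchConf : Triple (Fin m) → Triple (Fin m) → Triple (Fin m) → Bool
joined (_ , _ , c) (c′ , _ , _) = c ≡ᶠ c′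
loosePath′ (a , b , c) (_ , d , e) (e′ , f , g) =
  (e ≡ᶠ e′) ∧ distinct (a ∷ b ∷ c ∷ d ∷ e ∷ f ∷ g ∷ [])
loosePath x y z =
  any (λ x′ → any (λ y′ → joined x′ y′ ∧ any (loosePath′ x′ y′) (rotations z)) (arrangements y)) (rotations x)
pathConf x y z = loosePath x y z ∨ loosePath y x z ∨ loosePath x z y
matchConf (a , b , c) (d , e , f) _ = distinct (a ∷ b ∷ c ∷ d ∷ e ∷ f ∷ [])

-- 3-graphs on a vertex type and the edges among labelled vertices.

-- Edges are a symmetric Boolean function rather than a set of subsets: counts become sums of bits
-- over lists of vertices, and the edges among labelled vertices become the Boolean values which
-- `Bound` expects. The other cases of equal arguments follow from `irrefl` by symmetry.
record 3Graph (A : Set) : Set where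
  field
    edge   : A → A → A → Bool
    symm   : Sym3 edge
    irrefl : ∀ x y → edge x x y ≡ false

  Adj : A → A → A → Set
  Adj x y z = edge x y z ≡ true

  wt : A → A → A → ℕ
  wt x y z = bit (edge x y z)

  wt-sym : Sym3 wt
  wt-sym = record { swap12 = λ x y z → cong bit (swap12 symm x y z)
                  ; swap23 = λ x y z → cong bit (swap23 symm x y z) }

  count : List A → ℕ
  count = sum3 wt

  rotate : ∀ {x y z} → Adj x y z → Adj y z x
  rotate {x} {y} {z} h = trans (sym (trans (swap12 symm x y z) (swap23 symm y x z))) h

  flip₁ : ∀ {x y z} → Adj x y z → Adj y x z
  flip₁ {x} {y} {z} h = trans (sym (swap12 symm x y z)) h

  flip₂ : ∀ {x y z} → Adj x y z → Adj x z y
  flip₂ {x} {y} {z} h = trans (sym (swap23 symm x y z)) h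

  flip₁₃ : ∀ {x y z} → Adj x y z → Adj z y x
  flip₁₃ h = flip₁ (rotate h)

  PathFree : Set
  PathFree = ∀ {a b c d e f g} → Unique (a ∷ b ∷ c ∷ d ∷ e ∷ f ∷ g ∷ []) →
             Adj a b c → Adj c d e → Adj e f g → ⊥

  edge-distinct : ∀ {x y z} → Adj x y z → x ≢ y × x ≢ z × y ≢ z
  edge-distinct {x} {y} {z} h = ne h , ne (flip₂ h) , ne (rotate h)
    where
    ne : ∀ {x y z} → Adj x y z → x ≢ y
    ne {x} {y} {z} h refl with trans (sym h) (irrefl x z)
    ... | ()

  valueAt : Vec A m → Triple (Fin m) → Bool
  valueAt v (i , j , k) = edge (lookup v i) (lookup v j) (lookup v k)


lookup∈ : ∀ (v : Vec A m) i → lookup v i ∈ toList v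
lookup∈ (x ∷ v) zero    = here refl
lookup∈ (x ∷ v) (suc i) = there (lookup∈ v i)

lookup-index : ∀ {v : Vec A m} {x} → x ∈ toList v → ∃[ i ] lookup v i ≡ x
lookup-index {v = _ ∷ _} (here refl) = 0F , refl
lookup-index {v = _ ∷ _} (there x∈)  = let i , eq = lookup-index x∈ in suc i , eq

lookup-inj : ∀ {v : Vec A m} → Unique (toList v) → ∀ {i j} → lookup v i ≡ lookup v j → i ≡ j
lookup-inj {v = x ∷ v} (x∉ ∷ u) {zero}  {zero}  eq = refl
lookup-inj {v = x ∷ v} (x∉ ∷ u) {zero}  {suc j} eq = ⊥-elim (All.lookup x∉ (lookup∈ v j) eq)
lookup-inj {v = x ∷ v} (x∉ ∷ u) {suc i} {zero}  eq = ⊥-elim (All.lookup x∉ (lookup∈ v i) (sym eq))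
lookup-inj {v = x ∷ v} (x∉ ∷ u) {suc i} {suc j} eq = cong suc (lookup-inj u eq)

toList-lookup : ∀ (v : Vec A m) → toList v ≡ map (lookup v) (allFin m)
toList-lookup {m = zero}  []      = refl
toList-lookup {m = suc m} (x ∷ v) =
  cong (x ∷_) (trans (toList-lookup v)
    (trans (map-tabulate id (lookup v)) (sym (map-tabulate suc (lookup (x ∷ v))))))

-- The conflicts are checked by computation on the labels of v, so that v itself may be arbitrary.
module Labelled {A : Set} (G : 3Graph A) {m} (v : Vec A m) (u : Unique (toList v))
                (conf : Triple (Fin m) → Triple (Fin m) → Triple (Fin m) → Bool)
                (conf-sound : ∀ {x y z} → T (conf x y z) → 3Graph.valueAt G v x ≡ true →
                              3Graph.valueAt G v y ≡ true → 3Graph.valueAt G v z ≡ true → ⊥)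
                where
  open 3Graph G
  open Bound _≡ᵗ_ conf public

  module _ {K} (K✓ : All (λ t → valueAt v t ≡ true) K) where
    open Sound (valueAt v) ≡ᵗ-sound conf-sound K✓ public

triplesᶠ : ∀ m → List (Triple (Fin m))
triplesᶠ m = triples (allFin m)

-- The triples of 1+m labels, resp. 2+m labels, containing the first label, resp. the first two.
linksᶠ : ∀ m → List (Triple (Fin (1 + m)))
linksᶠ m = map (λ (i , j) → 0F , suc i , suc j) (pairs (allFin m))

colinksᶠ : ∀ m → List (Triple (Fin (2 + m)))
colinksᶠ m = map (λ i → suc (suc i) , 0F , 1F) (allFin m)

module _ {A : Set} (G : 3Graph A) where
  open 3Graph G

  count-labels : ∀ (v : Vec A m) → count (toList v) ≡ sum1 (bit ∘ valueAt v) (triplesᶠ m)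
  count-labels {m} v = begin
    sum3 wt (toList v)                      ≡⟨ cong (sum3 wt) (toList-lookup v) ⟩
    sum3 wt (map (lookup v) (allFin m))     ≡⟨ sum3-map wt (lookup v) (allFin m) ⟩
    sum3 (λ i j k → wt (lookup v i) (lookup v j) (lookup v k)) (allFin m)
                                            ≡⟨ sum3-triples _ (allFin m) ⟩
    sum1 (bit ∘ valueAt v) (triplesᶠ m)     ∎
    where open ≡-Reasoning

  link-labels : ∀ w (v : Vec A m) → sum2 (wt w) (toList v) ≡ sum1 (bit ∘ valueAt (w ∷ v)) (linksᶠ m)
  link-labels {m} w v = begin
    sum2 (wt w) (toList v)                  ≡⟨ cong (sum2 (wt w)) (toList-lookup v) ⟩
    sum2 (wt w) (map (lookup v) (allFin m)) ≡⟨ sum2-map (wt w) (lookup v) (allFin m) ⟩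
    sum2 (λ i j → wt w (lookup v i) (lookup v j)) (allFin m) ≡⟨ sum2-pairs _ (allFin m) ⟩
    sum1 (λ (i , j) → wt w (lookup v i) (lookup v j)) (pairs (allFin m))
                                            ≡⟨ sum1-map _ _ (pairs (allFin m)) ⟨
    sum1 (bit ∘ valueAt (w ∷ v)) (linksᶠ m) ∎
    where open ≡-Reasoning

  colink-labels : ∀ w w′ (v : Vec A m) →
                  sum1 (λ x → wt x w w′) (toList v) ≡ sum1 (bit ∘ valueAt (w ∷ w′ ∷ v)) (colinksᶠ m)
  colink-labels {m} w w′ v = begin
    sum1 (λ x → wt x w w′) (toList v)                  ≡⟨ cong (sum1 _) (toList-lookup v) ⟩
    sum1 (λ x → wt x w w′) (map (lookup v) (allFin m)) ≡⟨ sum1-map _ (lookup v) (allFin m) ⟩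
    sum1 (λ i → wt (lookup v i) w w′) (allFin m)       ≡⟨ sum1-map _ _ (allFin m) ⟨
    sum1 (bit ∘ valueAt (w ∷ w′ ∷ v)) (colinksᶠ m) ∎
    where open ≡-Reasoning

  private
    rotations-holds : ∀ (v : Vec A m) {t} → valueAt v t ≡ true →
                      All (λ t → valueAt v t ≡ true) (rotations t)
    rotations-holds v h = h ∷ rotate h ∷ rotate (rotate h) ∷ []

    arrangements-holds : ∀ (v : Vec A m) {t} → valueAt v t ≡ true →
                         All (λ t → valueAt v t ≡ true) (arrangements t)
    arrangements-holds v h =
      h ∷ rotate h ∷ rotate (rotate h) ∷ flip₂ h ∷ flip₁ h ∷ flip₁₃ h ∷ []

    pick : ∀ {P Q : B → Set} {xs} → Any P xs → All Q xs → ∃[ x ] P x × Q x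
    pick (here p)  (q ∷ _)  = _ , p , q
    pick (there a) (_ ∷ qs) = pick a qs

    map-unique : ∀ {v : Vec A m} → Unique (toList v) → ∀ {is} → Unique is → Unique (map (lookup v) is)
    map-unique u = Uniqueₚ.map⁺ (lookup-inj u)

  loosePath-sound : PathFree → ∀ {v : Vec A m} → Unique (toList v) → ∀ {x y z} → T (loosePath x y z) →
                    valueAt v x ≡ true → valueAt v y ≡ true → valueAt v z ≡ true → ⊥
  loosePath-sound pf {v} u {x} {y} {z} h hx hy hz
    with pick (any⁻ _ (rotations x) h) (rotations-holds v hx)
  ... | (a , b , c) , h₁ , hx′ with pick (any⁻ _ (arrangements y) h₁) (arrangements-holds v hy)
  ... | (c′ , d , e) , h₂ , hy′ with Equivalence.to (T-∧ {c ≡ᶠ c′}) h₂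
  ... | c≡c′ , h₃ with pick (any⁻ _ (rotations z) h₃) (rotations-holds v hz)
  ... | (e′ , f , g) , h₄ , hz′ with Equivalence.to (T-∧ {e ≡ᶠ e′}) h₄
  ... | e≡e′ , dist with ≡ᶠ-sound {i = c} {c′} c≡c′ | ≡ᶠ-sound {i = e} {e′} e≡e′
  ... | refl | refl = pf (map-unique {v = v} u (distinct-sound (a ∷ b ∷ c ∷ d ∷ e ∷ f ∷ g ∷ []) dist)) hx′ hy′ hz′

  pathConf-sound : PathFree → ∀ {v : Vec A m} → Unique (toList v) → ∀ {x y z} → T (pathConf x y z) →
                   valueAt v x ≡ true → valueAt v y ≡ true → valueAt v z ≡ true → ⊥
  pathConf-sound pf {v} u {x} {y} {z} h hx hy hz with Equivalence.to (T-∨ {loosePath x y z}) h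
  ... | inj₁ p = loosePath-sound pf {v} u {x} {y} {z} p hx hy hz
  ... | inj₂ h′ with Equivalence.to (T-∨ {loosePath y x z}) h′
  ... | inj₁ p = loosePath-sound pf {v} u {y} {x} {z} p hy hx hz
  ... | inj₂ p = loosePath-sound pf {v} u {x} {z} {y} p hx hz hy

  MatchingFree : List A → Set
  MatchingFree V = ∀ {a b c d e f} → Unique (a ∷ b ∷ c ∷ d ∷ e ∷ f ∷ []) →
                   All (_∈ V) (a ∷ b ∷ c ∷ d ∷ e ∷ f ∷ []) → Adj a b c → Adj d e f → ⊥

  matchConf-sound : ∀ {V} → MatchingFree V → ∀ {v : Vec A m} → Unique (toList v) → All (_∈ V) (toList v) →
                    ∀ {x y z} → T (matchConf x y z) →
                    valueAt v x ≡ true → valueAt v y ≡ true → valueAt v z ≡ true → ⊥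
  matchConf-sound mf {v} u v∈V {a , b , c} {d , e , f} dist hx hy _ =
    mf (map-unique {v = v} u (distinct-sound is dist))
       (inV a ∷ inV b ∷ inV c ∷ inV d ∷ inV e ∷ inV f ∷ []) hx hy
    where
    is = a ∷ b ∷ c ∷ d ∷ e ∷ f ∷ []
    inV = λ i → All.lookup v∈V (lookup∈ v i)

shift1 : Triple (Fin m) → Triple (Fin (suc m))
shift1 (i , j , k) = suc i , suc j , suc k

anyVec? : ∀ {P : Pred (Vec (Fin n) m) 0ℓ} → Decidable P → Dec (∃ P)
anyVec? {m = zero}  P? = map′ ([] ,_) (λ { ([] , p) → p }) (P? [])
anyVec? {m = suc m} P? =
  map′ (λ (x , v , p) → x ∷ v , p) (λ { (x ∷ v , p) → x , v , p }) (any? λ x → anyVec? λ v → P? (x ∷ v))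

Unique-++-disjoint : ∀ (xs : List A) {ys x} → Unique (xs ++ ys) → x ∈ xs → x ∈ ys → ⊥
Unique-++-disjoint (x ∷ xs) (x∉ ∷ u) (here refl) x∈ys = All.lookup x∉ (∈-++⁺ʳ xs x∈ys) refl
Unique-++-disjoint (x ∷ xs) (x∉ ∷ u) (there x∈)  x∈ys = Unique-++-disjoint xs u x∈ x∈ys

module Vertices {n} (G : 3Graph (Fin n)) where
  open 3Graph G

  open DecMembership (_≟ᶠ_ {n}) using (_∈?_) public

  Present : Vec (Fin n) m → List (Triple (Fin m)) → Set
  Present v = All λ t → valueAt v t ≡ true

  Absent : Vec (Fin n) m → List (Triple (Fin m)) → Set
  Absent v = All λ t → valueAt v t ≡ false

  Occurrence : List (Triple (Fin m)) → List (Fin n) → Vec (Fin n) m → Set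
  Occurrence K V v = Unique (toList v) × All (_∈ V) (toList v) × Present v K

  Occurs : List (Triple (Fin m)) → List (Fin n) → Set
  Occurs K V = ∃ (Occurrence K V)

  -- A finite search over all labellings, which makes the case distinctions on the presence of a
  -- configuration constructive.
  occurs? : ∀ (K : List (Triple (Fin m))) V → Dec (Occurs K V)
  occurs? K V = anyVec? λ v → unique? (toList v) ×-dec All.all? (_∈? V) (toList v)
                              ×-dec All.all? (λ t → valueAt v t ≟ᵇ true) K
    where open DecUnique (_≟ᶠ_ {n}) using (unique?)

  module Split {V W : List (Fin n)} {v : Vec (Fin n) m} (uV : Unique V) (V↭ : V ↭ toList v ++ W) where

    unique : Unique (toList v ++ W)
    unique = Unique-↭ V↭ uV

    uniqueˡ : Unique (toList v)
    uniqueˡ = Unique-++ˡ (toList v) unique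

    uniqueʳ : Unique W
    uniqueʳ = Unique-++ʳ (toList v) unique

    extend : ∀ {ys} → Unique ys → All (_∈ W) ys → Unique (ys ++ toList v)
    extend uys ys∈ = Uniqueₚ.++⁺ uys uniqueˡ λ (x∈ys , x∈v) →
      Unique-++-disjoint (toList v) unique x∈v (All.lookup ys∈ x∈ys)

    extend₁ : ∀ {w} → w ∈ W → Unique (w ∷ toList v)
    extend₁ w∈ = extend ([] ∷ []) (w∈ ∷ [])

    extend₂ : ∀ {w w′} → w ∈ W → w′ ∈ W → w ≢ w′ → Unique (w ∷ w′ ∷ toList v)
    extend₂ w∈ w′∈ ne = extend ((ne ∷ []) ∷ [] ∷ []) (w∈ ∷ w′∈ ∷ [])

    extend₃ : ∀ {w w′ w″} → w ∈ W → w′ ∈ W → w″ ∈ W → w ≢ w′ → w ≢ w″ → w′ ≢ w″ →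
              Unique (w ∷ w′ ∷ w″ ∷ toList v)
    extend₃ w∈ w′∈ w″∈ ne ne′ ne″ =
      extend ((ne ∷ ne′ ∷ []) ∷ (ne″ ∷ []) ∷ [] ∷ []) (w∈ ∷ w′∈ ∷ w″∈ ∷ [])

    v∈V : ∀ {x} → x ∈ toList v → x ∈ V
    v∈V x∈ = ∈-resp-↭ (↭-sym V↭) (∈-++⁺ˡ x∈)

    W∈V : ∀ {x} → x ∈ W → x ∈ V
    W∈V x∈ = ∈-resp-↭ (↭-sym V↭) (∈-++⁺ʳ (toList v) x∈)

    V-cases : ∀ {x} → x ∈ V → x ∈ toList v ⊎ x ∈ W
    V-cases x∈ = ∈-++⁻ (toList v) (∈-resp-↭ V↭ x∈)

    length-V : length V ≡ m + length W
    length-V = trans (↭-length V↭) (trans (length-++ (toList v)) (cong (_+ length W) (length-toList v)))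

    -- The edges with 0, 1, 2 and 3 vertices in `W`, in this order. All later counts bound these
    -- four terms separately.
    count-V : count V ≡ count (toList v) + sum1 (λ w → sum2 (wt w) (toList v)) W
                        + sum2 (λ w w′ → sum1 (λ x → wt x w w′) (toList v)) W + count W
    count-V = trans (sum3-↭ wt-sym V↭) (sum3-++ wt-sym (toList v) W)

    count-V-≤ : ∀ {a c p t} → count (toList v) ≤ a → sum1 (λ w → sum2 (wt w) (toList v)) W ≤ c →
                sum2 (λ w w′ → sum1 (λ x → wt x w w′) (toList v)) W ≤ p → count W ≤ t →
                count V ≤ a + c + p + t
    count-V-≤ a c p t = ≤-trans (≤-reflexive count-V) (+-mono-≤ (+-mono-≤ (+-mono-≤ a c) p) t)

  splitOff : ∀ {K : List (Triple (Fin m))} {V v} → Occurrence K V v → ∃[ W ] V ↭ toList v ++ W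
  splitOff (u , v∈ , _) = split-off u v∈

  count-0 : ∀ {V} → Unique V → (∀ {x y z} → x ∈ V → y ∈ V → z ∈ V → ¬ Adj x y z) → count V ≡ 0
  count-0 u ¬e = sum3-0 u λ x∈ y∈ z∈ _ _ _ → bit-false (¬e x∈ y∈ z∈)

  unique₃ : ∀ {x y z} → Adj x y z → Unique (x ∷ y ∷ z ∷ [])
  unique₃ e with edge-distinct e
  ... | a , b , c = (a ∷ b ∷ []) ∷ (c ∷ []) ∷ [] ∷ []

  count-≤binom3 : ∀ {V} → Unique V → count V ≤ binom3 (length V)
  count-≤binom3 {V} u = ≤-trans (sum3-mono u λ {x} {y} {z} _ _ _ _ _ _ → bit-≤1 (edge x y z))
                             (≤-reflexive (sum3-const1 V))

  module PathBound (pf : PathFree) {v : Vec (Fin n) m} (u : Unique (toList v)) where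
    open Labelled G v u pathConf (pathConf-sound G pf {v} u) public

  module MatchBound {V} (mf : MatchingFree G V) {v : Vec (Fin n) m} (u : Unique (toList v)) (v∈ : All (_∈ V) (toList v)) where
    open Labelled G v u matchConf (matchConf-sound G mf {v} u v∈) public

-- 3-graphs without two disjoint edges.

-- At most one value exceeds `b`. It is paired with some other entry, and the two together stay
-- below `b + b`.
sum1-pairwise : ∀ {f : A → ℕ} b {xs} → Unique xs → 2 ≤ length xs →
                (∀ {x y} → x ∈ xs → y ∈ xs → x ≢ y → f x + f y ≤ b + b) → sum1 f xs ≤ b * length xs
sum1-pairwise {f = f} b {xs} u 2≤ le with Any.any? (λ x → b <? f x) xs
... | no ¬big = sum1-≤ b xs λ x∈ → ≮⇒≥ λ b<fx → ¬big (Membership.lose x∈ b<fx)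
... | yes big with Membership.find big
... | x , x∈ , b<fx with split-off ([] ∷ []) (x∈ ∷ [])
... | [] , p = ⊥-elim (<⇒≱ 2≤ (≤-reflexive (↭-length p)))
... | y ∷ zs , p with Unique-↭ p u
... | (x≢y ∷ x∉) ∷ _ = begin
  sum1 f xs                   ≡⟨ sum1-↭ f p ⟩
  f x + (f y + sum1 f zs)     ≡⟨ +-assoc (f x) (f y) _ ⟨
  (f x + f y) + sum1 f zs     ≤⟨ +-mono-≤ (le x∈ (∈p (there (here refl))) x≢y) (sum1-≤ b zs small) ⟩
  (b + b) + b * length zs     ≡⟨ lem b (length zs) ⟩
  b * (2 + length zs)         ≡⟨ cong (b *_) (↭-length p) ⟨
  b * length xs               ∎
  where
  open ≤-Reasoning
  lem : ∀ b l → (b + b) + b * l ≡ b * (2 + l)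
  lem = solve-∀
  ∈p : ∀ {z} → z ∈ x ∷ y ∷ zs → z ∈ xs
  ∈p = ∈-resp-↭ (↭-sym p)
  small : ∀ {z} → z ∈ zs → f z ≤ b
  small {z} z∈ = ≮⇒≥ λ b<fz → <⇒≱ (+-mono-< b<fx b<fz)
    (le x∈ (∈p (there (there z∈))) (All.lookup x∉ z∈))

-- Bounds the edges on n vertices without two disjoint edges (for n = 7, 8 it is not sharp).
matchingFreeMax : ℕ → ℕ
matchingFreeMax 0 = 0
matchingFreeMax 1 = 0
matchingFreeMax 2 = 0
matchingFreeMax 3 = 1
matchingFreeMax 4 = 4
matchingFreeMax 5 = 10
matchingFreeMax 6 = 10
matchingFreeMax 7 = 18
matchingFreeMax 8 = 22
matchingFreeMax (suc n) = binom2 n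

edge₀ : List (Triple (Fin (3 + m)))
edge₀ = (0F , 1F , 2F) ∷ []

-- Two edges sharing exactly the vertex 0, and the two ways in which an edge can meet both of them outside 0.
cross₀ cross₁ : List (Triple (Fin (5 + m)))
cross₀ = (0F , 1F , 2F) ∷ (0F , 3F , 4F) ∷ []
cross₁ = (0F , 1F , 2F) ∷ (0F , 3F , 4F) ∷ (1F , 3F , 4F) ∷ []
cross₂ : List (Triple (Fin (6 + m)))
cross₂ = (0F , 1F , 2F) ∷ (0F , 3F , 4F) ∷ (1F , 3F , 5F) ∷ []

linkPair : ∀ m → List (Triple (Fin (2 + m)))
linkPair m = map (λ (i , j) → 0F , suc (suc i) , suc (suc j)) (pairs (allFin m))
          ++ map (λ (i , j) → 1F , suc (suc i) , suc (suc j)) (pairs (allFin m))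


private
  -- The values 18 and 22 of `matchingFreeMax` at 7 and 8 are this left-hand side for `k` equal to 0
  -- and 1. From nine vertices on the star bound C(n-1,2) dominates it.
  linear₁ : ∀ k → 10 + 4 * (2 + k) ≤ matchingFreeMax (7 + k)
  linear₁ 0 = ≤-refl
  linear₁ 1 = ≤-refl
  linear₁ (suc (suc k)) = go k
    where
    step : ∀ k → 10 + 4 * (5 + k) ≡ 10 + 4 * (4 + k) + 4
    step = solve-∀
    go : ∀ k → 10 + 4 * (4 + k) ≤ binom2 (8 + k)
    go zero    = m≤m+n 26 2
    go (suc k) = ≤-trans (≤-reflexive (trans (step k) (+-comm _ 4))) (+-mono-≤ (m≤m+n 4 (4 + k)) (go k))

  linear₂ : ∀ k → 10 + 3 * (2 + k) ≤ matchingFreeMax (8 + k)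
  linear₂ k = ≤-trans (≤-trans (≤-trans (+-monoʳ-≤ 10 (*-monoˡ-≤ (2 + k) (m≤m+n 3 1))) (m≤m+n _ 4))
                (≤-reflexive (step k))) (linear₁ (suc k))
    where
    step : ∀ k → 10 + 4 * (2 + k) + 4 ≡ 10 + 4 * (2 + suc k)
    step = solve-∀

  linear₃ : ∀ k → 1 + 3 * (4 + k) ≤ matchingFreeMax (7 + k)
  linear₃ k = ≤-trans (≤-trans (m≤m+n _ (5 + k)) (≤-reflexive (step k))) (linear₁ k)
    where
    step : ∀ k → 1 + 3 * (4 + k) + (5 + k) ≡ 10 + 4 * (2 + k)
    step = solve-∀

  binom2≤matchingFreeMax : ∀ k → binom2 (6 + k) ≤ matchingFreeMax (7 + k)
  binom2≤matchingFreeMax 0 = m≤m+n 15 3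
  binom2≤matchingFreeMax 1 = m≤m+n 21 1
  binom2≤matchingFreeMax (suc (suc k)) = ≤-refl

module _ {n} (G : 3Graph (Fin n)) where
  open 3Graph G
  open Vertices G

  module MatchingFreeBound {V} (uV : Unique V) (mf : MatchingFree G V) where

    meets : ∀ {a b c x y z} → Adj a b c → All (_∈ V) (a ∷ b ∷ c ∷ []) → Adj x y z → All (_∈ V) (x ∷ y ∷ z ∷ []) →
            x ∈ a ∷ b ∷ c ∷ [] ⊎ y ∈ a ∷ b ∷ c ∷ [] ⊎ z ∈ a ∷ b ∷ c ∷ []
    meets {a} {b} {c} {x} {y} {z} e abc∈ e′ xyz∈ with x ∈? (a ∷ b ∷ c ∷ []) | y ∈? (a ∷ b ∷ c ∷ []) | z ∈? (a ∷ b ∷ c ∷ [])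
    ... | yes p | _     | _     = inj₁ p
    ... | _     | yes p | _     = inj₂ (inj₁ p)
    ... | _     | _     | yes p = inj₂ (inj₂ p)
    ... | no ¬x | no ¬y | no ¬z =
      ⊥-elim (mf (Uniqueₚ.++⁺ (unique₃ e) (unique₃ e′) apart) (Allₚ.++⁺ abc∈ xyz∈) e e′)
      where
      apart : ∀ {t} → ¬ (t ∈ a ∷ b ∷ c ∷ [] × t ∈ x ∷ y ∷ z ∷ [])
      apart (t∈ , here refl)                 = ¬x t∈
      apart (t∈ , there (here refl))         = ¬y t∈
      apart (t∈ , there (there (here refl))) = ¬z t∈

    module Around {v : Vec (Fin n) m} {W} (V↭ : V ↭ toList v ++ W) where
      open Split {v = v} uV V↭ public

      v⊆V : All (_∈ V) (toList v)
      v⊆V = All.tabulate v∈V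

    outside-0 : ∀ {v : Vec (Fin n) (3 + m)} {W} → V ↭ toList v ++ W → Present v edge₀ → count W ≡ 0
    outside-0 {v = v} V↭ K✓ = count-0 uniqueʳ none
      where
      open Around {v = v} V↭
      none : ∀ {x y z} → x ∈ _ → y ∈ _ → z ∈ _ → ¬ Adj x y z
      none {x} {y} {z} x∈ y∈ z∈ e with edge-distinct e
      ... | x≢y , x≢z , y≢z =
        inconsistent {K = (0F , 1F , 2F) ∷ (3F , 4F , 5F) ∷ []} (e ∷ All.head K✓ ∷ []) tt
        where open MatchBound mf {v = x ∷ y ∷ z ∷ v} (extend₃ x∈ y∈ z∈ x≢y x≢z y≢z)
                                 (W∈V x∈ ∷ W∈V y∈ ∷ W∈V z∈ ∷ v⊆V)

    -- A single outside vertex may have a large link. Two disjoint pairs in the links of different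
    -- vertices give disjoint edges, so two links bound each other, and `sum1-pairwise` averages.
    link-pair : ∀ {v : Vec (Fin n) m} {W w w′} (V↭ : V ↭ toList v ++ W) → w ∈ W → w′ ∈ W → w ≢ w′ →
                ∀ {K} → Present v K →
                sum2 (wt w) (toList v) + sum2 (wt w′) (toList v)
                  ≤ Bound.bound _≡ᵗ_ matchConf (map (shift1 ∘ shift1) K) [] (linkPair m)
    link-pair {m = m} {v} {W} {w} {w′} V↭ w∈ w′∈ w≢w′ K✓ = begin
      sum2 (wt w) (toList v) + sum2 (wt w′) (toList v)
        ≡⟨ cong₂ _+_ (link w (λ _ → refl)) (link w′ (λ _ → refl)) ⟩
      sum1 f (map (λ (i , j) → 0F , suc (suc i) , suc (suc j)) ps) + sum1 f (map (λ (i , j) → 1F , suc (suc i) , suc (suc j)) ps)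
        ≡⟨ sum1-++ f (map _ ps) (map _ ps) ⟨
      sum1 f (linkPair m)
        ≤⟨ bound-sound (Allₚ.map⁺ K✓) [] (linkPair m) ⟩
      _ ∎
      where
      open ≤-Reasoning
      open Around {v = v} V↭
      open MatchBound mf {v = w ∷ w′ ∷ v} (extend₂ w∈ w′∈ w≢w′) (W∈V w∈ ∷ W∈V w′∈ ∷ v⊆V)
      ps = pairs (allFin m)
      f = bit ∘ valueAt (w ∷ w′ ∷ v)
      link : ∀ u {i} → (∀ j → edge (lookup (w ∷ w′ ∷ v) i) j ≡ edge u j) →
             sum2 (wt u) (toList v) ≡ sum1 f (map (λ (j , k) → i , suc (suc j) , suc (suc k)) ps)
      link u {i} eq = trans (link-labels G u v) (trans (sum1-map _ _ ps)
        (trans (sum1-cong ps λ (j , k) → cong bit (cong-app (sym (eq (lookup v j))) (lookup v k)))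
               (sym (sum1-map _ _ ps))))

    colink-0 : ∀ {v : Vec (Fin n) m} {W} (V↭ : V ↭ toList v ++ W) {K} → Present v K →
               Bound.bound _≡ᵗ_ matchConf (map (shift1 ∘ shift1) K) [] (colinksᶠ m) ≡ 0 →
               sum2 (λ w w′ → sum1 (λ x → wt x w w′) (toList v)) W ≡ 0
    colink-0 {m = m} {v} V↭ K✓ eq = sum2-0 uniqueʳ λ {w} {w′} w∈ w′∈ w≢w′ →
      let open MatchBound mf {v = w ∷ w′ ∷ v} (extend₂ w∈ w′∈ w≢w′) (W∈V w∈ ∷ W∈V w′∈ ∷ v⊆V)
      in n≤0⇒n≡0 (≤-trans (≤-reflexive (colink-labels G w w′ v))
                  (≤-trans (bound-sound (Allₚ.map⁺ K✓) [] (colinksᶠ m)) (≤-reflexive eq)))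
      where open Around {v = v} V↭

    inner : ∀ {v : Vec (Fin n) m} {W} (V↭ : V ↭ toList v ++ W) {K} → Present v K →
            count (toList v) ≤ Bound.bound _≡ᵗ_ matchConf K [] (triplesᶠ m)
    inner {m = m} {v} V↭ K✓ =
      ≤-trans (≤-reflexive (count-labels G v)) (bound-sound K✓ [] (triplesᶠ m))
      where
      open Around {v = v} V↭
      open MatchBound mf {v = v} uniqueˡ v⊆V

    link : ∀ {v : Vec (Fin n) m} {W w} (V↭ : V ↭ toList v ++ W) → w ∈ W → ∀ {K} → Present v K →
           sum2 (wt w) (toList v) ≤ Bound.bound _≡ᵗ_ matchConf (map shift1 K) [] (linksᶠ m)
    link {m = m} {v} {w = w} V↭ w∈ K✓ =
      ≤-trans (≤-reflexive (link-labels G w v)) (bound-sound (Allₚ.map⁺ K✓) [] (linksᶠ m))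
      where
      open Around {v = v} V↭
      open MatchBound mf {v = w ∷ v} (extend₁ w∈) (W∈V w∈ ∷ v⊆V)

    -- Of two complementary triples at most one is an edge, hence half of 20. The given edge only
    -- serves to make `K` nonempty.
    six : length V ≡ 6 → Occurs {3} edge₀ V → count V ≤ 10
    six eq (v , occ@(_ , _ , K✓)) with splitOff occ
    ... | W , V↭ with Split.length-V {v = v} uV V↭
    six eq (x ∷ y ∷ z ∷ [] , _ , _ , K✓) | a ∷ b ∷ c ∷ [] , V↭ | _ =
      ≤-trans (≤-reflexive (sum3-↭ wt-sym V↭)) (inner {v = x ∷ y ∷ z ∷ a ∷ b ∷ c ∷ []} {[]} V↭ {edge₀} (All.head K✓ ∷ []))
    six eq _ | []                  , V↭ | l = case trans (sym eq) l of λ ()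
    six eq _ | _ ∷ []              , V↭ | l = case trans (sym eq) l of λ ()
    six eq _ | _ ∷ _ ∷ []          , V↭ | l = case trans (sym eq) l of λ ()
    six eq _ | _ ∷ _ ∷ _ ∷ _ ∷ _   , V↭ | l = case trans (sym eq) l of λ ()

    module _ {k} (|V| : length V ≡ 7 + k) where

      -- All ten triples on the five labels are allowed. Seven pairs of labels meet each of the
      -- three given edges, so one link can have size seven, but two links together have size at
      -- most eight: four per outside vertex.
      bound₁ : Occurs {5} cross₁ V → count V ≤ matchingFreeMax (7 + k)
      bound₁ (v , occ@(_ , _ , K✓)) = ≤-trans
        (count-V-≤ (≤-trans (count-≤binom3 uniqueˡ) (≤-reflexive (cong binom3 (length-toList v))))
                   (sum1-pairwise 4 uniqueʳ (≤-trans (m≤m+n 2 k) (≤-reflexive (sym |W|)))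
                     λ w∈ w′∈ ne → link-pair {v = v} V↭ w∈ w′∈ ne K✓)
                   (≤-reflexive (colink-0 {v = v} V↭ K✓ refl)) (≤-reflexive (outside-0 {v = v} V↭ (All.head K✓ ∷ []))))
        (≤-trans (≤-reflexive (trans (cong (λ l → 10 + 4 * l + 0 + 0) |W|) (trans (+-identityʳ _) (+-identityʳ _)))) (linear₁ k))
        where
        W = proj₁ (splitOff occ)
        V↭ = proj₂ (splitOff occ)
        open Split {v = v} uV V↭
        |W| : length W ≡ 2 + k
        |W| = +-cancelˡ-≡ 5 _ _ (trans (sym length-V) |V|)

      -- Ten inner edges as on any six vertices, and three per outside vertex when the links are
      -- averaged over pairs. On seven vertices there is just one outside vertex and nothing to
      -- average; there the single link bound 6 is enough.
      bound₂ : Occurs {6} cross₂ V → count V ≤ matchingFreeMax (7 + k)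
      bound₂ (v , occ@(_ , _ , K✓)) = ≤-trans
        (count-V-≤ (inner {v = v} V↭ K✓) ≤-refl
                   (≤-reflexive (colink-0 {v = v} V↭ K✓ refl)) (≤-reflexive (outside-0 {v = v} V↭ (All.head K✓ ∷ []))))
        (≤-trans (≤-reflexive (trans (+-identityʳ _) (+-identityʳ _))) (links k |W|))
        where
        W = proj₁ (splitOff occ)
        V↭ = proj₂ (splitOff occ)
        open Split {v = v} uV V↭
        |W| : length W ≡ 1 + k
        |W| = +-cancelˡ-≡ 6 _ _ (trans (sym length-V) |V|)
        total = sum1 (λ w → sum2 (wt w) (toList v)) W
        links : ∀ k → length W ≡ 1 + k → 10 + total ≤ matchingFreeMax (7 + k)
        links zero    |W| = ≤-trans
          (+-monoʳ-≤ 10 (≤-trans (sum1-≤ 6 W λ w∈ → link {v = v} V↭ w∈ K✓) (≤-reflexive (cong (6 *_) |W|))))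
          (m≤m+n 16 2)
        links (suc k) |W| = ≤-trans
          (+-monoʳ-≤ 10 (≤-trans (sum1-pairwise 3 uniqueʳ (≤-trans (m≤m+n 2 k) (≤-reflexive (sym |W|)))
                                    λ w∈ w′∈ ne → link-pair {v = v} V↭ w∈ w′∈ ne K✓)
                                 (≤-reflexive (cong (3 *_) |W|))))
          (linear₂ k)

      -- No two edges share exactly one vertex, so every other edge meets the fixed one in two
      -- vertices. An outside vertex has only three pairs for this.
      bound₃ : Occurs {3} edge₀ V → ¬ Occurs {5} cross₀ V → count V ≤ matchingFreeMax (7 + k)
      bound₃ (v@(a ∷ b ∷ c ∷ []) , occ@(_ , _ , K✓@(abc ∷ []))) ¬cross = ≤-trans
        (count-V-≤ (count-≤binom3 uniqueˡ)
                   (sum1-≤ 3 W λ {w} _ → ≤-trans (sum2-≤1 uniqueˡ λ {x} {y} _ _ _ → bit-≤1 (edge w x y)) ≤-refl)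
                   (≤-reflexive (sum2-0 uniqueʳ λ w∈ w′∈ ne → sum1-0 (toList v) λ x∈ → bit-false (no-cross w∈ w′∈ ne x∈)))
                   (≤-reflexive (outside-0 {v = v} V↭ K✓)))
        (≤-trans (≤-reflexive (trans (cong (λ l → 1 + 3 * l + 0 + 0) |W|) (trans (+-identityʳ _) (+-identityʳ _)))) (linear₃ k))
        where
        W = proj₁ (splitOff occ)
        V↭ = proj₂ (splitOff occ)
        open Around {v = v} V↭
        |W| : length W ≡ 4 + k
        |W| = +-cancelˡ-≡ 3 _ _ (trans (sym length-V) |V|)
        no-cross : ∀ {w w′ x} → w ∈ W → w′ ∈ W → w ≢ w′ → x ∈ toList v → ¬ Adj x w w′
        no-cross {w} {w′} {x} w∈ w′∈ ne x∈ e = at x∈ e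
          where
          V∈ : All (_∈ V) (w ∷ w′ ∷ a ∷ b ∷ c ∷ [])
          V∈ = W∈V w∈ ∷ W∈V w′∈ ∷ v⊆V
          reorder : ∀ {x y z} → w ∷ w′ ∷ a ∷ b ∷ c ∷ [] ↭ x ∷ y ∷ z ∷ w ∷ w′ ∷ [] → Adj x y z → Adj x w w′ → ⊥
          reorder {x} {y} {z} p e e′ = ¬cross (x ∷ y ∷ z ∷ w ∷ w′ ∷ [] , Unique-↭ p (extend₂ w∈ w′∈ ne)
                                              , Permutationₚ.All-resp-↭ p V∈ , e ∷ e′ ∷ [])
          p₀ : w ∷ w′ ∷ a ∷ b ∷ c ∷ [] ↭ a ∷ b ∷ c ∷ w ∷ w′ ∷ []
          p₀ = Permutationₚ.++-comm (w ∷ w′ ∷ []) (a ∷ b ∷ c ∷ [])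
          p₁ : a ∷ b ∷ c ∷ w ∷ w′ ∷ [] ↭ b ∷ c ∷ a ∷ w ∷ w′ ∷ []
          p₁ = Permutationₚ.++⁺ʳ (w ∷ w′ ∷ []) (Permutationₚ.++-comm (a ∷ []) (b ∷ c ∷ []))
          p₂ : a ∷ b ∷ c ∷ w ∷ w′ ∷ [] ↭ c ∷ a ∷ b ∷ w ∷ w′ ∷ []
          p₂ = Permutationₚ.++⁺ʳ (w ∷ w′ ∷ []) (Permutationₚ.++-comm (a ∷ b ∷ []) (c ∷ []))
          at : ∀ {x} → x ∈ toList v → Adj x w w′ → ⊥
          at (here refl)                 = reorder p₀ abc
          at (there (here refl))         = reorder (↭-trans p₀ p₁) (rotate abc)
          at (there (there (here refl))) = reorder (↭-trans p₀ p₂) (rotate (rotate abc))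

      module Star (¬cross₁ : ¬ Occurs {5} cross₁ V) (¬cross₂ : ¬ Occurs {6} cross₂ V) where

        -- An edge that avoids `x` and meets both given edges has one further vertex `r`. It is on
        -- one of the two edges, which gives `cross₁`, or new, which gives `cross₂`.
        third : ∀ {x a a′ b b′ r} → Unique (x ∷ a ∷ a′ ∷ b ∷ b′ ∷ []) → All (_∈ V) (x ∷ a ∷ a′ ∷ b ∷ b′ ∷ []) → r ∈ V →
                x ≢ r → Adj x a a′ → Adj x b b′ → Adj a b r → ⊥
        third {x} {a} {a′} {b} {b′} {r} u V∈@(x∈ ∷ a∈ ∷ a′∈ ∷ b∈ ∷ b′∈ ∷ []) r∈ x≢r e₁ e₂ e₃
          with r ≟ᶠ a′ | r ≟ᶠ b′
        ... | yes refl | _ = ¬cross₁ (x ∷ b ∷ b′ ∷ a ∷ a′ ∷ [] , Unique-↭ p u , Permutationₚ.All-resp-↭ p V∈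
                                     , e₂ ∷ e₁ ∷ flip₁ e₃ ∷ [])
          where
          p : x ∷ a ∷ a′ ∷ b ∷ b′ ∷ [] ↭ x ∷ b ∷ b′ ∷ a ∷ a′ ∷ []
          p = prep x (Permutationₚ.++-comm (a ∷ a′ ∷ []) (b ∷ b′ ∷ []))
        ... | _ | yes refl = ¬cross₁ (x ∷ a ∷ a′ ∷ b ∷ b′ ∷ [] , u , V∈ , e₁ ∷ e₂ ∷ e₃ ∷ [])
        ... | no r≢a′ | no r≢b′ = ¬cross₂ (x ∷ a ∷ a′ ∷ b ∷ b′ ∷ r ∷ [] , Uniqueₚ.++⁺ u ([] ∷ []) apart
                                          , Allₚ.++⁺ V∈ (r∈ ∷ []) , e₁ ∷ e₂ ∷ e₃ ∷ [])
          where
          apart : ∀ {t} → ¬ (t ∈ x ∷ a ∷ a′ ∷ b ∷ b′ ∷ [] × t ∈ r ∷ [])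
          apart (here eq , here refl) = x≢r (sym eq)
          apart (there (here eq) , here refl) = proj₁ (proj₂ (edge-distinct e₃)) (sym eq)
          apart (there (there (here eq)) , here refl) = r≢a′ eq
          apart (there (there (there (here eq))) , here refl) = proj₂ (proj₂ (edge-distinct e₃)) (sym eq)
          apart (there (there (there (there (here eq)))) , here refl) = r≢b′ eq

        module _ {x a a′ b b′} (u : Unique (x ∷ a ∷ a′ ∷ b ∷ b′ ∷ [])) (V∈ : All (_∈ V) (x ∷ a ∷ a′ ∷ b ∷ b′ ∷ []))
                 (e₁ : Adj x a a′) (e₂ : Adj x b b′) where
          private
            in₂ : ∀ {p a a′} → x ≢ p → p ∈ x ∷ a ∷ a′ ∷ [] → p ≡ a ⊎ p ≡ a′
            in₂ x≢p (here eq)                 = ⊥-elim (x≢p (sym eq))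
            in₂ x≢p (there (here eq))         = inj₁ eq
            in₂ x≢p (there (there (here eq))) = inj₂ eq

            pa : x ∷ a ∷ a′ ∷ b ∷ b′ ∷ [] ↭ x ∷ a′ ∷ a ∷ b ∷ b′ ∷ []
            pa = prep x (swap a a′ refl)
            pb : ∀ {a a′} → x ∷ a ∷ a′ ∷ b ∷ b′ ∷ [] ↭ x ∷ a ∷ a′ ∷ b′ ∷ b ∷ []
            pb {a} {a′} = prep x (prep a (prep a′ (swap b b′ refl)))

          third′ : ∀ {p q r} → x ≢ p → x ≢ q → x ≢ r → r ∈ V → Adj p q r →
                   p ∈ x ∷ a ∷ a′ ∷ [] → q ∈ x ∷ b ∷ b′ ∷ [] → ⊥
          third′ x≢p x≢q x≢r r∈ e p∈ q∈ with in₂ x≢p p∈ | in₂ x≢q q∈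
          ... | inj₁ refl | inj₁ refl = third u V∈ r∈ x≢r e₁ e₂ e
          ... | inj₂ refl | inj₁ refl = third (Unique-↭ pa u) (Permutationₚ.All-resp-↭ pa V∈) r∈ x≢r (flip₂ e₁) e₂ e
          ... | inj₁ refl | inj₂ refl = third (Unique-↭ pb u) (Permutationₚ.All-resp-↭ pb V∈) r∈ x≢r e₁ (flip₂ e₂) e
          ... | inj₂ refl | inj₂ refl =
            third (Unique-↭ (↭-trans pa pb) u) (Permutationₚ.All-resp-↭ (↭-trans pa pb) V∈) r∈ x≢r (flip₂ e₁) (flip₂ e₂) e

          second : ∀ {p q r} → x ≢ p → x ≢ q → x ≢ r → q ∈ V → r ∈ V → Adj p q r → p ∈ x ∷ a ∷ a′ ∷ [] →
                   p ∈ x ∷ b ∷ b′ ∷ [] ⊎ q ∈ x ∷ b ∷ b′ ∷ [] ⊎ r ∈ x ∷ b ∷ b′ ∷ [] → ⊥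
          second x≢p _ _ _ _ _ p∈a (inj₁ p∈b) = differ (in₂ x≢p p∈a) (in₂ x≢p p∈b) u
            where
            differ : ∀ {p a a′ b b′} → p ≡ a ⊎ p ≡ a′ → p ≡ b ⊎ p ≡ b′ → Unique (x ∷ a ∷ a′ ∷ b ∷ b′ ∷ []) → ⊥
            differ (inj₁ refl) (inj₁ refl) (_ ∷ (_ ∷ ne ∷ _ ∷ []) ∷ _) = ne refl
            differ (inj₁ refl) (inj₂ refl) (_ ∷ (_ ∷ _ ∷ ne ∷ []) ∷ _) = ne refl
            differ (inj₂ refl) (inj₁ refl) (_ ∷ _ ∷ (ne ∷ _ ∷ []) ∷ _) = ne refl
            differ (inj₂ refl) (inj₂ refl) (_ ∷ _ ∷ (_ ∷ ne ∷ []) ∷ _) = ne refl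
          second x≢p x≢q x≢r q∈ r∈ e p∈a (inj₂ (inj₁ q∈b)) = third′ x≢p x≢q x≢r r∈ e p∈a q∈b
          second x≢p x≢q x≢r q∈ r∈ e p∈a (inj₂ (inj₂ r∈b)) = third′ x≢p x≢r x≢q q∈ (flip₂ e) p∈a r∈b

          through-x : ∀ {p q r} → x ≢ p → x ≢ q → x ≢ r → p ∈ V → q ∈ V → r ∈ V → ¬ Adj p q r
          through-x {p} {q} {r} x≢p x≢q x≢r p∈ q∈ r∈ e = go V∈
            where
            go : All (_∈ V) (x ∷ a ∷ a′ ∷ b ∷ b′ ∷ []) → ⊥
            go (x∈ ∷ a∈ ∷ a′∈ ∷ b∈ ∷ b′∈ ∷ [])
              with meets e₁ (x∈ ∷ a∈ ∷ a′∈ ∷ []) e (p∈ ∷ q∈ ∷ r∈ ∷ [])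
            ... | inj₁ p∈a        = second x≢p x≢q x≢r q∈ r∈ e p∈a (meets e₂ (x∈ ∷ b∈ ∷ b′∈ ∷ []) e (p∈ ∷ q∈ ∷ r∈ ∷ []))
            ... | inj₂ (inj₁ q∈a) = second x≢q x≢r x≢p r∈ p∈ (rotate e) q∈a (meets e₂ (x∈ ∷ b∈ ∷ b′∈ ∷ []) (rotate e) (q∈ ∷ r∈ ∷ p∈ ∷ []))
            ... | inj₂ (inj₂ r∈a) =
              second x≢r x≢p x≢q p∈ q∈ (rotate (rotate e)) r∈a (meets e₂ (x∈ ∷ b∈ ∷ b′∈ ∷ []) (rotate (rotate e)) (r∈ ∷ p∈ ∷ q∈ ∷ []))

        -- Any edge must meet both edges of `cross₀`; if it avoided their common vertex it would
        -- produce one of the two excluded configurations. So all edges form a star.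
        bound₄ : Occurs {5} cross₀ V → count V ≤ matchingFreeMax (7 + k)
        bound₄ (x ∷ a ∷ a′ ∷ b ∷ b′ ∷ [] , u , V∈ , e₁ ∷ e₂ ∷ [])
          with split-off ([] ∷ []) (All.head V∈ ∷ [])
        ... | W , V↭ = begin
          count V                  ≡⟨ sum3-↭ wt-sym V↭ ⟩
          sum2 (wt x) W + count W  ≡⟨ cong (sum2 (wt x) W +_) (count-0 uniqueʳ λ p∈ q∈ r∈ →
                                        through-x u V∈ e₁ e₂ (off p∈) (off q∈) (off r∈) (W∈V p∈) (W∈V q∈) (W∈V r∈)) ⟩
          sum2 (wt x) W + 0        ≡⟨ +-identityʳ _ ⟩
          sum2 (wt x) W            ≤⟨ sum2-≤1 uniqueʳ (λ {y} {z} _ _ _ → bit-≤1 (edge x y z)) ⟩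
          binom2 (length W)           ≡⟨ cong binom2 (suc-injective (trans (sym length-V) |V|)) ⟩
          binom2 (6 + k)              ≤⟨ binom2≤matchingFreeMax k ⟩
          matchingFreeMax (7 + k)               ∎
          where
          open ≤-Reasoning
          open Split {v = x ∷ []} uV V↭
          off : ∀ {y} → y ∈ W → x ≢ y
          off y∈ refl = Unique-++-disjoint (x ∷ []) unique (here refl) y∈

      large : Occurs {3} edge₀ V → count V ≤ matchingFreeMax (7 + k)
      large e with occurs? {5} cross₁ V | occurs? {6} cross₂ V | occurs? {5} cross₀ V
      ... | yes c₁ | _      | _      = bound₁ c₁
      ... | _      | yes c₂ | _      = bound₂ c₂
      ... | no ¬c₁ | no ¬c₂ | yes c₀ = Star.bound₄ ¬c₁ ¬c₂ c₀
      ... | _      | _      | no ¬c₀ = bound₃ e ¬c₀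

    count-≤matchingFreeMax : count V ≤ matchingFreeMax (length V)
    count-≤matchingFreeMax with occurs? {3} edge₀ V
    ... | no ¬e = ≤-trans (≤-reflexive (count-0 uV λ {x} {y} {z} x∈ y∈ z∈ e →
                     ¬e (x ∷ y ∷ z ∷ [] , unique₃ e , x∈ ∷ y∈ ∷ z∈ ∷ [] , e ∷ []))) z≤n
    ... | yes e = small (length V) refl
      where
      small : ∀ l → length V ≡ l → count V ≤ matchingFreeMax l
      small 0 eq = ≤-trans (count-≤binom3 uV) (≤-reflexive (cong binom3 eq))
      small 1 eq = ≤-trans (count-≤binom3 uV) (≤-reflexive (cong binom3 eq))
      small 2 eq = ≤-trans (count-≤binom3 uV) (≤-reflexive (cong binom3 eq))
      small 3 eq = ≤-trans (count-≤binom3 uV) (≤-reflexive (cong binom3 eq))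
      small 4 eq = ≤-trans (count-≤binom3 uV) (≤-reflexive (cong binom3 eq))
      small 5 eq = ≤-trans (count-≤binom3 uV) (≤-reflexive (cong binom3 eq))
      small 6 eq = six eq e
      small (suc (suc (suc (suc (suc (suc (suc k))))))) eq = large eq e

-- Numerical inequalities between the bounds.

-- The conditional Turán number for n ≥ 6, with junk value 0 below.
condTurán : ℕ → ℕ
condTurán 0  = 0
condTurán 1  = 0
condTurán 2  = 0
condTurán 3  = 0
condTurán 4  = 0
condTurán 5  = 0
condTurán 6  = 20
condTurán 7  = 20
condTurán 8  = 20
condTurán 9  = 21
condTurán 10 = 24
condTurán 11 = 30
condTurán 12 = 40
condTurán (suc (suc (suc (suc n)))) = 4 + binom2 n

-- Bounds the edges of a path-free 3-graph on n vertices (sharp except for n = 8).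
freeTurán : ℕ → ℕ
freeTurán 0 = 0
freeTurán 1 = 0
freeTurán 2 = 0
freeTurán 3 = 1
freeTurán 4 = 4
freeTurán 5 = 10
freeTurán 6 = 20
freeTurán 7 = 20
freeTurán 8 = 22
freeTurán (suc n) = binom2 n

private
  bounded : ∀ {P : ℕ → ℕ → Set} (p : ℕ → ℕ → Bool) a b → (∀ {k m} → T (p k m) → P k m) →
            T (all (λ k → all (p k) (upTo b)) (upTo a)) → ∀ {k m} → k < a → m < b → P k m
  bounded p a b sound h k<a m<b =
    sound (All.lookup (Allₚ.all⁺ _ (upTo b) (All.lookup (Allₚ.all⁺ _ (upTo a) h) (∈-upTo⁺ k<a))) (∈-upTo⁺ m<b))

  -- With the argument in the form `k + j`, the functions defined by cases on small numbers reduce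
  -- to their last clause.
  from-offset : ∀ k {P : ℕ → Set} → (∀ j → P (k + j)) → ∀ {n} → k ≤ n → P n
  from-offset k {P} h {n} k≤n = subst P (m+[n∸m]≡n k≤n) (h (n ∸ k))

  condTurán-step : ∀ n i → 13 ≤ n → i + 4 ≤ n → condTurán n + i ≤ condTurán (suc n)
  condTurán-step n i 13≤n = from-offset 13 {λ n → i + 4 ≤ n → condTurán n + i ≤ condTurán (suc n)} step 13≤n
    where
    step : ∀ k → i + 4 ≤ 13 + k → condTurán (13 + k) + i ≤ condTurán (14 + k)
    step k i+4≤ = ≤-trans
      (+-monoʳ-≤ (4 + binom2 (9 + k)) (+-cancelʳ-≤ 4 i (9 + k) (≤-trans i+4≤ (≤-reflexive (cong (9 +_) (+-comm 4 k))))))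
      (≤-reflexive (cong (4 +_) (+-comm (binom2 (9 + k)) (9 + k))))

  freeTurán-step : ∀ n → 9 ≤ n → freeTurán (suc n) + 1 ≡ freeTurán n + n
  freeTurán-step n 9≤n = from-offset 9 {λ n → freeTurán (suc n) + 1 ≡ freeTurán n + n} (λ k → lem k (binom2 (8 + k))) 9≤n
    where
    lem : ∀ k c → (8 + k + c) + 1 ≡ c + (9 + k)
    lem = solve-∀

  matchingFreeMax-step : ∀ n → 9 ≤ n → matchingFreeMax (suc n) + 1 ≡ matchingFreeMax n + n
  matchingFreeMax-step n 9≤n = from-offset 9 {λ n → matchingFreeMax (suc n) + 1 ≡ matchingFreeMax n + n} (λ k → lem k (binom2 (8 + k))) 9≤n
    where
    lem : ∀ k c → (8 + k + c) + 1 ≡ c + (9 + k)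
    lem = solve-∀

-- An inequality between the quadratic functions freeTurán and condTurán holds everywhere once it
-- holds for k < 8 and m < 10.
module Growth (u : ℕ → ℕ) (b d s : ℕ) where
  -- In the applications `k` and `m` count the outside vertices of two kinds, good and bad. `u k`
  -- bounds the edges without bad vertices, `b` the link of a bad vertex, and the induction
  -- hypothesis is applied to the bad vertices and `d` others. The whole set has `s` further
  -- vertices.
  lhs : ℕ → ℕ → ℕ
  lhs k m = u k + b * m + freeTurán (d + m)

  rhs : ℕ → ℕ → ℕ
  rhs k m = condTurán (s + (k + m))

  module _ (u-step : ∀ k → 7 ≤ k → u (suc k) + 4 ≤ u k + (s + k))
           {6≤s : True (6 ≤? s)} {bd≤s : True (b + d + 3 ≤? s)}
           {box : T (all (λ k → all (λ m → lhs k m <ᵇ rhs k m) (upTo 10)) (upTo 8))} where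
    private
      inBox : ∀ {k m} → k < 8 → m < 10 → lhs k m < rhs k m
      inBox = bounded (λ k m → lhs k m <ᵇ rhs k m) 8 10 (λ {k} {m} → <ᵇ⇒< (lhs k m) (rhs k m)) box

      rhs-step : ∀ k m → 13 ≤ s + (k + m) → rhs k m + (s + (k + m)) ≤ rhs k (suc m) + 4
      rhs-step k m big = begin
        rhs k m + (s + (k + m))                ≡⟨ cong (rhs k m +_) (m∸n+n≡m (≤-trans (m≤m+n 4 9) big)) ⟨
        rhs k m + (s + (k + m) ∸ 4 + 4)        ≡⟨ +-assoc (rhs k m) _ 4 ⟨
        rhs k m + (s + (k + m) ∸ 4) + 4        ≤⟨ +-monoˡ-≤ 4 (condTurán-step (s + (k + m)) _ big
                                                    (≤-reflexive (m∸n+n≡m (≤-trans (m≤m+n 4 9) big)))) ⟩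
        condTurán (suc (s + (k + m))) + 4             ≡⟨ cong (λ y → condTurán y + 4) (lem s k m) ⟩
        rhs k (suc m) + 4                      ∎
        where
        open ≤-Reasoning
        lem : ∀ s k m → suc (s + (k + m)) ≡ s + (k + suc m)
        lem = solve-∀

      -- From `m` = 9 on, `freeTurán (d + m)` is quadratic even if `d` is 0. The increments then
      -- compare as `b + d + 3` with `s + k`.
      stepM : ∀ k m → 9 ≤ m → lhs k m < rhs k m → lhs k (suc m) < rhs k (suc m)
      stepM k m 9≤m h = +-cancelʳ-< 4 _ _ (begin-strict
        u k + b * suc m + freeTurán (d + suc m) + 4
          ≡⟨ cong (λ x → u k + b * suc m + freeTurán x + 4) (+-suc d m) ⟩
        u k + b * suc m + freeTurán (suc (d + m)) + 4
          ≡⟨ +-assoc (u k + b * suc m) (freeTurán (suc (d + m))) 4 ⟩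
        u k + b * suc m + (freeTurán (suc (d + m)) + 4)
          ≡⟨ cong (u k + b * suc m +_) (trans (sym (+-assoc (freeTurán (suc (d + m))) 1 3))
               (cong (_+ 3) (freeTurán-step (d + m) (≤-trans 9≤m (m≤n+m m d))))) ⟩
        u k + b * suc m + (freeTurán (d + m) + (d + m) + 3)
          ≡⟨ lem (u k) b m (freeTurán (d + m)) d ⟩
        lhs k m + (b + d + 3 + m)
          <⟨ +-monoˡ-< (b + d + 3 + m) h ⟩
        rhs k m + (b + d + 3 + m)
          ≤⟨ +-monoʳ-≤ (rhs k m) (+-mono-≤ (toWitness bd≤s) (m≤n+m m k)) ⟩
        rhs k m + (s + (k + m))
          ≤⟨ rhs-step k m big ⟩
        rhs k (suc m) + 4 ∎)
        where
        open ≤-Reasoning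
        lem : ∀ x b m g d → x + b * suc m + (g + (d + m) + 3) ≡ x + b * m + g + (b + d + 3 + m)
        lem = solve-∀
        big : 13 ≤ s + (k + m)
        big = ≤-trans (m≤m+n 13 2) (+-mono-≤ (toWitness 6≤s) (≤-trans 9≤m (m≤n+m m k)))

      -- Together with `s` at least 6, `k` at least 7 brings the argument of `condTurán` to 13,
      -- where it becomes quadratic.
      stepK : ∀ k m → 7 ≤ k → lhs k m < rhs k m → lhs (suc k) m < rhs (suc k) m
      stepK k m 7≤k h = +-cancelʳ-< 4 _ _ (begin-strict
        u (suc k) + x + freeTurán (d + m) + 4         ≡⟨ lem (u (suc k)) x (freeTurán (d + m)) ⟩
        u (suc k) + 4 + (x + freeTurán (d + m))       ≤⟨ +-monoˡ-≤ (x + freeTurán (d + m)) (u-step k 7≤k) ⟩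
        u k + (s + k) + (x + freeTurán (d + m))       ≡⟨ lem₁ (u k) (s + k) x (freeTurán (d + m)) ⟩
        lhs k m + (s + k)                      <⟨ +-monoˡ-< (s + k) h ⟩
        rhs k m + (s + k)                      ≤⟨ +-monoʳ-≤ (rhs k m) (+-monoʳ-≤ s (m≤m+n k m)) ⟩
        rhs k m + (s + (k + m))                ≤⟨ rhs-step k m big ⟩
        rhs k (suc m) + 4                      ≡⟨ cong (λ y → condTurán (s + y) + 4) (+-suc k m) ⟩
        rhs (suc k) m + 4                      ∎)
        where
        open ≤-Reasoning
        x = b * m
        lem : ∀ u x g → u + x + g + 4 ≡ u + 4 + (x + g)
        lem = solve-∀
        lem₁ : ∀ u y x g → u + y + (x + g) ≡ u + x + g + y
        lem₁ = solve-∀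
        big : 13 ≤ s + (k + m)
        big = +-mono-≤ (toWitness 6≤s) (≤-trans 7≤k (m≤m+n k m))

      narrow : ∀ {k} m → k < 8 → lhs k m < rhs k m
      narrow {k} zero    k<8 = inBox k<8 (s≤s z≤n)
      narrow {k} (suc m) k<8 with suc m <? 10
      ... | yes m<10 = inBox k<8 m<10
      ... | no  m≮10 = stepM k m (≤-pred (≮⇒≥ m≮10)) (narrow m k<8)

    grow : ∀ k m → lhs k m < rhs k m
    grow zero    m = narrow m (s≤s z≤n)
    grow (suc k) m with suc k <? 8
    ... | yes k<8 = narrow m k<8
    ... | no  k≮8 = stepK k m (≤-pred (≮⇒≥ k≮8)) (grow k m)

-- The condition on `c` is what the range provides: `c + 4` is at most 13, and 13 is at most
-- `s + k`.
linear-step : ∀ a c s {c≤9 : True (c ≤? 9)} {6≤s : True (6 ≤? s)} → ∀ k → 7 ≤ k → a + c * suc k + 4 ≤ a + c * k + (s + k)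
linear-step a c s {c≤9} {6≤s} k 7≤k =
  ≤-trans (≤-reflexive (lem a c k))
          (+-monoʳ-≤ (a + c * k) (≤-trans (+-monoˡ-≤ 4 (toWitness c≤9)) (+-mono-≤ (toWitness 6≤s) 7≤k)))
  where
  lem : ∀ a c k → a + c * suc k + 4 ≡ a + c * k + (c + 4)
  lem = solve-∀

quadratic-step : ∀ a s {8≤s : True (8 ≤? s)} → ∀ k → 7 ≤ k → a + 4 * suc k + binom2 (suc k) + 4 ≤ a + 4 * k + binom2 k + (s + k)
quadratic-step a s {8≤s} k _ =
  ≤-trans (≤-reflexive (lem a k (binom2 k))) (+-monoʳ-≤ (a + 4 * k + binom2 k) (+-monoˡ-≤ k (toWitness 8≤s)))
  where
  lem : ∀ a k c → a + 4 * suc k + (k + c) + 4 ≡ a + 4 * k + c + (8 + k)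
  lem = solve-∀

private
  -- Each part contains an edge, whence the offsets 3. Outside the box the larger part grows, and
  -- `flip` exchanges the parts when it is the first. With `e` = 0 this becomes superadditivity,
  -- with `e` = 1 a strict inequality.
  module Parts (F : ℕ → ℕ) (F-step : ∀ n i → 13 ≤ n → i + 4 ≤ n → F n + i ≤ F (suc n)) (e : ℕ)
               (box : T (all (λ a → all (λ b → (e + matchingFreeMax (3 + a) + matchingFreeMax (3 + b)) ≤ᵇ F (6 + (a + b))) (upTo 8)) (upTo 8))) where

    Good : ℕ → ℕ → Set
    Good a b = e + matchingFreeMax (3 + a) + matchingFreeMax (3 + b) ≤ F (6 + (a + b))

    inBox : ∀ {a b} → a < 8 → b < 8 → Good a b
    inBox = bounded (λ a b → (e + matchingFreeMax (3 + a) + matchingFreeMax (3 + b)) ≤ᵇ F (6 + (a + b))) 8 8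
      (λ {a} {b} → ≤ᵇ⇒≤ (e + matchingFreeMax (3 + a) + matchingFreeMax (3 + b)) (F (6 + (a + b)))) box

    step : ∀ a b → 7 ≤ b → Good a b → Good a (suc b)
    step a b 7≤b h = +-cancelʳ-≤ 1 _ _ (begin
      x + matchingFreeMax (4 + b) + 1                  ≡⟨ +-assoc x (matchingFreeMax (4 + b)) 1 ⟩
      x + (matchingFreeMax (4 + b) + 1)                ≡⟨ cong (x +_) (matchingFreeMax-step (3 + b) (≤-trans (m≤m+n 9 1) (+-monoʳ-≤ 3 7≤b))) ⟩
      x + (matchingFreeMax (3 + b) + (3 + b))          ≡⟨ lem x (matchingFreeMax (3 + b)) b ⟩
      x + matchingFreeMax (3 + b) + (2 + b) + 1        ≤⟨ +-monoˡ-≤ 1 (+-monoˡ-≤ (2 + b) h) ⟩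
      F (6 + (a + b)) + (2 + b) + 1       ≤⟨ +-monoˡ-≤ 1 (F-step (6 + (a + b)) (2 + b) big fits) ⟩
      F (7 + (a + b)) + 1                 ≡⟨ cong (λ y → F (6 + y) + 1) (sym (+-suc a b)) ⟩
      F (6 + (a + suc b)) + 1             ∎)
      where
      open ≤-Reasoning
      x = e + matchingFreeMax (3 + a)
      lem : ∀ x j b → x + (j + (3 + b)) ≡ x + j + (2 + b) + 1
      lem = solve-∀
      big : 13 ≤ 6 + (a + b)
      big = +-monoʳ-≤ 6 (≤-trans 7≤b (m≤n+m b a))
      fits : 2 + b + 4 ≤ 6 + (a + b)
      fits = ≤-trans (≤-reflexive (+-comm (2 + b) 4)) (+-monoʳ-≤ 6 (m≤n+m b a))

    flip : ∀ a b → Good a b → Good b a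
    flip a b = subst₂ _≤_ (lem e (matchingFreeMax (3 + a)) (matchingFreeMax (3 + b))) (cong (λ y → F (6 + y)) (+-comm a b))
      where
      lem : ∀ e x y → e + x + y ≡ e + y + x
      lem = solve-∀

    narrow : ∀ {a} b → a < 8 → Good a b
    narrow zero    a<8 = inBox a<8 (s≤s z≤n)
    narrow {a} (suc b) a<8 with suc b <? 8
    ... | yes b<8 = inBox a<8 b<8
    ... | no  b≮8 = step a b (≤-pred (≮⇒≥ b≮8)) (narrow b a<8)

    good : ∀ a b → Good a b
    good zero    b = narrow b (s≤s z≤n)
    good (suc a) b with suc a <? 8
    ... | yes a<8 = narrow b a<8
    ... | no  a≮8 = flip b (suc a) (step b a (≤-pred (≮⇒≥ a≮8)) (flip a b (good a b)))

  matchingFreeMax-step′ : ∀ n i → 13 ≤ n → i + 4 ≤ n → matchingFreeMax n + i ≤ matchingFreeMax (suc n)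
  matchingFreeMax-step′ n i 13≤n i+4≤n = +-cancelʳ-≤ 1 _ _ (begin
    matchingFreeMax n + i + 1    ≡⟨ +-assoc (matchingFreeMax n) i 1 ⟩
    matchingFreeMax n + (i + 1)  ≤⟨ +-monoʳ-≤ (matchingFreeMax n) (≤-trans (+-monoʳ-≤ i (m≤m+n 1 3)) i+4≤n) ⟩
    matchingFreeMax n + n        ≡⟨ matchingFreeMax-step n (≤-trans (m≤m+n 9 4) 13≤n) ⟨
    matchingFreeMax (suc n) + 1  ∎)
    where open ≤-Reasoning

matchingFreeMax-super : ∀ a b → matchingFreeMax (3 + a) + matchingFreeMax (3 + b) ≤ matchingFreeMax (6 + (a + b))
matchingFreeMax-super = Parts.good matchingFreeMax matchingFreeMax-step′ 0 tt

matchingFreeMax<condTurán : ∀ a b → matchingFreeMax (3 + a) + matchingFreeMax (3 + b) < condTurán (6 + (a + b))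
matchingFreeMax<condTurán = Parts.good condTurán condTurán-step 1 tt

matchingFreeMax≤freeTurán : ∀ n → matchingFreeMax n ≤ freeTurán n
matchingFreeMax≤freeTurán 0 = ≤-refl
matchingFreeMax≤freeTurán 1 = ≤-refl
matchingFreeMax≤freeTurán 2 = ≤-refl
matchingFreeMax≤freeTurán 3 = ≤-refl
matchingFreeMax≤freeTurán 4 = ≤-refl
matchingFreeMax≤freeTurán 5 = ≤-refl
matchingFreeMax≤freeTurán 6 = m≤m+n 10 10
matchingFreeMax≤freeTurán 7 = m≤m+n 18 2
matchingFreeMax≤freeTurán 8 = ≤-refl
matchingFreeMax≤freeTurán (suc (suc (suc (suc (suc (suc (suc (suc (suc n))))))))) = ≤-refl

condTurán≤freeTurán : ∀ n → condTurán n ≤ freeTurán n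
condTurán≤freeTurán 0 = z≤n
condTurán≤freeTurán 1 = z≤n
condTurán≤freeTurán 2 = z≤n
condTurán≤freeTurán 3 = z≤n
condTurán≤freeTurán 4 = z≤n
condTurán≤freeTurán 5 = z≤n
condTurán≤freeTurán 6 = ≤-refl
condTurán≤freeTurán 7 = ≤-refl
condTurán≤freeTurán 8 = m≤m+n 20 2
condTurán≤freeTurán 9 = m≤m+n 21 7
condTurán≤freeTurán 10 = m≤m+n 24 12
condTurán≤freeTurán 11 = m≤m+n 30 15
condTurán≤freeTurán 12 = m≤m+n 40 15
condTurán≤freeTurán (suc (suc (suc (suc (suc (suc (suc (suc (suc (suc (suc (suc (suc n))))))))))))) =
  ≤-trans (≤-trans (+-monoʳ-≤ 4 (m≤n+m (binom2 (9 + n)) (9 + n))) (+-monoˡ-≤ (binom2 (10 + n)) (m≤m+n 4 (6 + n))))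
          (m≤n+m (binom2 (11 + n)) (11 + n))

-- Some constants are shifted by bad vertices known to exist. `alpha-heavy` and `base-56` have three
-- of them split off, so `s` and `d` rise by 3, and so does the constant (6 to 9, 8 to 11) since
-- these three contribute at most 3 in total. `alpha-rest` has one, which turns 10 into 11. In
-- `closed-large` the variable `k` is a dummy.
module Estimates where
  alpha-linked : ∀ k m → 6 + 4 * k + binom2 k + 2 * m + freeTurán (2 + m) < condTurán (8 + (k + m))
  alpha-linked = Growth.grow (λ k → 6 + 4 * k + binom2 k) 2 2 8 (quadratic-step 6 8)

  alpha-heavy : ∀ k m → 9 + 4 * k + binom2 k + 3 * m + freeTurán (5 + m) < condTurán (11 + (k + m))
  alpha-heavy = Growth.grow (λ k → 9 + 4 * k + binom2 k) 3 5 11 (quadratic-step 9 11)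

  alpha-rest : ∀ k m → 11 + 4 * k + binom2 k + 1 * m + freeTurán (3 + m) < condTurán (9 + (k + m))
  alpha-rest = Growth.grow (λ k → 11 + 4 * k + binom2 k) 1 3 9 (quadratic-step 11 9)

  alpha-deficient : ∀ k m → 9 + 4 * k + binom2 k + 0 * m + freeTurán (0 + m) < condTurán (8 + (k + m))
  alpha-deficient = Growth.grow (λ k → 9 + 4 * k + binom2 k) 0 0 8 (quadratic-step 9 8)

  beta-bound : ∀ k m → 8 + 5 * k + 3 * m + freeTurán (0 + m) < condTurán (8 + (k + m))
  beta-bound = Growth.grow (λ k → 8 + 5 * k) 3 0 8 (linear-step 8 5 8)

  base-56 : ∀ k m → 11 + 4 * k + 1 * m + freeTurán (3 + m) < condTurán (9 + (k + m))
  base-56 = Growth.grow (λ k → 11 + 4 * k) 1 3 9 (linear-step 11 4 9)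

  closed-large : ∀ m → 20 + 0 * m + freeTurán (8 + m) < condTurán (14 + m)
  closed-large m = Growth.grow (λ k → 20 + 0 * k) 0 8 14 (linear-step 20 0 14) 0 m

-- Path-free 3-graphs whose disjoint edges are never joined.

-- Two disjoint edges, joined by an edge in the case of base.
disjoint base : List (Triple (Fin (6 + m)))
disjoint = (0F , 1F , 2F) ∷ (3F , 4F , 5F) ∷ []
base     = (0F , 1F , 2F) ∷ (1F , 2F , 3F) ∷ (3F , 4F , 5F) ∷ []

module _ {n} (G : 3Graph (Fin n)) (pf : 3Graph.PathFree G) where
  open 3Graph G
  open Vertices G

  AnyIn : Fin n → Fin n → Fin n → List (Fin n) → Set
  AnyIn x y z V = x ∈ V ⊎ y ∈ V ⊎ z ∈ V

  anyIn-rotate : ∀ {x y z V} → AnyIn x y z V → AnyIn y z x V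
  anyIn-rotate (inj₁ x)        = inj₂ (inj₂ x)
  anyIn-rotate (inj₂ (inj₁ y)) = inj₁ y
  anyIn-rotate (inj₂ (inj₂ z)) = inj₂ (inj₁ z)

  Occurs-⊆ : ∀ {K : List (Triple (Fin m))} {V W} → (∀ {x} → x ∈ W → x ∈ V) → Occurs K W → Occurs K V
  Occurs-⊆ W⊆V (v , u , v∈ , K✓) = v , u , All.map W⊆V v∈ , K✓

  module Unlinked {V} (¬base : ¬ Occurs {6} base V) where

    -- An edge meeting each of two disjoint edges would complete a path or a copy of base.
    module _ {a₁ a₂ a₃ b₁ b₂ b₃} (u : Unique (a₁ ∷ a₂ ∷ a₃ ∷ b₁ ∷ b₂ ∷ b₃ ∷ []))
             (∈V : All (_∈ V) (a₁ ∷ a₂ ∷ a₃ ∷ b₁ ∷ b₂ ∷ b₃ ∷ [])) where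

      private
        as bs : List (Fin n)
        as = a₁ ∷ a₂ ∷ a₃ ∷ []
        bs = b₁ ∷ b₂ ∷ b₃ ∷ []

        base-occurs : ∀ {c₁ c₂ c₃ d₁ d₂ d₃} → as ++ bs ↭ c₁ ∷ c₂ ∷ c₃ ∷ d₁ ∷ d₂ ∷ d₃ ∷ [] →
                      Adj c₁ c₂ c₃ → Adj c₂ c₃ d₁ → Adj d₁ d₂ d₃ → ⊥
        base-occurs {c₁} {c₂} {c₃} {d₁} {d₂} {d₃} p e f g =
          ¬base (c₁ ∷ c₂ ∷ c₃ ∷ d₁ ∷ d₂ ∷ d₃ ∷ [] , Unique-↭ p u , Permutationₚ.All-resp-↭ p ∈V , e ∷ f ∷ g ∷ [])

      core : ∀ {z} → z ∈ V → Adj a₁ a₂ a₃ → Adj b₁ b₂ b₃ → Adj a₃ b₁ z → ⊥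
      core {z} z∈ e f g with z ≟ᶠ a₁ | z ≟ᶠ a₂ | z ≟ᶠ b₂ | z ≟ᶠ b₃
      -- If `z` lies in one of the two edges, then that edge shares two vertices with the joining
      -- edge, and the other edge hangs on the third: this is `base`, with the edges exchanged when
      -- `z` is in the second. Otherwise the three edges form a path.
      ... | yes refl | _ | _ | _ = base-occurs (swap a₁ a₂ refl) (flip₁ e) (rotate (rotate g)) f
      ... | _ | yes refl | _ | _ = base-occurs refl e (rotate (rotate g)) f
      ... | _ | _ | yes refl | _ =
        base-occurs (↭-trans (Permutationₚ.++-comm as bs)
                      (↭-trans (prep b₁ (swap b₂ b₃ refl)) (↭-trans (swap b₁ b₃ refl) (↭-trans (prep b₃ (swap b₁ b₂ refl))
                        (prep b₃ (prep b₂ (prep b₁ (↭-trans (prep a₁ (swap a₂ a₃ refl)) (swap a₁ a₃ refl)))))))))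
                    (flip₁₃ f) (flip₁₃ g) (rotate (rotate e))
      ... | _ | _ | _ | yes refl =
        base-occurs (↭-trans (Permutationₚ.++-comm as bs)
                      (↭-trans (swap b₁ b₂ refl) (↭-trans (prep b₂ (swap b₁ b₃ refl))
                        (prep b₂ (prep b₃ (prep b₁ (↭-trans (prep a₁ (swap a₂ a₃ refl)) (swap a₁ a₃ refl))))))))
                    (rotate f) (flip₁₃ g) (rotate (rotate e))
      ... | no z≢a₁ | no z≢a₂ | no z≢b₂ | no z≢b₃ = pf unique e (flip₂ g) f
        where
        unique : Unique (a₁ ∷ a₂ ∷ a₃ ∷ z ∷ b₁ ∷ b₂ ∷ b₃ ∷ [])
        unique = Unique-↭ (↭-sym (Permutationₚ.shift z as bs)) (z∉ ∷ u)
          where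
          z∉ : All (z ≢_) (as ++ bs)
          z∉ = z≢a₁ ∷ z≢a₂ ∷ proj₁ (proj₂ (edge-distinct g)) ∘ sym ∷ proj₂ (proj₂ (edge-distinct g)) ∘ sym ∷ z≢b₂ ∷ z≢b₃ ∷ []

    module _ {a₁ a₂ a₃ b₁ b₂ b₃ : Fin n} where
      private
        as bs : List (Fin n)
        as = a₁ ∷ a₂ ∷ a₃ ∷ []
        bs = b₁ ∷ b₂ ∷ b₃ ∷ []

      core′ : Unique (as ++ bs) → All (_∈ V) (as ++ bs) → ∀ {q z} → q ∈ bs → z ∈ V →
              Adj a₁ a₂ a₃ → Adj b₁ b₂ b₃ → Adj a₃ q z → ⊥
      core′ u ∈V (here refl) z∈ e f g = core u ∈V z∈ e f g
      core′ u ∈V (there (here refl)) z∈ e f g =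
        core (Unique-↭ p u) (Permutationₚ.All-resp-↭ p ∈V) z∈ e (rotate f) g
        where p = Permutationₚ.++⁺ˡ as (Permutationₚ.++-comm (b₁ ∷ []) (b₂ ∷ b₃ ∷ []))
      core′ u ∈V (there (there (here refl))) z∈ e f g =
        core (Unique-↭ p u) (Permutationₚ.All-resp-↭ p ∈V) z∈ e (rotate (rotate f)) g
        where p = Permutationₚ.++⁺ˡ as (Permutationₚ.++-comm (b₁ ∷ b₂ ∷ []) (b₃ ∷ []))

    module _ {a₁ a₂ a₃ b₁ b₂ b₃} (u : Unique (a₁ ∷ a₂ ∷ a₃ ∷ b₁ ∷ b₂ ∷ b₃ ∷ []))
             (∈V : All (_∈ V) (a₁ ∷ a₂ ∷ a₃ ∷ b₁ ∷ b₂ ∷ b₃ ∷ []))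
             (e : Adj a₁ a₂ a₃) (f : Adj b₁ b₂ b₃) where
      private
        as bs : List (Fin n)
        as = a₁ ∷ a₂ ∷ a₃ ∷ []
        bs = b₁ ∷ b₂ ∷ b₃ ∷ []

        core″ : ∀ {p q z} → p ∈ as → q ∈ bs → z ∈ V → Adj p q z → ⊥
        core″ (there (there (here refl))) q∈ z∈ g = core′ u ∈V q∈ z∈ e f g
        core″ (here refl)                 q∈ z∈ g =
          core′ (Unique-↭ p u) (Permutationₚ.All-resp-↭ p ∈V) q∈ z∈ (rotate e) f g
          where p = Permutationₚ.++⁺ʳ bs (Permutationₚ.++-comm (a₁ ∷ []) (a₂ ∷ a₃ ∷ []))
        core″ (there (here refl))         q∈ z∈ g =
          core′ (Unique-↭ p u) (Permutationₚ.All-resp-↭ p ∈V) q∈ z∈ (rotate (rotate e)) f g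
          where p = Permutationₚ.++⁺ʳ bs (Permutationₚ.++-comm (a₁ ∷ a₂ ∷ []) (a₃ ∷ []))

        second : ∀ {x y z} → All (_∈ V) (x ∷ y ∷ z ∷ []) → Adj x y z → x ∈ as → AnyIn x y z bs → ⊥
        second ∈V                  g x∈ (inj₁ x∈b)        = Unique-++-disjoint as u x∈ x∈b
        second (_ ∷ _ ∷ z∈ ∷ [])   g x∈ (inj₂ (inj₁ y∈b)) = core″ x∈ y∈b z∈ g
        second (_ ∷ y∈ ∷ _ ∷ [])   g x∈ (inj₂ (inj₂ z∈b)) = core″ x∈ z∈b y∈ (flip₂ g)

      unlinked : ∀ {x y z} → All (_∈ V) (x ∷ y ∷ z ∷ []) → Adj x y z → AnyIn x y z as → AnyIn x y z bs → ⊥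
      unlinked ∈V g (inj₁ x∈) any = second ∈V g x∈ any
      unlinked (x∈V ∷ y∈V ∷ z∈V ∷ []) g (inj₂ (inj₁ y∈)) any =
        second (y∈V ∷ z∈V ∷ x∈V ∷ []) (rotate g) y∈ (anyIn-rotate any)
      unlinked (x∈V ∷ y∈V ∷ z∈V ∷ []) g (inj₂ (inj₂ z∈)) any =
        second (z∈V ∷ x∈V ∷ y∈V ∷ []) (rotate (rotate g)) z∈ (anyIn-rotate (anyIn-rotate any))

    -- Hence meeting the edge a₁a₂a₃ is constant along intersecting edges, and the vertices of the
    -- edges meeting it form a union of components.
    module Component (uV : Unique V) {a₁ a₂ a₃ b₁ b₂ b₃} (uab : Unique (a₁ ∷ a₂ ∷ a₃ ∷ b₁ ∷ b₂ ∷ b₃ ∷ []))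
                     (ab∈V : All (_∈ V) (a₁ ∷ a₂ ∷ a₃ ∷ b₁ ∷ b₂ ∷ b₃ ∷ []))
                     (ea : Adj a₁ a₂ a₃) (eb : Adj b₁ b₂ b₃) where
      private
        as bs : List (Fin n)
        as = a₁ ∷ a₂ ∷ a₃ ∷ []
        bs = b₁ ∷ b₂ ∷ b₃ ∷ []

        a∈V : All (_∈ V) as
        a∈V = All.head ab∈V ∷ All.head (All.tail ab∈V) ∷ All.head (All.tail (All.tail ab∈V)) ∷ []

        b∈V : All (_∈ V) bs
        b∈V = All.tail (All.tail (All.tail ab∈V))

      anyIn? : ∀ x y z V → Dec (AnyIn x y z V)
      anyIn? x y z V = (x ∈? V) ⊎-dec (y ∈? V) ⊎-dec (z ∈? V)

      Near : Fin n → Set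
      Near x = ∃[ y ] ∃[ z ] All (_∈ V) (x ∷ y ∷ z ∷ []) × Adj x y z × AnyIn x y z as

      near? : ∀ x → Dec (Near x)
      near? x = any? λ y → any? λ z → All.all? (_∈? V) _ ×-dec (edge x y z ≟ᵇ true) ×-dec anyIn? x y z as

      -- If the edge missed `a₁a₂a₃`, these would be two disjoint edges joined by the edge which
      -- makes `x` near.
      spread : ∀ {x y z} → All (_∈ V) (x ∷ y ∷ z ∷ []) → Adj x y z → Near x → AnyIn x y z as
      spread {x} {y} {z} ∈V e (y′ , z′ , ∈V′ , e′ , meets) with anyIn? x y z as
      ... | yes p  = p
      ... | no ¬in = ⊥-elim (unlinked (Uniqueₚ.++⁺ (unique₃ ea) (unique₃ e) apart) (Allₚ.++⁺ a∈V ∈V) ea e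
                                      ∈V′ e′ meets (inj₁ (here refl)))
        where
        apart : ∀ {t} → ¬ (t ∈ as × t ∈ x ∷ y ∷ z ∷ [])
        apart (t∈ , here refl)                 = ¬in (inj₁ t∈)
        apart (t∈ , there (here refl))         = ¬in (inj₂ (inj₁ t∈))
        apart (t∈ , there (there (here refl))) = ¬in (inj₂ (inj₂ t∈))

      S R : List (Fin n)
      S = filter near? V
      R = filter (¬? ∘ near?) V

      V↭SR : V ↭ S ++ R
      V↭SR = filter-split-↭ near? V

      S-near : ∀ {x} → x ∈ S → x ∈ V × Near x
      S-near = ∈-filter⁻ near?

      R-far : ∀ {x} → x ∈ R → x ∈ V × ¬ Near x
      R-far = ∈-filter⁻ (¬? ∘ near?)

      closed : ∀ {x r y} → x ∈ S → r ∈ R → y ∈ V → ¬ Adj x r y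
      closed {x} {r} {y} x∈ r∈ y∈ e with S-near x∈ | R-far r∈
      ... | x∈V , near | r∈V , ¬near =
        ¬near (y , x , r∈V ∷ y∈ ∷ x∈V ∷ [] , rotate e , anyIn-rotate (spread (x∈V ∷ r∈V ∷ y∈ ∷ []) e near))

      -- All edges within `S` meet `a₁a₂a₃`, so this edge itself would join two disjoint ones.
      S-matchingFree : MatchingFree G S
      S-matchingFree {a} {b} {c} {d} {e} {f} u (a∈ ∷ b∈ ∷ c∈ ∷ d∈ ∷ e∈ ∷ f∈ ∷ []) x y =
        unlinked u (Allₚ.++⁺ abc def) x y a∈V ea (meets (spread abc x (proj₂ (S-near a∈))))
                                                 (meets (spread def y (proj₂ (S-near d∈))))
        where
        in-V = λ {x} (x∈ : x ∈ S) → proj₁ (S-near x∈)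
        abc : All (_∈ V) (a ∷ b ∷ c ∷ [])
        abc = in-V a∈ ∷ in-V b∈ ∷ in-V c∈ ∷ []
        def : All (_∈ V) (d ∷ e ∷ f ∷ [])
        def = in-V d∈ ∷ in-V e∈ ∷ in-V f∈ ∷ []
        swap∈ : ∀ {x xs} → x ∈ as → x ∈ xs → AnyIn a₁ a₂ a₃ xs
        swap∈ (here refl)                 x∈ = inj₁ x∈
        swap∈ (there (here refl))         x∈ = inj₂ (inj₁ x∈)
        swap∈ (there (there (here refl))) x∈ = inj₂ (inj₂ x∈)
        meets : ∀ {x y z} → AnyIn x y z as → AnyIn a₁ a₂ a₃ (x ∷ y ∷ z ∷ [])
        meets (inj₁ x∈)        = swap∈ x∈ (here refl)
        meets (inj₂ (inj₁ y∈)) = swap∈ y∈ (there (here refl))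
        meets (inj₂ (inj₂ z∈)) = swap∈ z∈ (there (there (here refl)))

      a∈S : All (_∈ S) as
      a∈S with a∈V
      ... | a₁∈ ∷ a₂∈ ∷ a₃∈ ∷ [] =
        ∈-filter⁺ near? a₁∈ (a₂ , a₃ , a₁∈ ∷ a₂∈ ∷ a₃∈ ∷ [] , ea , inj₁ (here refl)) ∷
        ∈-filter⁺ near? a₂∈ (a₃ , a₁ , a₂∈ ∷ a₃∈ ∷ a₁∈ ∷ [] , rotate ea , inj₁ (there (here refl))) ∷
        ∈-filter⁺ near? a₃∈ (a₁ , a₂ , a₃∈ ∷ a₁∈ ∷ a₂∈ ∷ [] , rotate (rotate ea) , inj₁ (there (there (here refl)))) ∷ []

      b∈R : All (_∈ R) bs
      b∈R = All.tabulate λ b∈ → ∈-filter⁺ (¬? ∘ near?) (All.lookup b∈V b∈)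
        λ (y , z , ∈V , e , meets) → unlinked uab ab∈V ea eb ∈V e meets (inj₁ b∈)

      uSR : Unique (S ++ R)
      uSR = Unique-↭ V↭SR uV

      uS : Unique S
      uS = Unique-++ˡ S uSR

      uR : Unique R
      uR = Unique-++ʳ S uSR

      count-SR : count V ≡ count S + count R
      count-SR = begin
        count V                       ≡⟨ sum3-↭ wt-sym V↭SR ⟩
        count (S ++ R)                ≡⟨ sum3-++ wt-sym S R ⟩
        count S + c + p + count R     ≡⟨ cong₂ (λ c p → count S + c + p + count R) c≡0 p≡0 ⟩
        count S + 0 + 0 + count R     ≡⟨ cong (_+ count R) (trans (+-identityʳ _) (+-identityʳ _)) ⟩
        count S + count R             ∎
        where
        open ≡-Reasoning
        c = sum1 (λ r → sum2 (wt r) S) R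
        p = sum2 (λ r r′ → sum1 (λ x → wt x r r′) S) R
        c≡0 : c ≡ 0
        c≡0 = sum1-0 R λ r∈ → sum2-0 uS λ x∈ y∈ _ → bit-false (closed x∈ r∈ (proj₁ (S-near y∈)) ∘ flip₁)
        p≡0 : p ≡ 0
        p≡0 = sum2-0 uR λ r∈ r′∈ _ → sum1-0 S λ x∈ → bit-false (closed x∈ r∈ (proj₁ (R-far r′∈)))

      sizes : ∃[ a ] ∃[ b ] length S ≡ 3 + a × length R ≡ 3 + b × length V ≡ 6 + (a + b)
      sizes with split-off (unique₃ ea) a∈S | split-off (unique₃ eb) b∈R
      ... | S′ , p | R′ , q = length S′ , length R′ , ↭-length p , ↭-length q , (begin
        length V                             ≡⟨ ↭-length V↭SR ⟩
        length (S ++ R)                      ≡⟨ length-++ S ⟩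
        length S + length R                  ≡⟨ cong₂ _+_ (↭-length p) (↭-length q) ⟩
        (3 + length S′) + (3 + length R′)    ≡⟨ lem (length S′) (length R′) ⟩
        6 + (length S′ + length R′)          ∎)
        where
        open ≡-Reasoning
        lem : ∀ a b → (3 + a) + (3 + b) ≡ 6 + (a + b)
        lem = solve-∀

  matching? : ∀ V → Dec (Occurs {6} disjoint V)
  matching? = occurs? disjoint

  no-matching : ∀ {V} → ¬ Occurs {6} disjoint V → MatchingFree G V
  no-matching ¬m u ∈V e f = ¬m (_ ∷ _ ∷ _ ∷ _ ∷ _ ∷ _ ∷ [] , u , ∈V , e ∷ f ∷ [])

  -- Splitting off `S` leaves a smaller `R` without `base`, where the argument is repeated.
  -- Superadditivity merges the bounds of the pieces.
  count-unlinked : ∀ {V} → Acc _<_ (length V) → Unique V → ¬ Occurs {6} base V → count V ≤ matchingFreeMax (length V)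
  count-unlinked-parts : ∀ {V} → Acc _<_ (length V) → Unique V → ¬ Occurs {6} base V → Occurs {6} disjoint V →
    ∃[ a ] ∃[ b ] length V ≡ 6 + (a + b) × count V ≤ matchingFreeMax (3 + a) + matchingFreeMax (3 + b)

  count-unlinked {V} ac u ¬base with matching? V
  ... | no ¬m = MatchingFreeBound.count-≤matchingFreeMax G u (no-matching ¬m)
  ... | yes m with count-unlinked-parts ac u ¬base m
  ... | a , b , l , le = ≤-trans le (≤-trans (matchingFreeMax-super a b) (≤-reflexive (cong matchingFreeMax (sym l))))

  count-unlinked-parts {V} (acc rec) u ¬base (_ ∷ _ ∷ _ ∷ _ ∷ _ ∷ _ ∷ [] , uab , ab∈ , ea ∷ eb ∷ []) =
    let a , b , la , lb , l = sizes in a , b , l , (begin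
      count V                   ≡⟨ count-SR ⟩
      count S + count R         ≤⟨ +-mono-≤ (MatchingFreeBound.count-≤matchingFreeMax G uS S-matchingFree)
                                            (count-unlinked (rec (smaller a b lb l)) uR
                                              (¬base ∘ Occurs-⊆ (proj₁ ∘ R-far))) ⟩
      matchingFreeMax (length S) + matchingFreeMax (length R) ≡⟨ cong₂ (λ a b → matchingFreeMax a + matchingFreeMax b) la lb ⟩
      matchingFreeMax (3 + a) + matchingFreeMax (3 + b)   ∎)
    where
    open ≤-Reasoning
    open Unlinked.Component ¬base u uab ab∈ ea eb
    smaller : ∀ a b → length R ≡ 3 + b → length V ≡ 6 + (a + b) → length R < length V
    smaller a b lb l = subst₂ _<_ (sym lb) (sym l) (+-mono-≤ (m≤m+n 4 2) (m≤n+m b a))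

  count-unlinked-< : ∀ {V} → Unique V → ¬ Occurs {6} base V → Occurs {6} disjoint V → count V < condTurán (length V)
  count-unlinked-< u ¬base m with count-unlinked-parts (<-wellFounded _) u ¬base m
  ... | a , b , l , le = ≤-trans (s≤s le) (≤-trans (matchingFreeMax<condTurán a b) (≤-reflexive (cong condTurán (sym l))))

-- Counting edges around a labelled configuration.

module PathConf {m} = Bound (_≡ᵗ_ {m}) pathConf

link₂ : Fin m × Fin m → Triple (Fin (2 + m))
link₂ (i , j) = 0F , suc (suc i) , suc (suc j)

link₃ : Fin m × Fin m → Triple (Fin (3 + m))
link₃ (i , j) = 0F , suc (suc (suc i)) , suc (suc (suc j))

repeated : Triple (Fin m) → Bool
repeated (i , j , k) = (i ≡ᶠ j) ∨ (i ≡ᶠ k) ∨ (j ≡ᶠ k)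

module _ {n} (G : 3Graph (Fin n)) (pf : 3Graph.PathFree G) where
  open 3Graph G
  open Vertices G

  module Labels {m} {v : Vec (Fin n) m} (u : Unique (toList v)) {K} (K✓ : Present v K) where
    open PathBound pf {v = v} u

    contradiction : T (any (killed K) K) → ⊥
    contradiction = inconsistent K✓

    killed-absent′ : ∀ t → T (killed K t) → valueAt v t ≡ false
    killed-absent′ = killed-absent K✓

    bounded-by : ∀ {N} → Absent v N → ∀ L → sum1 (bit ∘ valueAt v) L ≤ bound K N L
    bounded-by = bound-sound K✓

    absentees : ∀ {J : Set} (f : J → Triple (Fin m)) L → All (λ j → valueAt v (f j) ≡ false) (filterᵇ (killed K ∘ f) L)
    absentees = killed-all K✓

    -- Triples with repeated labels are included, so that the absence of edges can be tested over a
    -- full product of label ranges.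
    dead : List (Triple (Fin m)) → Triple (Fin m) → Bool
    dead N t = repeated t ∨ killed K t ∨ any (t ≡ᵗ_) N

    private
      no-repeat : ∀ t → T (repeated t) → ¬ (valueAt v t ≡ true)
      no-repeat (i , j , k) r e =
        [ i≢j ∘ same , [ i≢k ∘ same , j≢k ∘ same ]′ ∘ Equivalence.to (T-∨ {i ≡ᶠ k}) ]′ (Equivalence.to (T-∨ {i ≡ᶠ j}) r)
        where
        same : ∀ {i j} → T (i ≡ᶠ j) → lookup v i ≡ lookup v j
        same = cong (lookup v) ∘ ≡ᶠ-sound
        i≢j = proj₁ (edge-distinct e)
        i≢k = proj₁ (proj₂ (edge-distinct e))
        j≢k = proj₂ (proj₂ (edge-distinct e))

      listed : ∀ {N} t → Any (T ∘ (t ≡ᵗ_)) N → Absent v N → valueAt v t ≡ false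
      listed t (here eq) (a ∷ _)  = trans (cong (valueAt v) (≡ᵗ-sound {s = t} eq)) a
      listed t (there p) (_ ∷ as) = listed t p as

    dead-absent : ∀ {N} → Absent v N → ∀ t → T (dead N t) → ¬ (valueAt v t ≡ true)
    dead-absent {N} N✓ t d e =
      [ (λ r → no-repeat t r e)
      , [ not-both ∘ killed-absent′ t , (λ t∈ → not-both (listed t (any⁻ (t ≡ᵗ_) N t∈) N✓)) ]′ ∘ Equivalence.to (T-∨ {killed K t})
      ]′ (Equivalence.to (T-∨ {repeated t}) d)
      where
      not-both : ¬ (valueAt v t ≡ false)
      not-both f = case trans (sym e) f of λ ()

  sub-unique : ∀ {k} {v : Vec (Fin n) m} → Unique (toList v) → (is : Vec (Fin m) k) → T (distinct (toList is)) →
               Unique (toList (Vec.map (lookup v) is))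
  sub-unique {v = v} u is d =
    subst Unique (sym (toList-map (lookup v) is)) (Uniqueₚ.map⁺ (lookup-inj {v = v} u) (distinct-sound (toList is) d))

  sub-⊆ : ∀ {k} {v : Vec (Fin n) m} {V} → All (_∈ V) (toList v) → (is : Vec (Fin m) k) →
          All (_∈ V) (toList (Vec.map (lookup v) is))
  sub-⊆ v∈ []       = []
  sub-⊆ {v = v} v∈ (i ∷ is) = All.lookup v∈ (lookup∈ v i) ∷ sub-⊆ {v = v} v∈ is

  module Around {V W : List (Fin n)} {v : Vec (Fin n) m} (uV : Unique V) (V↭ : V ↭ toList v ++ W) where
    open Split {v = v} uV V↭ public

    v⊆V : All (_∈ V) (toList v)
    v⊆V = All.tabulate v∈V

    link : Fin n → ℕ
    link u = sum2 (wt u) (toList v)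

    colink : Fin n → Fin n → ℕ
    colink u u′ = sum1 (λ x → wt x u u′) (toList v)

    colink-sym : ∀ x y → colink x y ≡ colink y x
    colink-sym x y = sum1-cong (toList v) λ z → swap23 wt-sym z x y

    extendₑ : ∀ {x y z} → x ∈ W → y ∈ W → z ∈ W → Adj x y z → Unique (x ∷ y ∷ z ∷ toList v)
    extendₑ x∈ y∈ z∈ e = let x≢y , x≢z , y≢z = edge-distinct e in extend₃ x∈ y∈ z∈ x≢y x≢z y≢z

    private
      link-pairs : ∀ u → link u ≡ sum1 (λ (i , j) → wt u (lookup v i) (lookup v j)) (pairs (allFin m))
      link-pairs u = trans (link-labels G u v) (sum1-map _ _ (pairs (allFin m)))

    -- The variants differ in which outside vertices are put in front of the labels, so that known
    -- edges through them can enter `K`. In the uses `K` and `N` are literal, and the bound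
    -- evaluates to a numeral.
    bound₀ : ∀ {K N} → Present v K → Absent v N → count (toList v) ≤ PathConf.bound K N (triplesᶠ m)
    bound₀ K✓ N✓ = ≤-trans (≤-reflexive (count-labels G v)) (bounded-by N✓ (triplesᶠ m))
      where open Labels {v = v} uniqueˡ K✓

    bound₀′ : ∀ {u K} → u ∈ W → Present (u ∷ v) K → count (toList v) ≤ PathConf.bound K [] (map shift1 (triplesᶠ m))
    bound₀′ {u} u∈ K✓ = ≤-trans (≤-reflexive (trans (count-labels G v) (sym (sum1-map _ shift1 (triplesᶠ m)))))
                                (bounded-by [] (map shift1 (triplesᶠ m)))
      where open Labels {v = u ∷ v} (extend₁ u∈) K✓

    bound₀″ : ∀ {u x y K} → u ∈ W → x ∈ W → y ∈ W → Adj u x y → Present (u ∷ x ∷ y ∷ v) K →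
              count (toList v) ≤ PathConf.bound K [] (map (shift1 ∘ shift1 ∘ shift1) (triplesᶠ m))
    bound₀″ {u} {x} {y} u∈ x∈ y∈ e K✓ =
      ≤-trans (≤-reflexive (trans (count-labels G v) (sym (sum1-map _ (shift1 ∘ shift1 ∘ shift1) (triplesᶠ m)))))
              (bounded-by [] (map (shift1 ∘ shift1 ∘ shift1) (triplesᶠ m)))
      where open Labels {v = u ∷ x ∷ y ∷ v} (extendₑ u∈ x∈ y∈ e) K✓

    bound₁ : ∀ {u K N} → u ∈ W → Present (u ∷ v) K → Absent (u ∷ v) N → link u ≤ PathConf.bound K N (linksᶠ m)
    bound₁ {u} u∈ K✓ N✓ = ≤-trans (≤-reflexive (link-labels G u v)) (bounded-by N✓ (linksᶠ m))
      where open Labels {v = u ∷ v} (extend₁ u∈) K✓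

    bound₂ : ∀ {u x K N} → u ∈ W → x ∈ W → u ≢ x → Present (u ∷ x ∷ v) K → Absent (u ∷ x ∷ v) N →
             link u ≤ PathConf.bound K N (map link₂ (pairs (allFin m)))
    bound₂ {u} {x} u∈ x∈ u≢x K✓ N✓ =
      ≤-trans (≤-reflexive (trans (link-pairs u) (sym (sum1-map _ link₂ (pairs (allFin m))))))
              (bounded-by N✓ (map link₂ (pairs (allFin m))))
      where open Labels {v = u ∷ x ∷ v} (extend₂ u∈ x∈ u≢x) K✓

    bound₃ : ∀ {u x y K N} → u ∈ W → x ∈ W → y ∈ W → Adj u x y → Present (u ∷ x ∷ y ∷ v) K → Absent (u ∷ x ∷ y ∷ v) N →
             link u ≤ PathConf.bound K N
               (map link₃ (pairs (allFin m)))
    bound₃ {u} {x} {y} u∈ x∈ y∈ e K✓ N✓ =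
      ≤-trans (≤-reflexive (trans (link-pairs u) (sym (sum1-map _ link₃ (pairs (allFin m))))))
              (bounded-by N✓ (map link₃ (pairs (allFin m))))
      where open Labels {v = u ∷ x ∷ y ∷ v} (extendₑ u∈ x∈ y∈ e) K✓

  -- By `touch`, and by symmetry of edges, every vertex of an edge inside `W` is bad. The edges
  -- inside `W` thus lie in `W⁺` and can be left to the induction.
  module Parted {V W : List (Fin n)} {v : Vec (Fin n) m} (uV : Unique V) (V↭ : V ↭ toList v ++ W)
                {Bad : Fin n → Set} (Bad? : ∀ x → Dec (Bad x))
                (touch : ∀ {x y z} → x ∈ W → y ∈ W → z ∈ W → Adj x y z → Bad x) where
    open Around {v = v} uV V↭

    W⁺ W⁻ : List (Fin n)
    W⁺ = filter Bad? W
    W⁻ = filter (¬? ∘ Bad?) W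

    W↭ : W ↭ W⁺ ++ W⁻
    W↭ = filter-split-↭ Bad? W

    in⁺ : ∀ {x} → x ∈ W⁺ → x ∈ W × Bad x
    in⁺ = ∈-filter⁻ Bad?

    in⁻ : ∀ {x} → x ∈ W⁻ → x ∈ W × ¬ Bad x
    in⁻ = ∈-filter⁻ (¬? ∘ Bad?)

    unique⁺⁻ : Unique (W⁺ ++ W⁻)
    unique⁺⁻ = Unique-↭ W↭ uniqueʳ

    unique⁺ : Unique W⁺
    unique⁺ = Unique-++ˡ W⁺ unique⁺⁻

    unique⁻ : Unique W⁻
    unique⁻ = Unique-++ʳ W⁺ unique⁺⁻

    length-parts : length V ≡ m + (length W⁻ + length W⁺)
    length-parts = trans length-V (cong (m +_) (trans (↭-length W↭) (trans (length-++ W⁺) (+-comm (length W⁺) _))))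

    count-W : count W ≡ count W⁺
    count-W = begin
      count W                        ≡⟨ sum3-↭ wt-sym W↭ ⟩
      count (W⁺ ++ W⁻)               ≡⟨ sum3-++ wt-sym W⁺ W⁻ ⟩
      count W⁺ + c + p + count W⁻    ≡⟨ cong₂ (λ c p → count W⁺ + c + p + count W⁻) c≡0 p≡0 ⟩
      count W⁺ + 0 + 0 + count W⁻    ≡⟨ cong₂ _+_ (trans (+-identityʳ _) (+-identityʳ _)) t≡0 ⟩
      count W⁺ + 0                   ≡⟨ +-identityʳ _ ⟩
      count W⁺                       ∎
      where
      open ≡-Reasoning
      c = sum1 (λ y → sum2 (wt y) W⁺) W⁻
      p = sum2 (λ y z → sum1 (λ x → wt x y z) W⁺) W⁻
      good : ∀ {x y z} → x ∈ W⁻ → y ∈ W → z ∈ W → ¬ Adj x y z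
      good x∈ y∈ z∈ e = proj₂ (in⁻ x∈) (touch (proj₁ (in⁻ x∈)) y∈ z∈ e)
      c≡0 : c ≡ 0
      c≡0 = sum1-0 W⁻ λ x∈ → sum2-0 unique⁺ λ y∈ z∈ _ → bit-false (good x∈ (proj₁ (in⁺ y∈)) (proj₁ (in⁺ z∈)))
      p≡0 : p ≡ 0
      p≡0 = sum2-0 unique⁻ λ y∈ z∈ _ → sum1-0 W⁺ λ x∈ →
        bit-false (good y∈ (proj₁ (in⁻ z∈)) (proj₁ (in⁺ x∈)) ∘ rotate)
      t≡0 : count W⁻ ≡ 0
      t≡0 = count-0 unique⁻ λ x∈ y∈ z∈ → good x∈ (proj₁ (in⁻ y∈)) (proj₁ (in⁻ z∈))

    colinks-split : (∀ {x y} → x ∈ W⁺ → y ∈ W⁻ → colink x y ≡ 0) →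
                    sum2 colink W ≡ sum2 colink W⁺ + sum2 colink W⁻
    colinks-split cross = trans (sum2-↭ colink-sym W↭) (trans (sum2-++ colink W⁺ W⁻)
      (cong (_+ sum2 colink W⁻) (trans (cong (sum2 colink W⁺ +_) (sum1-0 W⁻ λ y∈ → sum1-0 W⁺ λ x∈ → cross x∈ y∈))
                                       (+-identityʳ _))))

    -- The edges with two vertices in `W` and those inside `W⁺` are bounded jointly by `p`, because
    -- one application of the induction hypothesis can cover both.
    parted : ∀ {e c⁻ s p} → count (toList v) ≤ e → (∀ {u} → u ∈ W → link u ≤ c⁻) →
             sum1 link W⁺ ≤ s → sum2 colink W + count W⁺ ≤ p →
             count V ≤ e + c⁻ * length W⁻ + s + p
    parted {e} {c⁻} {s} {p} le le⁻ le⁺ le-p = begin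
      count V                                                      ≡⟨ count-V ⟩
      count (toList v) + sum1 link W + sum2 colink W + count W     ≡⟨ cong₂ (λ x y → count (toList v) + x + sum2 colink W + y)
                                                                        (trans (sum1-↭ link W↭) (sum1-++ link W⁺ W⁻)) count-W ⟩
      count (toList v) + (sum1 link W⁺ + sum1 link W⁻) + sum2 colink W + count W⁺
                                                                   ≡⟨ lem (count (toList v)) (sum1 link W⁺) (sum1 link W⁻) _ _ ⟩
      count (toList v) + sum1 link W⁻ + sum1 link W⁺ + (sum2 colink W + count W⁺)
        ≤⟨ +-mono-≤ (+-mono-≤ (+-mono-≤ le (sum1-≤ c⁻ W⁻ λ u∈ → le⁻ (proj₁ (in⁻ u∈)))) le⁺) le-p ⟩
      e + c⁻ * length W⁻ + s + p ∎
      where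
      open ≤-Reasoning
      lem : ∀ e a b s t → e + (a + b) + s + t ≡ e + b + a + (s + t)
      lem = solve-∀

    links⁺ : ∀ {c} → (∀ {u} → u ∈ W → Bad u → link u ≤ c) → sum1 link W⁺ ≤ c * length W⁺
    links⁺ {c} le = sum1-≤ c W⁺ λ u∈ → le (proj₁ (in⁺ u∈)) (proj₂ (in⁺ u∈))

-- A further edge at the vertex 3: comets.

-- base with a further edge at the vertex 3, which is the centre of a comet, resp. at 0.
alpha beta : List (Triple (Fin (8 + m)))
alpha = (0F , 1F , 2F) ∷ (1F , 2F , 3F) ∷ (3F , 4F , 5F) ∷ (3F , 6F , 7F) ∷ []
beta  = (0F , 1F , 2F) ∷ (1F , 2F , 3F) ∷ (3F , 4F , 5F) ∷ (0F , 6F , 7F) ∷ []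

module _ {n} (G : 3Graph (Fin n)) where
  open 3Graph G
  open Vertices G

  -- What these two prohibitions leave are triples within the four head vertices and triples formed
  -- by `c` and two vertices of `R`: the edges of a comet.
  record SubComet (V : List (Fin n)) : Set where
    field
      {c h₁ h₂ h₃} : Fin n
      {R}          : List (Fin n)
      arrangement  : V ↭ c ∷ h₁ ∷ h₂ ∷ h₃ ∷ R
      heads        : ∀ {h r y} → h ∈ h₁ ∷ h₂ ∷ h₃ ∷ [] → r ∈ R → y ∈ V → ¬ Adj h r y
      rest         : ∀ {x y z} → x ∈ R → y ∈ R → z ∈ R → ¬ Adj x y z

module Alpha {n} (G : 3Graph (Fin n)) (pf : 3Graph.PathFree G)
             {V : List (Fin n)} (uV : Unique V)
             (ih : ∀ {U} → length U < length V → Unique U → 3Graph.count G U ≤ freeTurán (length U))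
             {v₀ v₁ v₂ v₃ v₄ v₅ v₆ v₇ : Fin n} {W : List (Fin n)}
             (V↭ : V ↭ v₀ ∷ v₁ ∷ v₂ ∷ v₃ ∷ v₄ ∷ v₅ ∷ v₆ ∷ v₇ ∷ W)
             (K✓ : Vertices.Present G (v₀ ∷ v₁ ∷ v₂ ∷ v₃ ∷ v₄ ∷ v₅ ∷ v₆ ∷ v₇ ∷ []) alpha) where
  open 3Graph G
  open Vertices G

  v : Vec (Fin n) 8
  v = v₀ ∷ v₁ ∷ v₂ ∷ v₃ ∷ v₄ ∷ v₅ ∷ v₆ ∷ v₇ ∷ []

  open Around G pf {v = v} uV V↭

  shift2 : Triple (Fin m) → Triple (Fin (2 + m))
  shift2 = shift1 ∘ shift1

  shift3 : Triple (Fin m) → Triple (Fin (3 + m))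
  shift3 = shift1 ∘ shift2

  K₁✓ : ∀ {u} → Present (u ∷ v) (map shift1 (alpha {0}))
  K₁✓ = Allₚ.map⁺ {f = shift1} K✓

  K₂✓ : ∀ {u u′} → Present (u ∷ u′ ∷ v) (map shift2 (alpha {0}))
  K₂✓ = Allₚ.map⁺ {f = shift2} K✓

  K₃✓ : ∀ {u u′ u″} → Present (u ∷ u′ ∷ u″ ∷ v) (map shift3 (alpha {0}))
  K₃✓ = Allₚ.map⁺ {f = shift3} K✓

  K₄✓ : ∀ {u u′ u″ u‴} → Present (u ∷ u′ ∷ u″ ∷ u‴ ∷ v) (map (shift1 ∘ shift3) (alpha {0}))
  K₄✓ = Allₚ.map⁺ {f = shift1 ∘ shift3} K✓

  -- An edge joining two outside vertices to `v₁` or `v₂` continues through `v₁v₂v₃` and `v₃v₄v₅`,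
  -- and one at `v₄`, ..., `v₇` continues through the two edges at `v₃` that end there. Only `v₀`
  -- and `v₃` are left.
  colink-eq : ∀ {u u′} → u ∈ W → u′ ∈ W → u ≢ u′ → colink u u′ ≡ wt v₀ u u′ + wt v₃ u u′
  colink-eq {u} {u′} u∈ u′∈ ne = go (absentees id (colinksᶠ 8))
    where
    open Labels G pf {v = u ∷ u′ ∷ v} (extend₂ u∈ u′∈ ne) K₂✓
    go : All (λ t → valueAt (u ∷ u′ ∷ v) t ≡ false) (filterᵇ (PathConf.killed (map shift2 alpha)) (colinksᶠ 8)) →
         colink u u′ ≡ wt v₀ u u′ + wt v₃ u u′
    go (n₁ ∷ n₂ ∷ n₄ ∷ n₅ ∷ n₆ ∷ n₇ ∷ []) rewrite n₁ | n₂ | n₄ | n₅ | n₆ | n₇ = cong (wt v₀ u u′ +_) (+-identityʳ _)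

  -- Seven pairs survive: `v₃` with each of `v₄`, ..., `v₇`, as in a comet, and the deviating pairs
  -- `v₁v₂`, `v₄v₅`, `v₆v₇`. Each deviating pair clashes with one containing `v₃`, and greedy
  -- matching leaves four.
  link-≤ : ∀ {u} → u ∈ W → link u ≤ 4
  link-≤ u∈ = bound₁ u∈ K₁✓ []

  Joined Covered : Fin n → Set
  Joined u  = ∃[ u′ ] u′ ∈ W × Adj v₀ u u′
  Covered u = ∃[ x ] ∃[ y ] x ∈ W × y ∈ W × Adj u x y

  bad? : ∀ u → Dec (Joined u ⊎ Covered u)
  bad? u = any? (λ u′ → (u′ ∈? W) ×-dec (edge v₀ u u′ ≟ᵇ true))
     ⊎-dec any? (λ x → any? λ y → (x ∈? W) ×-dec (y ∈? W) ×-dec (edge u x y ≟ᵇ true))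

  -- The edges `v₄v₅v₃`, `v₃uu′` and the edge that makes `u′` bad form a path unless `u` is on the
  -- last one, but then `u` would be bad as well.
  separated : ∀ {u u′} → u ∈ W → u′ ∈ W → ¬ (Joined u ⊎ Covered u) → Joined u′ ⊎ Covered u′ → ¬ Adj v₃ u u′
  separated {u} {u′} u∈ u′∈ ¬bad (inj₁ (u″ , u″∈ , e)) f =
    contradiction tt
    where
    u≢u″ : u ≢ u″
    u≢u″ refl = ¬bad (inj₁ (u′ , u′∈ , flip₂ e))
    open Labels G pf {v = u ∷ u′ ∷ u″ ∷ v}
      (extend₃ u∈ u′∈ u″∈ (proj₂ (proj₂ (edge-distinct f))) u≢u″ (proj₂ (proj₂ (edge-distinct e))))
      {(6F , 0F , 1F) ∷ (3F , 1F , 2F) ∷ map shift3 alpha} (f ∷ e ∷ K₃✓)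
  separated {u} {u′} u∈ u′∈ ¬bad (inj₂ (x , y , x∈ , y∈ , e)) f =
    contradiction tt
    where
    u≢x : u ≢ x
    u≢x refl = ¬bad (inj₂ (u′ , y , u′∈ , y∈ , flip₁ e))
    u≢y : u ≢ y
    u≢y refl = ¬bad (inj₂ (x , u′ , x∈ , u′∈ , flip₁₃ e))
    u≢u′ : u ≢ u′
    u≢u′ = proj₂ (proj₂ (edge-distinct f))
    open Labels G pf {v = u ∷ u′ ∷ x ∷ y ∷ v}
      (extend {ys = u ∷ u′ ∷ x ∷ y ∷ []} ((u≢u′ ∷ u≢x ∷ u≢y ∷ []) ∷ unique₃ e) (u∈ ∷ u′∈ ∷ x∈ ∷ y∈ ∷ []))
      {(7F , 0F , 1F) ∷ (1F , 2F , 3F) ∷ map (shift1 ∘ shift3) alpha} (f ∷ e ∷ K₄✓)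

  module Pairs {Bad : Fin n → Set} (Bad? : ∀ x → Dec (Bad x))
               (bad : ∀ {u} → Joined u ⊎ Covered u → Bad u)
               (apart : ∀ {u u′} → u ∈ W → u′ ∈ W → ¬ Bad u → Bad u′ → ¬ Adj v₃ u u′) where
    open Parted G pf {v = v} uV V↭ Bad? (λ {x} {y} {z} _ y∈ z∈ e → bad (inj₂ (y , z , y∈ , z∈ , e))) public

    good-v₀ : ∀ {x y} → x ∈ W⁻ → y ∈ W → ¬ Adj v₀ x y
    good-v₀ x∈ y∈ e = proj₂ (in⁻ x∈) (bad (inj₁ (_ , y∈ , e)))

    private
      cross : ∀ {x y} → x ∈ W⁺ → y ∈ W⁻ → colink x y ≡ 0
      cross {x} {y} x∈ y∈ =
        trans (colink-eq (proj₁ (in⁺ x∈)) (proj₁ (in⁻ y∈)) λ { refl → proj₂ (in⁻ y∈) (proj₂ (in⁺ x∈)) })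
              (cong₂ _+_ (bit-false (good-v₀ y∈ (proj₁ (in⁺ x∈)) ∘ flip₂))
                         (bit-false (apart (proj₁ (in⁻ y∈)) (proj₁ (in⁺ x∈)) (proj₂ (in⁻ y∈)) (proj₂ (in⁺ x∈)) ∘ flip₂)))

      colinks⁻ : sum2 colink W⁻ ≤ binom2 (length W⁻)
      colinks⁻ = sum2-≤1 unique⁻ λ {x} {y} x∈ y∈ x≢y →
        ≤-trans (≤-reflexive (trans (colink-eq (proj₁ (in⁻ x∈)) (proj₁ (in⁻ y∈)) x≢y)
                                    (cong (_+ wt v₃ x y) (bit-false (good-v₀ x∈ (proj₁ (in⁻ y∈)))))))
                (bit-≤1 (edge v₃ x y))

      U : List (Fin n)
      U = v₀ ∷ v₃ ∷ W⁺

      v∉W⁺ : ∀ i {x} → x ∈ W⁺ → lookup v i ≢ x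
      v∉W⁺ i x∈ refl = Unique-++-disjoint (toList v) unique (lookup∈ v i) (proj₁ (in⁺ x∈))

      uU : Unique U
      uU = ((λ eq → case lookup-inj {v = v} uniqueˡ {0F} {3F} eq of λ ()) ∷ All.tabulate (v∉W⁺ 0F))
           ∷ All.tabulate (v∉W⁺ 3F) ∷ unique⁺

      -- These are among the edges on `v₀`, `v₃` and `W⁺`, a smaller vertex set, to which the
      -- induction hypothesis applies once.
      colinks⁺ : sum2 colink W⁺ + count W⁺ ≤ freeTurán (2 + length W⁺)
      colinks⁺ = begin
        sum2 colink W⁺ + count W⁺
          ≤⟨ +-monoˡ-≤ (count W⁺) (sum2-mono unique⁺ λ x∈ y∈ x≢y →
               ≤-reflexive (colink-eq (proj₁ (in⁺ x∈)) (proj₁ (in⁺ y∈)) x≢y)) ⟩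
        sum2 (λ x y → wt v₀ x y + wt v₃ x y) W⁺ + count W⁺
          ≡⟨ cong (_+ count W⁺) (sum2-+ (wt v₀) (wt v₃) W⁺) ⟩
        sum2 (wt v₀) W⁺ + sum2 (wt v₃) W⁺ + count W⁺
          ≡⟨ +-assoc (sum2 (wt v₀) W⁺) _ _ ⟩
        sum2 (wt v₀) W⁺ + (sum2 (wt v₃) W⁺ + count W⁺)
          ≤⟨ +-monoˡ-≤ _ (m≤n+m (sum2 (wt v₀) W⁺) (sum1 (wt v₀ v₃) W⁺)) ⟩
        count U
          ≤⟨ ih (≤-trans (+-mono-≤ (m≤m+n 3 5) (m≤n+m (length W⁺) (length W⁻))) (≤-reflexive (sym length-parts))) uU ⟩
        freeTurán (2 + length W⁺) ∎
        where open ≤-Reasoning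

    colinks-≤ : sum2 colink W + count W⁺ ≤ binom2 (length W⁻) + freeTurán (2 + length W⁺)
    colinks-≤ = begin
      sum2 colink W + count W⁺                        ≡⟨ cong (_+ count W⁺) (colinks-split cross) ⟩
      sum2 colink W⁺ + sum2 colink W⁻ + count W⁺      ≡⟨ lem (sum2 colink W⁺) (sum2 colink W⁻) (count W⁺) ⟩
      sum2 colink W⁻ + (sum2 colink W⁺ + count W⁺)    ≤⟨ +-mono-≤ colinks⁻ colinks⁺ ⟩
      binom2 (length W⁻) + freeTurán (2 + length W⁺)            ∎
      where
      open ≤-Reasoning
      lem : ∀ a b c → a + b + c ≡ b + (a + c)
      lem = solve-∀

  -- An outside vertex with an edge through `v₄v₅` or `v₆v₇` lowers the inner bound from ten to six,
  -- which pays for larger links of bad vertices.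
  module Linked {w} (w∈ : w ∈ W) (linked : Adj w v₄ v₅ ⊎ Adj w v₆ v₇) where
    open Pairs bad? id separated

    inner-≤ : Adj w v₄ v₅ ⊎ Adj w v₆ v₇ → count (toList v) ≤ 6
    inner-≤ (inj₁ e) = bound₀′ {K = (0F , 5F , 6F) ∷ map shift1 alpha} w∈ (e ∷ K₁✓)
    inner-≤ (inj₂ e) = bound₀′ {K = (0F , 7F , 8F) ∷ map shift1 alpha} w∈ (e ∷ K₁✓)

    joined-≤ : ∀ {u} → u ∈ W → Joined u → link u ≤ 1
    joined-≤ u∈ (u′ , u′∈ , e) =
      bound₂ {K = (2F , 0F , 1F) ∷ map shift2 alpha} u∈ u′∈ (proj₂ (proj₂ (edge-distinct e))) (e ∷ K₂✓) []

    covered-≤ : ∀ {u} → u ∈ W → Covered u → link u ≤ 3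
    covered-≤ u∈ (x , y , x∈ , y∈ , e) = bound₃ {K = (0F , 1F , 2F) ∷ map shift3 alpha} u∈ x∈ y∈ e (e ∷ K₃✓) []

    bad-≤ : ∀ {u} → u ∈ W → Joined u ⊎ Covered u → link u ≤ 3
    bad-≤ u∈ (inj₁ j) = ≤-trans (joined-≤ u∈ j) (m≤m+n 1 2)
    bad-≤ u∈ (inj₂ c) = covered-≤ u∈ c

    heavy : ∀ {u x y} → u ∈ W → x ∈ W → y ∈ W → Adj u x y → 2 < link u →
            Adj u v₁ v₂ × Adj u v₄ v₅ × Adj u v₆ v₇
    heavy {u} {x} {y} u∈ x∈ y∈ e big =
      present (λ a → bound₃ {K = (0F , 1F , 2F) ∷ map shift3 alpha} {(0F , 4F , 5F) ∷ []} u∈ x∈ y∈ e (e ∷ K₃✓) (a ∷ [])) ,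
      present (λ a → bound₃ {K = (0F , 1F , 2F) ∷ map shift3 alpha} {(0F , 7F , 8F) ∷ []} u∈ x∈ y∈ e (e ∷ K₃✓) (a ∷ [])) ,
      -- The label of `v₇` is ten, written `suc 9F` as the literals end at `9F`.
      present (λ a → bound₃ {K = (0F , 1F , 2F) ∷ map shift3 alpha} {(0F , 9F , suc 9F) ∷ []} u∈ x∈ y∈ e (e ∷ K₃✓) (a ∷ []))
      where
      present : ∀ {b} → (b ≡ false → link u ≤ 2) → b ≡ true
      present {true}  _ = refl
      present {false} h = ⊥-elim (<⇒≱ big (h refl))

    light : ∀ {u x y} → u ∈ W → x ∈ W → y ∈ W → Adj u x y → Adj u v₁ v₂ × Adj u v₄ v₅ × Adj u v₆ v₇ → link x ≤ 0
    light u∈ x∈ y∈ e (f , g , h) =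
      bound₃ {K = (0F , 1F , 2F) ∷ (1F , 4F , 5F) ∷ (1F , 7F , 8F) ∷ (1F , 9F , suc 9F) ∷ map shift3 alpha}
             x∈ u∈ y∈ (flip₁ e) (flip₁ e ∷ f ∷ g ∷ h ∷ K₃✓) []

    small : count V < condTurán (length V)
    -- Allowing link 3 for every bad vertex would be too weak: with five bad and no good vertices
    -- the total is 6 + 15 + 20 = 41, against `condTurán 13` = 40. So either all links are at most
    -- 2, or a vertex with link 3 is offset by the two others on its edge, which by `light` have
    -- link 0.
    small with Any.any? (λ u → 2 <? link u) W⁺
    ... | no ¬heavy = begin-strict
      count V
        ≤⟨ parted (inner-≤ linked) link-≤ (sum1-≤ 2 W⁺ λ u∈ → ≮⇒≥ λ big → ¬heavy (Membership.lose u∈ big)) colinks-≤ ⟩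
      6 + 4 * length W⁻ + 2 * length W⁺ + (binom2 (length W⁻) + freeTurán (2 + length W⁺))
        ≡⟨ lem (4 * length W⁻) (2 * length W⁺) (binom2 (length W⁻)) (freeTurán (2 + length W⁺)) ⟩
      6 + 4 * length W⁻ + binom2 (length W⁻) + 2 * length W⁺ + freeTurán (2 + length W⁺)
        <⟨ Estimates.alpha-linked (length W⁻) (length W⁺) ⟩
      condTurán (8 + (length W⁻ + length W⁺))
        ≡⟨ cong condTurán length-parts ⟨
      condTurán (length V) ∎
      where
      open ≤-Reasoning
      lem : ∀ a b c g → 6 + a + b + (c + g) ≡ 6 + a + c + b + g
      lem = solve-∀
    ... | yes some with Membership.find some
    ... | u , u∈⁺ , big with in⁺ u∈⁺
    ... | u∈ , inj₁ j = ⊥-elim (<⇒≱ big (≤-trans (joined-≤ u∈ j) (n≤1+n 1)))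
    ... | u∈ , inj₂ (x , y , x∈ , y∈ , e) =
      go (split-off {xs = x ∷ y ∷ u ∷ []} (unique₃ (rotate e)) (x∈⁺ ∷ y∈⁺ ∷ u∈⁺ ∷ []))
      where
      x∈⁺ : x ∈ W⁺
      x∈⁺ = ∈-filter⁺ bad? x∈ (inj₂ (u , y , u∈ , y∈ , flip₁ e))
      y∈⁺ : y ∈ W⁺
      y∈⁺ = ∈-filter⁺ bad? y∈ (inj₂ (x , u , x∈ , u∈ , flip₁₃ e))
      h : Adj u v₁ v₂ × Adj u v₄ v₅ × Adj u v₆ v₇
      h = heavy u∈ x∈ y∈ e big
      go : (∃[ Z ] W⁺ ↭ x ∷ y ∷ u ∷ Z) → count V < condTurán (length V)
      go (Z , p) = begin-strict
        count V
          ≤⟨ parted (inner-≤ linked) link-≤ links colinks-≤ ⟩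
        6 + 4 * k + (3 + 3 * length Z) + (binom2 k + freeTurán (2 + length W⁺))
          ≡⟨ cong (λ l → 6 + 4 * k + (3 + 3 * length Z) + (binom2 k + freeTurán (2 + l))) (↭-length p) ⟩
        6 + 4 * k + (3 + 3 * length Z) + (binom2 k + freeTurán (5 + length Z))
          ≡⟨ lem (4 * k) (3 * length Z) (binom2 k) (freeTurán (5 + length Z)) ⟩
        9 + 4 * k + binom2 k + 3 * length Z + freeTurán (5 + length Z)
          <⟨ Estimates.alpha-heavy k (length Z) ⟩
        condTurán (11 + (k + length Z))
          ≡⟨ cong condTurán (trans length-parts (trans (cong (λ l → 8 + (k + l)) (↭-length p)) (lem₂ k (length Z)))) ⟨
        condTurán (length V) ∎
        where
        open ≤-Reasoning
        k = length W⁻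
        lem : ∀ a z c g → 6 + a + (3 + z) + (c + g) ≡ 9 + a + c + z + g
        lem = solve-∀
        lem₂ : ∀ k z → 8 + (k + (3 + z)) ≡ 11 + (k + z)
        lem₂ = solve-∀
        links : sum1 link W⁺ ≤ 3 + 3 * length Z
        links = ≤-trans (≤-reflexive (sum1-↭ link p))
          (+-mono-≤ (light u∈ x∈ y∈ e h) (+-mono-≤ (light u∈ y∈ x∈ (flip₂ e) h)
            (+-mono-≤ (covered-≤ u∈ (x , y , x∈ , y∈ , e))
                      (sum1-≤ 3 Z λ z∈ → let z∈⁺ = ∈-resp-↭ (↭-sym p) (there (there (there z∈)))
                                         in bad-≤ (proj₁ (in⁺ z∈⁺)) (proj₂ (in⁺ z∈⁺))))))

  module NotLinked (¬linked : ∀ {w} → w ∈ W → ¬ Adj w v₄ v₅ × ¬ Adj w v₆ v₇) where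

    -- A vertex of `R` in a comet has no edge with two of the `h` vertices, so `v₁v₂` in a link now
    -- counts as a defect too. After this every bad vertex has link at most 1.
    Bad : Fin n → Set
    Bad u = (Joined u ⊎ Covered u) ⊎ Adj u v₁ v₂

    apart : ∀ {u u′} → u ∈ W → u′ ∈ W → ¬ Bad u → Bad u′ → ¬ Adj v₃ u u′
    apart u∈ u′∈ ¬bad (inj₁ b) = separated u∈ u′∈ (¬bad ∘ inj₁) b
    apart {u} {u′} u∈ u′∈ ¬bad (inj₂ e) f = contradiction tt
      where
      open Labels G pf {v = u ∷ u′ ∷ v} (extend₂ u∈ u′∈ (proj₂ (proj₂ (edge-distinct f))))
        {(5F , 0F , 1F) ∷ (1F , 3F , 4F) ∷ map shift2 alpha} (f ∷ e ∷ K₂✓)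

    open Pairs (λ u → bad? u ⊎-dec (edge u v₁ v₂ ≟ᵇ true)) inj₁ apart

    bad-≤ : ∀ {u} → u ∈ W → Bad u → link u ≤ 1
    bad-≤ u∈ (inj₁ (inj₁ (u′ , u′∈ , e))) =
      bound₂ {K = (2F , 0F , 1F) ∷ map shift2 alpha} u∈ u′∈ (proj₂ (proj₂ (edge-distinct e))) (e ∷ K₂✓) []
    bad-≤ u∈ (inj₁ (inj₂ (x , y , x∈ , y∈ , e))) =
      bound₃ {K = (0F , 1F , 2F) ∷ map shift3 alpha} {(0F , 7F , 8F) ∷ (0F , 9F , suc 9F) ∷ []} u∈ x∈ y∈ e (e ∷ K₃✓)
             (¬-not (proj₁ (¬linked u∈)) ∷ ¬-not (proj₂ (¬linked u∈)) ∷ [])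
    bad-≤ u∈ (inj₂ e) =
      bound₁ {K = (0F , 2F , 3F) ∷ map shift1 alpha} {(0F , 5F , 6F) ∷ (0F , 7F , 8F) ∷ []} u∈ (e ∷ K₁✓)
             (¬-not (proj₁ (¬linked u∈)) ∷ ¬-not (proj₂ (¬linked u∈)) ∷ [])

    count-≤ : ∀ {e m} → count (toList v) ≤ e → length W⁺ ≡ m →
              count V ≤ e + 4 * length W⁻ + 1 * m + (binom2 (length W⁻) + freeTurán (2 + m))
    count-≤ le refl = parted le link-≤ (links⁺ bad-≤) colinks-≤

    some-bad : ∀ {m} → length W⁺ ≡ suc m → count V < condTurán (length V)
    some-bad {m} eq = begin-strict
      count V                                                   ≤⟨ count-≤ (bound₀ K✓ []) eq ⟩
      10 + 4 * k + 1 * suc m + (binom2 k + freeTurán (3 + m))             ≡⟨ lem (4 * k) m (binom2 k) (freeTurán (3 + m)) ⟩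
      11 + 4 * k + binom2 k + 1 * m + freeTurán (3 + m)                   <⟨ Estimates.alpha-rest k m ⟩
      condTurán (9 + (k + m))                                          ≡⟨ cong condTurán (trans length-parts (trans (cong (λ l → 8 + (k + l)) eq) (cong (8 +_) (+-suc k m)))) ⟨
      condTurán (length V)                                             ∎
      where
      open ≤-Reasoning
      k = length W⁻
      lem : ∀ a m c g → 10 + a + 1 * suc m + (c + g) ≡ 11 + a + c + 1 * m + g
      lem = solve-∀

    module _ (no-bad : length W⁺ ≡ 0) where
      k : ℕ
      k = length W⁻

      length-V′ : length V ≡ 8 + k
      length-V′ = trans length-parts (cong (8 +_) (trans (cong (k +_) no-bad) (+-identityʳ k)))

      none-bad : ∀ {u} → u ∈ W → ¬ Bad u
      none-bad u∈ b = empty (∈-filter⁺ (λ u → bad? u ⊎-dec (edge u v₁ v₂ ≟ᵇ true)) u∈ b) no-bad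
        where
        empty : ∀ {x} {xs : List (Fin n)} → x ∈ xs → length xs ≢ 0
        empty (here _)  ()
        empty (there _) ()

      deficient : count (toList v) ≤ 9 → count V < condTurán (length V)
      deficient le = begin-strict
        count V                                     ≤⟨ count-≤ le no-bad ⟩
        9 + 4 * k + 0 + (binom2 k + 0)                 ≡⟨ lem (4 * k) (binom2 k) ⟩
        9 + 4 * k + binom2 k + 0 + 0                   <⟨ Estimates.alpha-deficient k 0 ⟩
        condTurán (8 + (k + 0))                            ≡⟨ cong condTurán (trans length-V′ (cong (8 +_) (sym (+-identityʳ k)))) ⟨
        condTurán (length V)                               ∎
        where
        open ≤-Reasoning
        lem : ∀ a c → 9 + a + 0 + (c + 0) ≡ 9 + a + c + 0 + 0
        lem = solve-∀

      -- The bound 10 + 4k + C(k,2) equals 4 + C(4+k,2), the size of the comet on `8 + k` vertices.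
      -- This is below `condTurán` up to twelve vertices and attains it afterwards.
      small-or-large : count V < condTurán (length V) ⊎ 13 ≤ length V
      small-or-large = by-size k length-V′
        (≤-trans (count-≤ (bound₀ K✓ []) no-bad) (≤-reflexive (lem (4 * k) (binom2 k))))
        where
        lem : ∀ a c → 10 + a + 0 + (c + 0) ≡ 10 + a + c
        lem = solve-∀
        by-size : ∀ k → length V ≡ 8 + k → count V ≤ 10 + 4 * k + binom2 k → count V < condTurán (length V) ⊎ 13 ≤ length V
        by-size 0 eq le = inj₁ (≤-trans (s≤s le) (≤-trans (m≤m+n 11 9) (≤-reflexive (cong condTurán (sym eq)))))
        by-size 1 eq le = inj₁ (≤-trans (s≤s le) (≤-trans (m≤m+n 15 6) (≤-reflexive (cong condTurán (sym eq)))))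
        by-size 2 eq le = inj₁ (≤-trans (s≤s le) (≤-trans (m≤m+n 20 4) (≤-reflexive (cong condTurán (sym eq)))))
        by-size 3 eq le = inj₁ (≤-trans (s≤s le) (≤-trans (m≤m+n 26 4) (≤-reflexive (cong condTurán (sym eq)))))
        by-size 4 eq le = inj₁ (≤-trans (s≤s le) (≤-trans (m≤m+n 33 7) (≤-reflexive (cong condTurán (sym eq)))))
        by-size (suc (suc (suc (suc (suc k))))) eq le = inj₂ (≤-trans (m≤m+n 13 k) (≤-reflexive (sym eq)))

      -- Apart from bad vertices and links through `v₄v₅` or `v₆v₇`, these two triples are the only
      -- ones outside the comet which the conflicts do not exclude; either would lower the inner
      -- bound to 6.
      module Comet (¬v₀₄₅ : ¬ Adj v₀ v₄ v₅) (¬v₀₆₇ : ¬ Adj v₀ v₆ v₇) where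
        hs rs : List (Fin 8)
        hs = 0F ∷ 1F ∷ 2F ∷ []
        rs = 4F ∷ 5F ∷ 6F ∷ 7F ∷ []

        R : List (Fin n)
        R = v₄ ∷ v₅ ∷ v₆ ∷ v₇ ∷ W

        check₂ : ∀ {p : Fin 8 → Fin 8 → Bool} is js → T (all (λ i → all (p i) js) is) →
                 ∀ {i j} → i ∈ is → j ∈ js → T (p i j)
        check₂ is js h i∈ j∈ = All.lookup (Allₚ.all⁺ _ js (All.lookup (Allₚ.all⁺ _ is h) i∈)) j∈

        check₃ : ∀ {p : Fin 8 → Fin 8 → Fin 8 → Bool} is js ks → T (all (λ i → all (λ j → all (p i j) ks) js) is) →
                 ∀ {i j k} → i ∈ is → j ∈ js → k ∈ ks → T (p i j k)
        check₃ is js ks h i∈ j∈ k∈ = All.lookup (Allₚ.all⁺ _ ks (check₂ is js h i∈ j∈)) k∈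

        no₀ : ∀ {i j k} → i ∈ hs → j ∈ rs → ¬ Adj (lookup v i) (lookup v j) (lookup v k)
        no₀ {i} {j} {k} i∈ j∈ = dead-absent {N} N✓ (i , j , k)
            (check₃ {λ i j k → dead N (i , j , k)} hs rs (allFin 8) tt i∈ j∈ (∈-allFin k))
          where
          open Labels G pf {v = v} uniqueˡ K✓
          N : List (Triple (Fin 8))
          -- Membership in `N` is literal, so both orders of the last two labels are needed. The
          -- conflict test does not depend on the order.
          N = (0F , 4F , 5F) ∷ (0F , 5F , 4F) ∷ (0F , 6F , 7F) ∷ (0F , 7F , 6F) ∷ []
          N✓ : Absent v N
          N✓ = ¬-not ¬v₀₄₅ ∷ ¬-not (¬v₀₄₅ ∘ flip₂) ∷ ¬-not ¬v₀₆₇ ∷ ¬-not (¬v₀₆₇ ∘ flip₂) ∷ []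

        no₀′ : ∀ {i j k} → i ∈ rs → j ∈ rs → k ∈ rs → ¬ Adj (lookup v i) (lookup v j) (lookup v k)
        no₀′ {i} {j} {k} i∈ j∈ k∈ = dead-absent {[]} [] (i , j , k)
            (check₃ {λ i j k → dead [] (i , j , k)} rs rs rs tt i∈ j∈ k∈)
          where open Labels G pf {v = v} uniqueˡ K✓

        no₁ : ∀ {w i k} → w ∈ W → i ∈ hs → ¬ Adj w (lookup v i) (lookup v k)
        no₁ {w} {i} {k} w∈ i∈ = dead-absent {N} N✓ (0F , suc i , suc k)
            (check₂ {λ i k → dead N (0F , suc i , suc k)} hs (allFin 8) tt i∈ (∈-allFin k))
          where
          open Labels G pf {v = w ∷ v} (extend₁ w∈) K₁✓
          N : List (Triple (Fin 9))
          N = (0F , 2F , 3F) ∷ (0F , 3F , 2F) ∷ []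
          N✓ : Absent (w ∷ v) N
          N✓ = ¬-not (none-bad w∈ ∘ inj₂) ∷ ¬-not (none-bad w∈ ∘ inj₂ ∘ flip₂) ∷ []

        no₁′ : ∀ {w i k} → w ∈ W → i ∈ rs → k ∈ rs → ¬ Adj w (lookup v i) (lookup v k)
        no₁′ {w} {i} {k} w∈ i∈ k∈ = dead-absent {N} N✓ (0F , suc i , suc k)
            (check₂ {λ i k → dead N (0F , suc i , suc k)} rs rs tt i∈ k∈)
          where
          open Labels G pf {v = w ∷ v} (extend₁ w∈) K₁✓
          N : List (Triple (Fin 9))
          N = (0F , 5F , 6F) ∷ (0F , 6F , 5F) ∷ (0F , 7F , 8F) ∷ (0F , 8F , 7F) ∷ []
          N✓ : Absent (w ∷ v) N
          N✓ = ¬-not (proj₁ (¬linked w∈)) ∷ ¬-not (proj₁ (¬linked w∈) ∘ flip₂)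
             ∷ ¬-not (proj₂ (¬linked w∈)) ∷ ¬-not (proj₂ (¬linked w∈) ∘ flip₂) ∷ []

        no₂ : ∀ {w w′ i} → w ∈ W → w′ ∈ W → i ∈ hs ++ rs → ¬ Adj (lookup v i) w w′
        no₂ {w} {w′} {i} w∈ w′∈ i∈ e = dead-absent {N} (¬-not (λ f → none-bad w∈ (inj₁ (inj₁ (w′ , w′∈ , f)))) ∷ [])
            (suc (suc i) , 0F , 1F)
            (All.lookup (Allₚ.all⁺ (λ i → dead N (suc (suc i) , 0F , 1F)) (hs ++ rs) tt) i∈) e
          where
          open Labels G pf {v = w ∷ w′ ∷ v} (extend₂ w∈ w′∈ (proj₂ (proj₂ (edge-distinct e)))) K₂✓
          N : List (Triple (Fin 10))
          N = (2F , 0F , 1F) ∷ []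

        no₃ : ∀ {x y z} → x ∈ W → y ∈ W → z ∈ W → ¬ Adj x y z
        no₃ x∈ y∈ z∈ e = none-bad x∈ (inj₁ (inj₂ (_ , _ , y∈ , z∈ , e)))

        h-cases : ∀ {h} → h ∈ v₀ ∷ v₁ ∷ v₂ ∷ [] → ∃[ i ] i ∈ hs × lookup v i ≡ h
        h-cases (here refl)                 = 0F , here refl , refl
        h-cases (there (here refl))         = 1F , there (here refl) , refl
        h-cases (there (there (here refl))) = 2F , there (there (here refl)) , refl

        R-cases : ∀ {r} → r ∈ R → (∃[ i ] i ∈ rs × lookup v i ≡ r) ⊎ r ∈ W
        R-cases (here refl)                         = inj₁ (4F , here refl , refl)
        R-cases (there (here refl))                 = inj₁ (5F , there (here refl) , refl)
        R-cases (there (there (here refl)))         = inj₁ (6F , there (there (here refl)) , refl)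
        R-cases (there (there (there (here refl)))) = inj₁ (7F , there (there (there (here refl))) , refl)
        R-cases (there (there (there (there r∈))))  = inj₂ r∈

        no-heads : ∀ {h r y} → h ∈ v₀ ∷ v₁ ∷ v₂ ∷ [] → r ∈ R → y ∈ V → ¬ Adj h r y
        no-heads h∈ r∈ y∈ e with h-cases h∈ | R-cases r∈ | V-cases y∈
        ... | i , i∈ , refl | inj₂ r∈W           | inj₂ y∈W = no₂ r∈W y∈W (∈-++⁺ˡ i∈) e
        ... | i , i∈ , refl | inj₁ (j , _ , refl) | inj₂ y∈W = no₁ {k = j} y∈W i∈ (rotate (rotate e))
        ... | i , i∈ , refl | inj₁ (j , j∈ , refl) | inj₁ y∈v with lookup-index {v = v} y∈v
        ... | k , refl = no₀ {k = k} i∈ j∈ e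
        no-heads h∈ r∈ y∈ e | i , i∈ , refl | inj₂ r∈W | inj₁ y∈v with lookup-index {v = v} y∈v
        ... | k , refl = no₁ {k = k} r∈W i∈ (flip₁ e)

        no-rest : ∀ {x y z} → x ∈ R → y ∈ R → z ∈ R → ¬ Adj x y z
        no-rest x∈ y∈ z∈ e with R-cases x∈ | R-cases y∈ | R-cases z∈
        ... | inj₁ (i , i∈ , refl) | inj₁ (j , j∈ , refl) | inj₁ (k , k∈ , refl) = no₀′ i∈ j∈ k∈ e
        ... | inj₁ (i , i∈ , refl) | inj₁ (j , j∈ , refl) | inj₂ z∈W = no₁′ z∈W i∈ j∈ (rotate (rotate e))
        ... | inj₁ (i , i∈ , refl) | inj₂ y∈W | inj₁ (k , k∈ , refl) = no₁′ y∈W k∈ i∈ (rotate e)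
        ... | inj₂ x∈W | inj₁ (j , j∈ , refl) | inj₁ (k , k∈ , refl) = no₁′ x∈W j∈ k∈ e
        ... | inj₁ (i , i∈ , refl) | inj₂ y∈W | inj₂ z∈W = no₂ y∈W z∈W (∈-++⁺ʳ hs i∈) e
        ... | inj₂ x∈W | inj₁ (j , j∈ , refl) | inj₂ z∈W = no₂ z∈W x∈W (∈-++⁺ʳ hs j∈) (rotate e)
        ... | inj₂ x∈W | inj₂ y∈W | inj₁ (k , k∈ , refl) = no₂ x∈W y∈W (∈-++⁺ʳ hs k∈) (rotate (rotate e))
        ... | inj₂ x∈W | inj₂ y∈W | inj₂ z∈W = no₃ x∈W y∈W z∈W e

        subComet : SubComet G V
        subComet = record
          { arrangement = ↭-trans V↭ (Permutationₚ.shift v₃ (v₀ ∷ v₁ ∷ v₂ ∷ []) R)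
          ; heads       = no-heads
          ; rest        = no-rest
          }

      inner-045 : Adj v₀ v₄ v₅ → count (toList v) ≤ 6
      inner-045 e = bound₀ {K = (0F , 4F , 5F) ∷ alpha} (e ∷ K✓) []

      inner-067 : Adj v₀ v₆ v₇ → count (toList v) ≤ 6
      inner-067 e = bound₀ {K = (0F , 6F , 7F) ∷ alpha} (e ∷ K✓) []

      outcome : count V < condTurán (length V) ⊎ (13 ≤ length V × SubComet G V)
      outcome = by-edges (edge v₀ v₄ v₅ ≟ᵇ true) (edge v₀ v₆ v₇ ≟ᵇ true) small-or-large
        where
        by-edges : Dec (Adj v₀ v₄ v₅) → Dec (Adj v₀ v₆ v₇) → count V < condTurán (length V) ⊎ 13 ≤ length V →
                   count V < condTurán (length V) ⊎ (13 ≤ length V × SubComet G V)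
        by-edges (yes e) _       _         = inj₁ (deficient (≤-trans (inner-045 e) (m≤m+n 6 3)))
        by-edges _       (yes e) _         = inj₁ (deficient (≤-trans (inner-067 e) (m≤m+n 6 3)))
        by-edges _       _       (inj₁ lt) = inj₁ lt
        by-edges (no ¬e) (no ¬f) (inj₂ ge) = inj₂ (ge , Comet.subComet ¬e ¬f)

    outcome′ : count V < condTurán (length V) ⊎ (13 ≤ length V × SubComet G V)
    outcome′ = go (length W⁺) refl
      where
      go : ∀ m → length W⁺ ≡ m → count V < condTurán (length V) ⊎ (13 ≤ length V × SubComet G V)
      go zero    eq = outcome eq
      go (suc m) eq = inj₁ (some-bad eq)

  alpha-outcome : count V < condTurán (length V) ⊎ (13 ≤ length V × SubComet G V)
  alpha-outcome with Any.any? (λ w → (edge w v₄ v₅ ≟ᵇ true) ⊎-dec (edge w v₆ v₇ ≟ᵇ true)) W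
  ... | yes l = let w , w∈ , e = Membership.find l in inj₁ (Linked.small w∈ e)
  ... | no ¬l = NotLinked.outcome′ λ w∈ → (λ e → ¬l (Membership.lose w∈ (inj₁ e))) , (λ e → ¬l (Membership.lose w∈ (inj₂ e)))

-- A further edge at the vertex 0 and none at 3.

module Beta {n} (G : 3Graph (Fin n)) (pf : 3Graph.PathFree G)
            {V : List (Fin n)} (uV : Unique V)
            (ih : ∀ {U} → length U < length V → Unique U → 3Graph.count G U ≤ freeTurán (length U))
            (¬alpha : ¬ Vertices.Occurs G {8} alpha V)
            {v₀ v₁ v₂ v₃ v₄ v₅ v₆ v₇ : Fin n} {W : List (Fin n)}
            (V↭ : V ↭ v₀ ∷ v₁ ∷ v₂ ∷ v₃ ∷ v₄ ∷ v₅ ∷ v₆ ∷ v₇ ∷ W)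
            (K✓ : Vertices.Present G (v₀ ∷ v₁ ∷ v₂ ∷ v₃ ∷ v₄ ∷ v₅ ∷ v₆ ∷ v₇ ∷ []) beta) where
  open 3Graph G
  open Vertices G

  v : Vec (Fin n) 8
  v = v₀ ∷ v₁ ∷ v₂ ∷ v₃ ∷ v₄ ∷ v₅ ∷ v₆ ∷ v₇ ∷ []

  Covered : Fin n → Set
  Covered u = ∃[ x ] ∃[ y ] x ∈ W × y ∈ W × Adj u x y

  covered? : ∀ u → Dec (Covered u)
  covered? u = any? λ x → any? λ y → (x ∈? W) ×-dec (y ∈? W) ×-dec (edge u x y ≟ᵇ true)

  open Around G pf {v = v} uV V↭
  open Parted G pf {v = v} uV V↭ covered? (λ {x} {y} {z} _ y∈ z∈ e → y , z , y∈ , z∈ , e)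

  K₂✓ : ∀ {u u′} → Present (u ∷ u′ ∷ v) (map (shift1 ∘ shift1) (beta {0}))
  K₂✓ = Allₚ.map⁺ {f = shift1 ∘ shift1} K✓

  private
    -- Exchanging the roles of the vertices 0 and 3 turns a further edge at 0 into a copy of alpha.
    at-0 at-3 : Vec (Fin 10) 8
    at-0 = 5F ∷ 3F ∷ 4F ∷ 2F ∷ 8F ∷ 9F ∷ 0F ∷ 1F ∷ []
    at-3 = 2F ∷ 3F ∷ 4F ∷ 5F ∷ 6F ∷ 7F ∷ 0F ∷ 1F ∷ []

    occurs : ∀ {u u′} → u ∈ W → u′ ∈ W → u ≢ u′ → (is : Vec (Fin 10) 8) → T (distinct (toList is)) →
             ¬ Present (Vec.map (lookup (u ∷ u′ ∷ v)) is) alpha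
    occurs {u} {u′} u∈ u′∈ ne is d p = ¬alpha (_ , sub-unique G pf {v = u ∷ u′ ∷ v} (extend₂ u∈ u′∈ ne) is d ,
      sub-⊆ G pf {v = u ∷ u′ ∷ v} (W∈V u∈ ∷ W∈V u′∈ ∷ v⊆V) is , p)

  -- The conflicts exclude all labels but 0 and 3; at these two an edge to the outside would give
  -- the excluded `alpha`.
  colink-0 : ∀ {u u′} → u ∈ W → u′ ∈ W → u ≢ u′ → colink u u′ ≡ 0
  colink-0 {u} {u′} u∈ u′∈ ne = go K✓ (absentees id (colinksᶠ 8))
    where
    open Labels G pf {v = u ∷ u′ ∷ v} (extend₂ u∈ u′∈ ne) K₂✓
    go : Present v beta →
         All (λ t → valueAt (u ∷ u′ ∷ v) t ≡ false) (filterᵇ (PathConf.killed (map (shift1 ∘ shift1) beta)) (colinksᶠ 8)) →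
         colink u u′ ≡ 0
    go (e₁ ∷ e₂ ∷ e₃ ∷ e₄ ∷ []) (n₁ ∷ n₂ ∷ n₄ ∷ n₅ ∷ n₆ ∷ n₇ ∷ []) rewrite n₁ | n₂ | n₄ | n₅ | n₆ | n₇ =
      cong₂ _+_ (bit-false λ e → occurs u∈ u′∈ ne at-0 tt (rotate (rotate e₂) ∷ rotate e₁ ∷ e₄ ∷ e ∷ []))
                (trans (+-identityʳ _) (bit-false λ e → occurs u∈ u′∈ ne at-3 tt (e₁ ∷ e₂ ∷ e₃ ∷ e ∷ [])))

  covered-≤ : ∀ {u} → u ∈ W → Covered u → link u ≤ 3
  covered-≤ u∈ (x , y , x∈ , y∈ , e) =
    bound₃ {K = (0F , 1F , 2F) ∷ map (shift1 ∘ shift1 ∘ shift1) beta} u∈ x∈ y∈ e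
           (e ∷ Allₚ.map⁺ {f = shift1 ∘ shift1 ∘ shift1} K✓) []

  inner-≤ : count (toList v) ≤ 8
  inner-≤ = bound₀ K✓ []

  link-≤ : ∀ {u} → u ∈ W → link u ≤ 5
  link-≤ u∈ = bound₁ {K = map shift1 beta} u∈ (Allₚ.map⁺ {f = shift1} K✓) []

  beta-outcome : count V < condTurán (length V)
  beta-outcome = begin-strict
    count V
      ≤⟨ parted inner-≤ link-≤ (links⁺ covered-≤) (+-mono-≤ (≤-reflexive (sum2-0 uniqueʳ colink-0)) (ih smaller unique⁺)) ⟩
    8 + 5 * length W⁻ + 3 * length W⁺ + freeTurán (length W⁺)
      <⟨ Estimates.beta-bound (length W⁻) (length W⁺) ⟩
    condTurán (8 + (length W⁻ + length W⁺))
      ≡⟨ cong condTurán length-parts ⟨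
    condTurán (length V) ∎
    where
    open ≤-Reasoning
    smaller : length W⁺ < length V
    smaller = ≤-trans (+-mono-≤ (m≤m+n 1 7) (m≤n+m (length W⁺) (length W⁻))) (≤-reflexive (sym length-parts))

module _ {n} (G : 3Graph (Fin n)) where
  open 3Graph G

  record Closed6 (V : List (Fin n)) : Set where
    field
      {U W}       : List (Fin n)
      arrangement : V ↭ U ++ W
      size-U      : length U ≡ 6
      closed      : ∀ {x w y} → x ∈ U → w ∈ W → y ∈ V → ¬ Adj x w y

-- Six labelled vertices without outgoing edges at 0 and 3.

private
  T-∨⁺ : ∀ b {c} → T b ⊎ T c → T (b ∨ c)
  T-∨⁺ b = Equivalence.from (T-∨ {b})

-- An outside vertex can only be joined to the six vertices of base through four pairs, and each of
-- these destroys the listed edges among the six.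
module Types where
  pairOf : Fin 4 → Fin 6 × Fin 6
  pairOf 0F = 1F , 2F
  pairOf 1F = 3F , 4F
  pairOf 2F = 3F , 5F
  pairOf 3F = 4F , 5F

  linkOf : Fin 4 → Triple (Fin 7)
  linkOf t = let i , j = pairOf t in 0F , suc i , suc j

  lost : Fin 4 → List (Triple (Fin 6))
  lost 0F = (0F , 1F , 3F) ∷ (0F , 1F , 4F) ∷ (0F , 1F , 5F) ∷ (0F , 2F , 3F) ∷ (0F , 2F , 4F) ∷ (0F , 2F , 5F) ∷ []
  lost 1F = (0F , 1F , 5F) ∷ (0F , 2F , 5F) ∷ (0F , 3F , 5F) ∷ (0F , 4F , 5F) ∷ (1F , 3F , 5F) ∷ (1F , 4F , 5F) ∷ (2F , 3F , 5F) ∷ (2F , 4F , 5F) ∷ []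
  lost 2F = (0F , 1F , 4F) ∷ (0F , 2F , 4F) ∷ (0F , 3F , 4F) ∷ (0F , 4F , 5F) ∷ (1F , 3F , 4F) ∷ (1F , 4F , 5F) ∷ (2F , 3F , 4F) ∷ (2F , 4F , 5F) ∷ []
  lost 3F = (0F , 1F , 4F) ∷ (0F , 1F , 5F) ∷ (0F , 2F , 4F) ∷ (0F , 2F , 5F) ∷ (0F , 3F , 4F) ∷ (0F , 3F , 5F) ∷ (1F , 3F , 4F) ∷ (1F , 3F , 5F) ∷ (2F , 3F , 4F) ∷ (2F , 3F , 5F) ∷ []

  unlinkable : List (Triple (Fin 7))
  unlinkable = (0F , 1F , 2F) ∷ (0F , 1F , 3F) ∷ (0F , 1F , 4F) ∷ (0F , 1F , 5F) ∷ (0F , 1F , 6F) ∷ (0F , 2F , 4F) ∷ (0F , 2F , 5F) ∷ (0F , 2F , 6F) ∷ (0F , 3F , 4F) ∷ (0F , 3F , 5F) ∷ (0F , 3F , 6F) ∷ []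

  lostIf : Fin 4 → Bool → List (Triple (Fin 6))
  lostIf t true  = lost t
  lostIf t false = []

  absentIf : Fin 4 → Bool → List (Triple (Fin 7))
  absentIf t true  = []
  absentIf t false = linkOf t ∷ []

  innerN : Bool → Bool → Bool → Bool → List (Triple (Fin 6))
  innerN b₀ b₁ b₂ b₃ = lostIf 0F b₀ ++ lostIf 1F b₁ ++ lostIf 2F b₂ ++ lostIf 3F b₃

  linkN : Bool → Bool → Bool → Bool → List (Triple (Fin 7))
  linkN b₀ b₁ b₂ b₃ = unlinkable ++ absentIf 0F b₀ ++ absentIf 1F b₁ ++ absentIf 2F b₂ ++ absentIf 3F b₃

  -- With `K` empty nothing is killed and nothing clashes, so these bounds merely count the triples
  -- outside the lists: 20 minus the union of the losses inside, and 15 minus the excluded pairs for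
  -- a link.
  innerB linkB : Bool → Bool → Bool → Bool → ℕ
  innerB b₀ b₁ b₂ b₃ = PathConf.bound [] (innerN b₀ b₁ b₂ b₃) (triplesᶠ 6)
  linkB  b₀ b₁ b₂ b₃ = PathConf.bound [] (linkN b₀ b₁ b₂ b₃) (linksᶠ 6)

  innerT : Bool → Bool → Bool → Bool → ℕ
  innerT true  false false false = 14
  innerT false true  false false = 12
  innerT false false true  false = 12
  innerT false false false true  = 10
  innerT true  true  false false = 8
  innerT true  false true  false = 8
  innerT true  false false true  = 8
  innerT false true  true  false = 7
  innerT false true  false true  = 7
  innerT false false true  true  = 7
  innerT true  true  true  false = 5
  innerT true  true  false true  = 5
  innerT true  false true  true  = 5
  innerT false true  true  true  = 7
  innerT true  true  true  true  = 5
  innerT false false false false = 20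

  linkT : Bool → Bool → Bool → Bool → ℕ
  linkT b₀ b₁ b₂ b₃ = bit b₀ + bit b₁ + bit b₂ + bit b₃

  allBools : (Bool → Bool → Bool → Bool → Bool) → Bool
  allBools p = all (λ b₀ → all (λ b₁ → all (λ b₂ → all (λ b₃ → p b₀ b₁ b₂ b₃) bs) bs) bs) bs
    where
    bs : List Bool
    bs = true ∷ false ∷ []

  fromAll : ∀ p → T (allBools p) → ∀ b₀ b₁ b₂ b₃ → T (p b₀ b₁ b₂ b₃)
  fromAll p h b₀ b₁ b₂ b₃ =
    look (λ b₃ → p b₀ b₁ b₂ b₃) (look (λ b₂ → all (p b₀ b₁ b₂) bs) (look (λ b₁ → all (λ b₂ → all (p b₀ b₁ b₂) bs) bs)
      (look (λ b₀ → all (λ b₁ → all (λ b₂ → all (p b₀ b₁ b₂) bs) bs) bs) h b₀) b₁) b₂) b₃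
    where
    bs : List Bool
    bs = true ∷ false ∷ []
    look : ∀ q → T (all q bs) → ∀ b → T (q b)
    look q h true  = All.lookup (Allₚ.all⁺ q bs h) (here refl)
    look q h false = All.lookup (Allₚ.all⁺ q bs h) (there (here refl))

  inner-table : ∀ b₀ b₁ b₂ b₃ → innerB b₀ b₁ b₂ b₃ ≤ innerT b₀ b₁ b₂ b₃
  inner-table b₀ b₁ b₂ b₃ = ≤ᵇ⇒≤ _ _ (fromAll (λ b₀ b₁ b₂ b₃ → innerB b₀ b₁ b₂ b₃ ≤ᵇ innerT b₀ b₁ b₂ b₃) tt b₀ b₁ b₂ b₃)

  link-table : ∀ b₀ b₁ b₂ b₃ → linkB b₀ b₁ b₂ b₃ ≤ linkT b₀ b₁ b₂ b₃
  link-table b₀ b₁ b₂ b₃ = ≤ᵇ⇒≤ _ _ (fromAll (λ b₀ b₁ b₂ b₃ → linkB b₀ b₁ b₂ b₃ ≤ᵇ linkT b₀ b₁ b₂ b₃) tt b₀ b₁ b₂ b₃)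

  small : ∀ b₀ b₁ b₂ b₃ → T (b₀ ∨ b₁ ∨ b₂ ∨ b₃) → ∀ k m →
          innerT b₀ b₁ b₂ b₃ + linkT b₀ b₁ b₂ b₃ * k + 0 * m + freeTurán (0 + m) < condTurán (6 + (k + m))
  small true  false false false _ = Growth.grow (λ k → 14 + 1 * k) 0 0 6 (linear-step 14 1 6)
  small false true  false false _ = Growth.grow (λ k → 12 + 1 * k) 0 0 6 (linear-step 12 1 6)
  small false false true  false _ = Growth.grow (λ k → 12 + 1 * k) 0 0 6 (linear-step 12 1 6)
  small false false false true  _ = Growth.grow (λ k → 10 + 1 * k) 0 0 6 (linear-step 10 1 6)
  small true  true  false false _ = Growth.grow (λ k →  8 + 2 * k) 0 0 6 (linear-step 8 2 6)
  small true  false true  false _ = Growth.grow (λ k →  8 + 2 * k) 0 0 6 (linear-step 8 2 6)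
  small true  false false true  _ = Growth.grow (λ k →  8 + 2 * k) 0 0 6 (linear-step 8 2 6)
  small false true  true  false _ = Growth.grow (λ k →  7 + 2 * k) 0 0 6 (linear-step 7 2 6)
  small false true  false true  _ = Growth.grow (λ k →  7 + 2 * k) 0 0 6 (linear-step 7 2 6)
  small false false true  true  _ = Growth.grow (λ k →  7 + 2 * k) 0 0 6 (linear-step 7 2 6)
  small true  true  true  false _ = Growth.grow (λ k →  5 + 3 * k) 0 0 6 (linear-step 5 3 6)
  small true  true  false true  _ = Growth.grow (λ k →  5 + 3 * k) 0 0 6 (linear-step 5 3 6)
  small true  false true  true  _ = Growth.grow (λ k →  5 + 3 * k) 0 0 6 (linear-step 5 3 6)
  small false true  true  true  _ = Growth.grow (λ k →  7 + 3 * k) 0 0 6 (linear-step 7 3 6)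
  small true  true  true  true  _ = Growth.grow (λ k →  5 + 4 * k) 0 0 6 (linear-step 5 4 6)

module Base {n} (G : 3Graph (Fin n)) (pf : 3Graph.PathFree G)
            {V : List (Fin n)} (uV : Unique V)
            (ih : ∀ {U} → length U < length V → Unique U → 3Graph.count G U ≤ freeTurán (length U))
            (¬alpha : ¬ Vertices.Occurs G {8} alpha V) (¬beta : ¬ Vertices.Occurs G {8} beta V)
            {v₀ v₁ v₂ v₃ v₄ v₅ : Fin n} {W : List (Fin n)}
            (V↭ : V ↭ v₀ ∷ v₁ ∷ v₂ ∷ v₃ ∷ v₄ ∷ v₅ ∷ W)
            (K✓ : Vertices.Present G (v₀ ∷ v₁ ∷ v₂ ∷ v₃ ∷ v₄ ∷ v₅ ∷ []) base) where
  open 3Graph G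
  open Vertices G
  open Types

  v : Vec (Fin n) 6
  v = v₀ ∷ v₁ ∷ v₂ ∷ v₃ ∷ v₄ ∷ v₅ ∷ []

  Covered : Fin n → Set
  Covered u = ∃[ x ] ∃[ y ] x ∈ W × y ∈ W × Adj u x y

  covered? : ∀ u → Dec (Covered u)
  covered? u = any? λ x → any? λ y → (x ∈? W) ×-dec (y ∈? W) ×-dec (edge u x y ≟ᵇ true)

  open Around G pf {v = v} uV V↭
  open Parted G pf {v = v} uV V↭ covered? (λ {x} {y} {z} _ y∈ z∈ e → y , z , y∈ , z∈ , e)

  K₁✓ : ∀ {u} → Present (u ∷ v) (map shift1 (base {0}))
  K₁✓ = Allₚ.map⁺ {f = shift1} K✓

  K₂✓ : ∀ {u u′} → Present (u ∷ u′ ∷ v) (map (shift1 ∘ shift1) (base {0}))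
  K₂✓ = Allₚ.map⁺ {f = shift1 ∘ shift1} K✓

  K₃✓ : ∀ {u u′ u″} → Present (u ∷ u′ ∷ u″ ∷ v) (map (shift1 ∘ shift1 ∘ shift1) (base {0}))
  K₃✓ = Allₚ.map⁺ {f = shift1 ∘ shift1 ∘ shift1} K✓

  no-v₀ : ∀ {u u′} → u ∈ W → u′ ∈ W → ¬ Adj v₀ u u′
  no-v₀ {u} {u′} u∈ u′∈ e = go K✓
    where
    is : Vec (Fin 8) 8
    is = 2F ∷ 3F ∷ 4F ∷ 5F ∷ 6F ∷ 7F ∷ 0F ∷ 1F ∷ []
    go : Present v base → ⊥
    go (e₁ ∷ e₂ ∷ e₃ ∷ []) = ¬beta
      (_ , sub-unique G pf {v = u ∷ u′ ∷ v} (extend₂ u∈ u′∈ (proj₂ (proj₂ (edge-distinct e)))) is tt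
         , sub-⊆ G pf {v = u ∷ u′ ∷ v} (W∈V u∈ ∷ W∈V u′∈ ∷ v⊆V) is , e₁ ∷ e₂ ∷ e₃ ∷ e ∷ [])

  no-v₃ : ∀ {u u′} → u ∈ W → u′ ∈ W → ¬ Adj v₃ u u′
  no-v₃ {u} {u′} u∈ u′∈ e = go K✓
    where
    is : Vec (Fin 8) 8
    is = 2F ∷ 3F ∷ 4F ∷ 5F ∷ 6F ∷ 7F ∷ 0F ∷ 1F ∷ []
    go : Present v base → ⊥
    go (e₁ ∷ e₂ ∷ e₃ ∷ []) = ¬alpha
      (_ , sub-unique G pf {v = u ∷ u′ ∷ v} (extend₂ u∈ u′∈ (proj₂ (proj₂ (edge-distinct e)))) is tt
         , sub-⊆ G pf {v = u ∷ u′ ∷ v} (W∈V u∈ ∷ W∈V u′∈ ∷ v⊆V) is , e₁ ∷ e₂ ∷ e₃ ∷ e ∷ [])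

  -- With u in place of v₀ the edge uxy would give a copy of beta.
  no-v₁v₂ : ∀ {u} → u ∈ W → Covered u → ¬ Adj u v₁ v₂
  no-v₁v₂ {u} u∈ (x , y , x∈ , y∈ , e) f = go K✓
    where
    is : Vec (Fin 9) 8
    is = 0F ∷ 4F ∷ 5F ∷ 6F ∷ 7F ∷ 8F ∷ 1F ∷ 2F ∷ []
    go : Present v base → ⊥
    go (e₁ ∷ e₂ ∷ e₃ ∷ []) = ¬beta
      (_ , sub-unique G pf {v = u ∷ x ∷ y ∷ v} (extendₑ u∈ x∈ y∈ e) is tt
         , sub-⊆ G pf {v = u ∷ x ∷ y ∷ v} (W∈V u∈ ∷ W∈V x∈ ∷ W∈V y∈ ∷ v⊆V) is , f ∷ e₂ ∷ e₃ ∷ e ∷ [])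

  no-colink : ∀ {u u′ i} → u ∈ W → u′ ∈ W → ¬ Adj (lookup v i) u u′
  no-colink {u} {u′} {i} u∈ u′∈ e = dead-absent {N} (¬-not (no-v₀ u∈ u′∈) ∷ ¬-not (no-v₃ u∈ u′∈) ∷ [])
    (suc (suc i) , 0F , 1F) (All.lookup (Allₚ.all⁺ (λ i → dead N (suc (suc i) , 0F , 1F)) (allFin 6) tt) (∈-allFin i)) e
    where
    open Labels G pf {v = u ∷ u′ ∷ v} (extend₂ u∈ u′∈ (proj₂ (proj₂ (edge-distinct e)))) K₂✓
    N : List (Triple (Fin 8))
    N = (2F , 0F , 1F) ∷ (5F , 0F , 1F) ∷ []

  colink-0 : ∀ {u u′} → u ∈ W → u′ ∈ W → u ≢ u′ → colink u u′ ≡ 0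
  colink-0 u∈ u′∈ _ = sum1-0 (toList v) λ x∈ → bit-false λ e → absurd (lookup-index {v = v} x∈) e
    where
    absurd : ∀ {x} → ∃[ i ] lookup v i ≡ x → ¬ Adj x _ _
    absurd (i , refl) = no-colink {i = i} u∈ u′∈

  colinks-≤ : sum2 colink W + count W⁺ ≤ freeTurán (length W⁺)
  colinks-≤ = +-mono-≤ (≤-reflexive (sum2-0 uniqueʳ colink-0))
    (ih (≤-trans (+-mono-≤ (m≤m+n 1 5) (m≤n+m (length W⁺) (length W⁻))) (≤-reflexive (sym length-parts))) unique⁺)

  -- Of the four pairs only `v₄v₅` can tie a covered vertex to the six. If one does, inner edges are
  -- lost, and `u`, `x`, `y` are three known members of `W⁺` with links at most 1, which the
  -- estimate splits off.
  module Covered56 {u x y} (u∈ : u ∈ W) (x∈ : x ∈ W) (y∈ : y ∈ W) (e : Adj u x y) (f : Adj u v₄ v₅) where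

    inner-≤ : count (toList v) ≤ 8
    inner-≤ = bound₀″ {K = (0F , 1F , 2F) ∷ (0F , 7F , 8F) ∷ map (shift1 ∘ shift1 ∘ shift1) base} u∈ x∈ y∈ e (e ∷ f ∷ K₃✓)

    link-≤ : ∀ {u} → u ∈ W → link u ≤ 4
    link-≤ u∈ = bound₁ u∈ K₁✓ []

    covered-≤ : ∀ {u} → u ∈ W → Covered u → link u ≤ 1
    covered-≤ {u} u∈ c@(x , y , x∈ , y∈ , e) =
      bound₃ {K = (0F , 1F , 2F) ∷ map (shift1 ∘ shift1 ∘ shift1) base} {(0F , 4F , 5F) ∷ []} u∈ x∈ y∈ e (e ∷ K₃✓)
             (¬-not (no-v₁v₂ u∈ c) ∷ [])

    small₅₆ : count V < condTurán (length V)
    small₅₆ = go (split-off {xs = u ∷ x ∷ y ∷ []} (unique₃ e) (u∈⁺ ∷ x∈⁺ ∷ y∈⁺ ∷ []))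
      where
      u∈⁺ : u ∈ W⁺
      u∈⁺ = ∈-filter⁺ covered? u∈ (x , y , x∈ , y∈ , e)
      x∈⁺ : x ∈ W⁺
      x∈⁺ = ∈-filter⁺ covered? x∈ (u , y , u∈ , y∈ , flip₁ e)
      y∈⁺ : y ∈ W⁺
      y∈⁺ = ∈-filter⁺ covered? y∈ (x , u , x∈ , u∈ , flip₁₃ e)
      go : (∃[ Z ] W⁺ ↭ u ∷ x ∷ y ∷ Z) → count V < condTurán (length V)
      go (Z , p) = begin-strict
        count V                                                  ≤⟨ parted inner-≤ link-≤ (links⁺ covered-≤) colinks-≤ ⟩
        8 + 4 * k + 1 * length W⁺ + freeTurán (length W⁺)               ≡⟨ cong (λ l → 8 + 4 * k + 1 * l + freeTurán l) (↭-length p) ⟩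
        8 + 4 * k + 1 * (3 + length Z) + freeTurán (3 + length Z)       ≡⟨ lem (4 * k) (length Z) (freeTurán (3 + length Z)) ⟩
        11 + 4 * k + 1 * length Z + freeTurán (3 + length Z)            <⟨ Estimates.base-56 k (length Z) ⟩
        condTurán (9 + (k + length Z))                                  ≡⟨ cong condTurán (trans length-parts (trans (cong (λ l → 6 + (k + l)) (↭-length p)) (lem₂ k (length Z)))) ⟨
        condTurán (length V) ∎
        where
        open ≤-Reasoning
        k = length W⁻
        lem : ∀ a z g → 8 + a + 1 * (3 + z) + g ≡ 11 + a + 1 * z + g
        lem = solve-∀
        lem₂ : ∀ k z → 6 + (k + (3 + z)) ≡ 9 + (k + z)
        lem₂ = solve-∀

  -- No edge joins a covered vertex to the six any more, so `W⁺` costs exactly what the induction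
  -- hypothesis allows it.
  module NotCovered56 (¬56 : ∀ {u} → u ∈ W → Covered u → ¬ Adj u v₄ v₅) where

    covered-≤ : ∀ {u} → u ∈ W → Covered u → link u ≤ 0
    covered-≤ {u} u∈ c@(x , y , x∈ , y∈ , e) =
      bound₃ {K = (0F , 1F , 2F) ∷ map (shift1 ∘ shift1 ∘ shift1) base} {(0F , 4F , 5F) ∷ (0F , 7F , 8F) ∷ []} u∈ x∈ y∈ e (e ∷ K₃✓)
             (¬-not (no-v₁v₂ u∈ c) ∷ ¬-not (¬56 u∈ c) ∷ [])

    -- Whether a pair is used is stored as a Boolean which indexes the lists of lost and missing
    -- triples. Both counts can then be stated once for all sixteen combinations and compared with a
    -- table.
    record Type (t : Fin 4) : Set where
      constructor type
      field
        used      : Bool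
        destroyed : Absent v (lostIf t used)
        missing   : ∀ {u} → u ∈ W → Absent (u ∷ v) (absentIf t used)
        unused    : ∀ {u} → u ∈ W → used ≡ false → ¬ (valueAt (u ∷ v) (linkOf t) ≡ true)
    open Type

    lost-absent : ∀ {u} t → u ∈ W → valueAt (u ∷ v) (linkOf t) ≡ true → Absent v (lost t)
    lost-absent {u} t u∈ e = by-type t (Labels.absentees G pf {v = u ∷ v} (extend₁ u∈) {linkOf t ∷ map shift1 base} (e ∷ K₁✓) shift1 (triplesᶠ 6))
      where
      -- Once `t` is a literal the filter computes, and `lost t` is written to agree with its result
      -- including the order.
      by-type : ∀ t → Absent v (filterᵇ (PathConf.killed (linkOf t ∷ map shift1 base) ∘ shift1) (triplesᶠ 6)) → Absent v (lost t)
      by-type 0F a = a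
      by-type 1F a = a
      by-type 2F a = a
      by-type 3F a = a

    findType : ∀ t → Type t
    findType t with Any.any? (λ u → valueAt (u ∷ v) (linkOf t) ≟ᵇ true) W
    ... | yes some = let u , u∈ , e = Membership.find some in type true (lost-absent t u∈ e) (λ _ → []) (λ _ ())
    ... | no none  = type false [] (λ u∈ → ¬-not (λ e → none (Membership.lose u∈ e)) ∷ [])
                                   (λ u∈ _ e → none (Membership.lose u∈ e))

    module _ (t₀ : Type 0F) (t₁ : Type 1F) (t₂ : Type 2F) (t₃ : Type 3F) where

      inner-≤ : count (toList v) ≤ innerB (used t₀) (used t₁) (used t₂) (used t₃)
      inner-≤ = bound₀ {K = []} [] (Allₚ.++⁺ (destroyed t₀) (Allₚ.++⁺ (destroyed t₁) (Allₚ.++⁺ (destroyed t₂) (destroyed t₃))))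

      link-≤ : ∀ {u} → u ∈ W → link u ≤ linkB (used t₀) (used t₁) (used t₂) (used t₃)
      link-≤ {u} u∈ = bound₁ {K = []} u∈ []
        (Allₚ.++⁺ {xs = unlinkable} (Labels.absentees G pf {v = u ∷ v} (extend₁ u∈) K₁✓ id (linksᶠ 6))
          (Allₚ.++⁺ (missing t₀ u∈) (Allₚ.++⁺ (missing t₁ u∈) (Allₚ.++⁺ (missing t₂ u∈) (missing t₃ u∈)))))

      crossing : T (used t₀ ∨ used t₁ ∨ used t₂ ∨ used t₃) → count V < condTurán (length V)
      crossing some = begin-strict
        count V
          ≤⟨ parted (≤-trans inner-≤ (inner-table b₀ b₁ b₂ b₃)) (λ u∈ → ≤-trans (link-≤ u∈) (link-table b₀ b₁ b₂ b₃))
                    (links⁺ covered-≤) colinks-≤ ⟩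
        innerT b₀ b₁ b₂ b₃ + linkT b₀ b₁ b₂ b₃ * length W⁻ + 0 * length W⁺ + freeTurán (length W⁺)
          <⟨ small b₀ b₁ b₂ b₃ some (length W⁻) (length W⁺) ⟩
        condTurán (6 + (length W⁻ + length W⁺))
          ≡⟨ cong condTurán length-parts ⟨
        condTurán (length V) ∎
        where
        open ≤-Reasoning
        b₀ = used t₀
        b₁ = used t₁
        b₂ = used t₂
        b₃ = used t₃

      not-crossing : used t₀ ≡ false → used t₁ ≡ false → used t₂ ≡ false → used t₃ ≡ false → Closed6 G V
      not-crossing f₀ f₁ f₂ f₃ = record { arrangement = V↭ ; size-U = refl ; closed = no-edge }
        where
        no-link : ∀ {w i j} → w ∈ W → ¬ Adj w (lookup v i) (lookup v j)
        no-link {w} {i} {j} w∈ = dead-absent {N} N✓ (0F , suc i , suc j)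
          (All.lookup (Allₚ.all⁺ (λ j → dead N (0F , suc i , suc j)) (allFin 6) (All.lookup (Allₚ.all⁺ (λ i → all (λ j → dead N (0F , suc i , suc j)) (allFin 6)) (allFin 6) tt)
            (∈-allFin i))) (∈-allFin j))
          where
          open Labels G pf {v = w ∷ v} (extend₁ w∈) K₁✓
          N : List (Triple (Fin 7))
          N = (0F , 2F , 3F) ∷ (0F , 3F , 2F) ∷ (0F , 4F , 5F) ∷ (0F , 5F , 4F)
            ∷ (0F , 4F , 6F) ∷ (0F , 6F , 4F) ∷ (0F , 5F , 6F) ∷ (0F , 6F , 5F) ∷ []
          N✓ : Absent (w ∷ v) N
          N✓ = ¬-not (unused t₀ w∈ f₀) ∷ ¬-not (unused t₀ w∈ f₀ ∘ flip₂) ∷ ¬-not (unused t₁ w∈ f₁) ∷ ¬-not (unused t₁ w∈ f₁ ∘ flip₂)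
             ∷ ¬-not (unused t₂ w∈ f₂) ∷ ¬-not (unused t₂ w∈ f₂ ∘ flip₂) ∷ ¬-not (unused t₃ w∈ f₃) ∷ ¬-not (unused t₃ w∈ f₃ ∘ flip₂) ∷ []
        no-edge : ∀ {x w y} → x ∈ toList v → w ∈ W → y ∈ V → ¬ Adj x w y
        no-edge {x} {w} {y} x∈ w∈ y∈ e = by-place (lookup-index {v = v} x∈) (V-cases y∈) e
          where
          by-place : ∀ {x y} → ∃[ i ] lookup v i ≡ x → y ∈ toList v ⊎ y ∈ W → ¬ Adj x w y
          by-place (i , refl) (inj₂ y∈W) e = no-colink {i = i} w∈ y∈W e
          by-place (i , refl) (inj₁ y∈v) e with lookup-index {v = v} y∈v
          ... | j , refl = no-link {w} {i} {j} w∈ (flip₁ e)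

      decide : count V < condTurán (length V) ⊎ Closed6 G V
      decide = by-use (used t₀) (used t₁) (used t₂) (used t₃) refl refl refl refl
        where
        by-use : ∀ b₀ b₁ b₂ b₃ → used t₀ ≡ b₀ → used t₁ ≡ b₁ → used t₂ ≡ b₂ → used t₃ ≡ b₃ → count V < condTurán (length V) ⊎ Closed6 G V
        by-use false false false false f₀ f₁ f₂ f₃ = inj₂ (not-crossing f₀ f₁ f₂ f₃)
        by-use true  _     _     _     f₀ _  _  _  = inj₁ (crossing (T-∨⁺ (used t₀) (inj₁ (≡⇒T f₀))))
        by-use false true  _     _     _  f₁ _  _  = inj₁ (crossing (T-∨⁺ (used t₀) (inj₂ (T-∨⁺ (used t₁) (inj₁ (≡⇒T f₁))))))
        by-use false false true  _     _  _  f₂ _  = inj₁ (crossing (T-∨⁺ (used t₀) (inj₂ (T-∨⁺ (used t₁) (inj₂ (T-∨⁺ (used t₂) (inj₁ (≡⇒T f₂))))))))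
        by-use false false false true  _  _  _  f₃ = inj₁ (crossing (T-∨⁺ (used t₀) (inj₂ (T-∨⁺ (used t₁) (inj₂ (T-∨⁺ (used t₂) (inj₂ (≡⇒T f₃))))))))

  base-outcome : count V < condTurán (length V) ⊎ Closed6 G V
  base-outcome = by-56 (Any.any? (λ u → covered? u ×-dec (edge u v₄ v₅ ≟ᵇ true)) W)
    where
    by-56 : Dec (Any (λ u → Covered u × Adj u v₄ v₅) W) → count V < condTurán (length V) ⊎ Closed6 G V
    by-56 (yes some) with Membership.find some
    ... | u , u∈ , (x , y , x∈ , y∈ , e) , f = inj₁ (Covered56.small₅₆ u∈ x∈ y∈ e f)
    by-56 (no none) = decide (findType 0F) (findType 1F) (findType 2F) (findType 3F)
      where open NotCovered56 (λ u∈ c f → none (Membership.lose u∈ (c , f)))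

-- Combination of the cases.

module _ {n} (G : 3Graph (Fin n)) where
  open 3Graph G
  open Vertices G

  record Closed66 (V : List (Fin n)) : Set where
    field
      {U U′ W}    : List (Fin n)
      arrangement : V ↭ U ++ (U′ ++ W)
      size-U      : length U ≡ 6
      size-U′     : length U′ ≡ 6
      size-W      : length W ≡ 1
      closed      : ∀ {x w y} → x ∈ U → w ∈ U′ ++ W → y ∈ V → ¬ Adj x w y
      closed′     : ∀ {x w y} → x ∈ U′ → w ∈ W → y ∈ U′ ++ W → ¬ Adj x w y

  -- The structural constructors carry the ranges of the length in which the structure can attain
  -- `condTurán`; everywhere else a structure has to be turned into `below`.
  data Outcome (V : List (Fin n)) : Set where
    below : count V < condTurán (length V) → Outcome V
    twoBlocks   : length V ≤ 12 → Closed6 G V → Outcome V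
    threeBlocks : length V ≡ 13 → Closed66 V → Outcome V
    inComet : 13 ≤ length V → SubComet G V → Outcome V

  count-closed : ∀ {V U W} → Unique V → V ↭ U ++ W → (∀ {x w y} → x ∈ U → w ∈ W → y ∈ V → ¬ Adj x w y) →
                 count V ≡ count U + count W
  count-closed {V} {U} {W} uV V↭ closed = begin
    count V                       ≡⟨ sum3-↭ wt-sym V↭ ⟩
    count (U ++ W)                ≡⟨ sum3-++ wt-sym U W ⟩
    count U + c + p + count W     ≡⟨ cong₂ (λ c p → count U + c + p + count W) c≡0 p≡0 ⟩
    count U + 0 + 0 + count W     ≡⟨ cong (_+ count W) (trans (+-identityʳ _) (+-identityʳ _)) ⟩
    count U + count W             ∎
    where
    open ≡-Reasoning
    c = sum1 (λ r → sum2 (wt r) U) W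
    p = sum2 (λ r r′ → sum1 (λ x → wt x r r′) U) W
    u : Unique (U ++ W)
    u = Unique-↭ V↭ uV
    c≡0 : c ≡ 0
    c≡0 = sum1-0 W λ w∈ → sum2-0 (Unique-++ˡ U u) λ x∈ y∈ _ →
      bit-false (closed x∈ w∈ (∈-resp-↭ (↭-sym V↭) (∈-++⁺ˡ y∈)) ∘ flip₁)
    p≡0 : p ≡ 0
    p≡0 = sum2-0 (Unique-++ʳ U u) λ w∈ w′∈ _ → sum1-0 U λ x∈ →
      bit-false (closed x∈ w∈ (∈-resp-↭ (↭-sym V↭) (∈-++⁺ʳ U w′∈)))

  private
    two-sizes : ∀ k → 6 + k ≤ 12 → 20 + binom3 k ≤ condTurán (6 + k)
    two-sizes 0 _ = ≤-refl
    two-sizes 1 _ = ≤-refl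
    two-sizes 2 _ = ≤-refl
    two-sizes 3 _ = ≤-refl
    two-sizes 4 _ = ≤-refl
    two-sizes 5 _ = ≤-refl
    two-sizes 6 _ = ≤-refl
    two-sizes (suc (suc (suc (suc (suc (suc (suc k))))))) (s≤s (s≤s (s≤s (s≤s (s≤s (s≤s (s≤s (s≤s (s≤s (s≤s (s≤s (s≤s ()))))))))))))

    comet-size : ∀ r → 13 ≤ 4 + r → 4 + binom2 r ≤ condTurán (4 + r)
    comet-size r 13≤ = subst (λ r → 4 + binom2 r ≤ condTurán (4 + r)) (m+[n∸m]≡n (+-cancelˡ-≤ 4 9 r 13≤)) ≤-refl

  closed6-size : ∀ {V} (c : Closed6 G V) → length V ≡ 6 + length (Closed6.W c)
  closed6-size c = trans (↭-length arrangement) (trans (length-++ U) (cong (_+ length W) size-U))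
    where open Closed6 c

  count-six : ∀ {U} → Unique U → length U ≡ 6 → count U ≤ 20
  count-six u eq = ≤-trans (count-≤binom3 u) (≤-reflexive (cong binom3 eq))

  closed6-count : ∀ {V} → Unique V → (c : Closed6 G V) → count V ≤ 20 + count (Closed6.W c)
  closed6-count uV c = ≤-trans (≤-reflexive (count-closed uV arrangement closed))
    (+-monoˡ-≤ (count W) (count-six (Unique-++ˡ U (Unique-↭ arrangement uV)) size-U))
    where open Closed6 c

  subComet-count : ∀ {V} → Unique V → (s : SubComet G V) → count V ≤ 4 + binom2 (length (SubComet.R s))
  subComet-count {V} uV s = begin
    count V                           ≡⟨ count-V ⟩
    count (toList v) + sum1 (λ w → sum2 (wt w) (toList v)) R
      + sum2 (λ w w′ → sum1 (λ x → wt x w w′) (toList v)) R + count R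
      ≤⟨ +-mono-≤ (+-mono-≤ (+-mono-≤ (count-≤binom3 uniqueˡ) (≤-reflexive links)) colinks) (≤-reflexive (count-0 uniqueʳ rest)) ⟩
    4 + 0 + binom2 (length R) + 0        ≡⟨ +-identityʳ _ ⟩
    4 + binom2 (length R)                ∎
    where
    open ≤-Reasoning
    open SubComet s
    v : Vec (Fin n) 4
    v = c ∷ h₁ ∷ h₂ ∷ h₃ ∷ []
    open Split {v = v} uV arrangement
    links : sum1 (λ w → sum2 (wt w) (toList v)) R ≡ 0
    links = sum1-0 R λ w∈ → sum2-0 uniqueˡ (link w∈)
      where
      link : ∀ {w x y} → w ∈ R → x ∈ toList v → y ∈ toList v → x ≢ y → wt w x y ≡ 0
      link w∈ (there x∈) y∈          _   = bit-false (heads x∈ w∈ (v∈V y∈) ∘ flip₁)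
      link w∈ x∈@(here _) (there y∈) _   = bit-false (heads y∈ w∈ (v∈V x∈) ∘ rotate ∘ rotate)
      link w∈ (here refl) (here refl) ne = ⊥-elim (ne refl)
    colinks : sum2 (λ w w′ → sum1 (λ x → wt x w w′) (toList v)) R ≤ binom2 (length R)
    colinks = sum2-≤1 uniqueʳ λ {w} {w′} w∈ w′∈ _ →
      ≤-trans (≤-reflexive (trans (cong (wt c w w′ +_) (sum1-0 (h₁ ∷ h₂ ∷ h₃ ∷ []) λ h∈ → bit-false (heads h∈ w∈ (W∈V w′∈))))
                                  (+-identityʳ _)))
              (bit-≤1 (edge c w w′))

  Outcome-≤ : ∀ {V} → Unique V → Outcome V → count V ≤ condTurán (length V)
  Outcome-≤ uV (below lt)   = <⇒≤ lt
  Outcome-≤ {V} uV (twoBlocks le c) = begin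
    count V                     ≤⟨ closed6-count uV c ⟩
    20 + count W                ≤⟨ +-monoʳ-≤ 20 (count-≤binom3 (Unique-++ʳ U (Unique-↭ arrangement uV))) ⟩
    20 + binom3 (length W)         ≤⟨ two-sizes (length W) (≤-trans (≤-reflexive (sym (closed6-size c))) le) ⟩
    condTurán (6 + length W)           ≡⟨ cong condTurán (closed6-size c) ⟨
    condTurán (length V)               ∎
    where
    open ≤-Reasoning
    open Closed6 c
  Outcome-≤ {V} uV (threeBlocks eq c) = begin
    count V                           ≡⟨ count-closed uV arrangement closed ⟩
    count U + count (U′ ++ W)         ≡⟨ cong (count U +_) (count-closed uUW refl closed′) ⟩
    count U + (count U′ + count W)    ≤⟨ +-mono-≤ (count-six (Unique-++ˡ U u) size-U)
                                           (+-mono-≤ (count-six (Unique-++ˡ U′ uUW) size-U′)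
                                                     (≤-trans (count-≤binom3 (Unique-++ʳ U′ uUW)) (≤-reflexive (cong binom3 size-W)))) ⟩
    40                                ≡⟨ cong condTurán eq ⟨
    condTurán (length V)                     ∎
    where
    open ≤-Reasoning
    open Closed66 c
    u : Unique (U ++ (U′ ++ W))
    u = Unique-↭ arrangement uV
    uUW : Unique (U′ ++ W)
    uUW = Unique-++ʳ U u
  Outcome-≤ {V} uV (inComet le s) = begin
    count V                 ≤⟨ subComet-count uV s ⟩
    4 + binom2 (length R)      ≤⟨ comet-size (length R) (≤-trans le (≤-reflexive |V|)) ⟩
    condTurán (4 + length R)       ≡⟨ cong condTurán |V| ⟨
    condTurán (length V)           ∎
    where
    open ≤-Reasoning
    open SubComet s
    |V| : length V ≡ 4 + length R
    |V| = ↭-length arrangement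

  module _ (pf : PathFree) where

    outcome : ∀ {V} → Acc _<_ (length V) → Unique V → Occurs {6} disjoint V → Outcome V
    outcome {V} (acc rec) uV m = by-alpha (occurs? {8} alpha V) (occurs? {8} beta V) (occurs? {6} base V)
      where
      -- A subset may or may not still contain two disjoint edges; `freeTurán` dominates the bounds
      -- of both cases.
      smaller : ∀ {U} → length U < length V → Unique U → count U ≤ freeTurán (length U)
      smaller {U} lt uU = by-matching (matching? G pf U)
        where
        by-matching : Dec (Occurs {6} disjoint U) → count U ≤ freeTurán (length U)
        by-matching (yes m) = ≤-trans (Outcome-≤ uU (outcome (rec lt) uU m)) (condTurán≤freeTurán (length U))
        by-matching (no ¬m) = ≤-trans (MatchingFreeBound.count-≤matchingFreeMax G uU (no-matching G pf ¬m)) (matchingFreeMax≤freeTurán (length U))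

      from-closed : Closed6 G V → Outcome V
      from-closed c = by-size (length W) refl
        where
        open Closed6 c
        uW : Unique W
        uW = Unique-++ʳ U (Unique-↭ arrangement uV)
        lt : length W < length V
        lt = ≤-trans (m≤n+m (suc (length W)) 5) (≤-reflexive (sym (closed6-size c)))
        few : ∀ {k} → length W ≡ k → 6 + k ≤ 12 → Outcome V
        few eq le = twoBlocks (≤-trans (≤-reflexive (trans (closed6-size c) (cong (6 +_) eq))) le) c
        -- Here 20 + `freeTurán 7` equals `condTurán 13`, so numbers alone do not decide. Without
        -- disjoint edges `W` has at most 18 edges; otherwise its own outcome gives fewer than 20,
        -- or a second block of six with one vertex left over.
        seven : length W ≡ 7 → Dec (Occurs {6} disjoint W) → Outcome V
        seven eq (no ¬m) = below (≤-trans (s≤s (≤-trans (closed6-count uV c) (+-monoʳ-≤ 20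
          (≤-trans (MatchingFreeBound.count-≤matchingFreeMax G uW (no-matching G pf ¬m)) (≤-reflexive (cong matchingFreeMax eq))))))
          (≤-trans (m≤m+n 39 1) (≤-reflexive (cong condTurán (sym (trans (closed6-size c) (cong (6 +_) eq)))))))
        seven eq (yes m) = by-outcome (outcome (rec lt) uW m)
          where
          by-outcome : Outcome W → Outcome V
          by-outcome (below lt) = below (≤-trans (s≤s (closed6-count uV c)) (≤-trans (+-monoʳ-≤ 20 (≤-trans lt (≤-reflexive (cong condTurán eq))))
            (≤-reflexive (cong condTurán (sym (trans (closed6-size c) (cong (6 +_) eq)))))))
          by-outcome (twoBlocks _ c′) = threeBlocks (trans (closed6-size c) (cong (6 +_) eq)) record
            { arrangement = ↭-trans arrangement (Permutationₚ.++⁺ˡ U (Closed6.arrangement c′))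
            ; size-U      = size-U
            ; size-U′     = Closed6.size-U c′
            ; size-W      = +-cancelˡ-≡ 6 _ _ (trans (sym (closed6-size c′)) eq)
            ; closed      = λ x∈ w∈ → closed x∈ (∈-resp-↭ (↭-sym (Closed6.arrangement c′)) w∈)
            ; closed′     = λ x∈ w∈ y∈ → Closed6.closed c′ x∈ w∈ (∈-resp-↭ (↭-sym (Closed6.arrangement c′)) y∈)
            }
          by-outcome (threeBlocks eq′ _) = case trans (sym eq) eq′ of λ ()
          by-outcome (inComet le _)  = case ≤-trans le (≤-reflexive eq) of λ { (s≤s (s≤s (s≤s (s≤s (s≤s (s≤s (s≤s ()))))))) }
        many : ∀ k → length W ≡ 8 + k → Outcome V
        many k eq = below (begin-strict
          count V                       ≤⟨ closed6-count uV c ⟩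
          20 + count W                  ≤⟨ +-monoʳ-≤ 20 (≤-trans (smaller lt uW) (≤-reflexive (cong freeTurán eq))) ⟩
          20 + 0 * k + freeTurán (8 + k)       <⟨ Estimates.closed-large k ⟩
          condTurán (14 + k)                   ≡⟨ cong condTurán (trans (closed6-size c) (cong (6 +_) eq)) ⟨
          condTurán (length V)                 ∎)
          where open ≤-Reasoning
        by-size : ∀ k → length W ≡ k → Outcome V
        by-size 0 eq = few eq (m≤m+n 6 6)
        by-size 1 eq = few eq (m≤m+n 7 5)
        by-size 2 eq = few eq (m≤m+n 8 4)
        by-size 3 eq = few eq (m≤m+n 9 3)
        by-size 4 eq = few eq (m≤m+n 10 2)
        by-size 5 eq = few eq (m≤m+n 11 1)
        by-size 6 eq = few eq (m≤m+n 12 0)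
        by-size 7 eq = seven eq (matching? G pf W)
        by-size (suc (suc (suc (suc (suc (suc (suc (suc k)))))))) eq = many k eq

      from-alpha : count V < condTurán (length V) ⊎ (13 ≤ length V × SubComet G V) → Outcome V
      from-alpha (inj₁ lt)       = below lt
      from-alpha (inj₂ (le , s)) = inComet le s

      from-base : count V < condTurán (length V) ⊎ Closed6 G V → Outcome V
      from-base (inj₁ lt) = below lt
      from-base (inj₂ c)  = from-closed c

      by-alpha : Dec (Occurs {8} alpha V) → Dec (Occurs {8} beta V) → Dec (Occurs {6} base V) → Outcome V
      by-alpha (yes (_ ∷ _ ∷ _ ∷ _ ∷ _ ∷ _ ∷ _ ∷ _ ∷ [] , u , v∈ , K✓)) _ _ =
        let W , V↭ = split-off u v∈ in from-alpha (Alpha.alpha-outcome G pf uV smaller V↭ K✓)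
      by-alpha (no ¬α) (yes (_ ∷ _ ∷ _ ∷ _ ∷ _ ∷ _ ∷ _ ∷ _ ∷ [] , u , v∈ , K✓)) _ =
        let W , V↭ = split-off u v∈ in below (Beta.beta-outcome G pf uV smaller ¬α V↭ K✓)
      by-alpha (no ¬α) (no ¬β) (yes (_ ∷ _ ∷ _ ∷ _ ∷ _ ∷ _ ∷ [] , u , v∈ , K✓)) =
        let W , V↭ = split-off u v∈ in from-base (Base.base-outcome G pf uV smaller ¬α ¬β V↭ K✓)
      by-alpha _ _ (no ¬base) = below (count-unlinked-< G pf uV ¬base m)

-- From Graph³ to 3Graph.

pair : Fin n → Fin n → Subset n
pair x y = ⁅ x ⁆ ∪ ⁅ y ⁆

countSubsets : ∀ {n} {Q : Pred (Subset n) 0ℓ} → Decidable Q → ℕ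
countSubsets {n} Q? = length (filter Q? (subsets n))

private
  length-filter-map : ∀ {A B : Set} {Q : Pred B 0ℓ} (Q? : Decidable Q) (f : A → B) xs →
                      length (filter Q? (map f xs)) ≡ length (filter (Q? ∘ f) xs)
  length-filter-map Q? f [] = refl
  length-filter-map Q? f (x ∷ xs) with does (Q? (f x))
  ... | true  = cong suc (length-filter-map Q? f xs)
  ... | false = length-filter-map Q? f xs

  countSubsets-suc : ∀ {n} {Q : Pred (Subset (suc n)) 0ℓ} (Q? : Decidable Q) →
                     countSubsets Q? ≡ countSubsets (Q? ∘ (outside ∷_)) + countSubsets (Q? ∘ (inside ∷_))
  countSubsets-suc {n} Q? = begin
    length (filter Q? (map (outside ∷_) (subsets n) ++ map (inside ∷_) (subsets n)))
      ≡⟨ cong length (filter-++ Q? (map (outside ∷_) (subsets n)) _) ⟩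
    length (filter Q? (map (outside ∷_) (subsets n)) ++ filter Q? (map (inside ∷_) (subsets n)))
      ≡⟨ length-++ (filter Q? (map (outside ∷_) (subsets n))) ⟩
    length (filter Q? (map (outside ∷_) (subsets n))) + length (filter Q? (map (inside ∷_) (subsets n)))
      ≡⟨ cong₂ _+_ (length-filter-map Q? _ (subsets n)) (length-filter-map Q? _ (subsets n)) ⟩
    _ ∎
    where open ≡-Reasoning

  allFin-suc : ∀ n → allFin (suc n) ≡ zero ∷ map suc (allFin n)
  allFin-suc n = cong (zero ∷_) (sym (map-tabulate id suc))

  does-≡ : ∀ {n} {Q : Pred (Subset n) 0ℓ} (Q? : Decidable Q) {p q} → p ≡ q → bit (does (Q? p)) ≡ bit (does (Q? q))
  does-≡ Q? refl = refl

-- This and the next three lemmas follow the recursion of `subsets`: a subset either avoids the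
-- first vertex, or contains it and leaves a subset of one element less.
countSubsets-0 : ∀ {n} {Q : Pred (Subset n) 0ℓ} (Q? : Decidable Q) → (∀ {p} → Q p → ∣ p ∣ ≡ 0) →
                 countSubsets Q? ≡ bit (does (Q? ∅))
countSubsets-0 {zero}  Q? card with does (Q? [])
... | true  = refl
... | false = refl
countSubsets-0 {suc n} Q? card = begin
  countSubsets Q?                                    ≡⟨ countSubsets-suc Q? ⟩
  countSubsets (Q? ∘ (outside ∷_)) + countSubsets (Q? ∘ (inside ∷_))
    ≡⟨ cong₂ _+_ (countSubsets-0 (Q? ∘ (outside ∷_)) card) (none (subsets n)) ⟩
  bit (does (Q? (outside ∷ ∅))) + 0                  ≡⟨ +-identityʳ _ ⟩
  bit (does (Q? ∅))                                  ∎
  where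
  open ≡-Reasoning
  none : ∀ xs → length (filter (Q? ∘ (inside ∷_)) xs) ≡ 0
  none [] = refl
  none (x ∷ xs) with Q? (inside ∷ x)
  ... | yes q = case card q of λ ()
  ... | no _  = none xs

countSubsets-1 : ∀ {n} {Q : Pred (Subset n) 0ℓ} (Q? : Decidable Q) → (∀ {p} → Q p → ∣ p ∣ ≡ 1) →
                 countSubsets Q? ≡ sum1 (λ x → bit (does (Q? ⁅ x ⁆))) (allFin n)
countSubsets-1 {zero}  Q? card with Q? []
... | yes q = case card q of λ ()
... | no _  = refl
countSubsets-1 {suc n} Q? card = begin
  countSubsets Q?                       ≡⟨ countSubsets-suc Q? ⟩
  _                                     ≡⟨ cong₂ _+_ (countSubsets-1 (Q? ∘ (outside ∷_)) card)
                                                     (countSubsets-0 (Q? ∘ (inside ∷_)) (suc-injective ∘ card)) ⟩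
  sum1 (f ∘ suc) (allFin n) + f zero    ≡⟨ +-comm _ (f zero) ⟩
  f zero + sum1 (f ∘ suc) (allFin n)    ≡⟨ cong (f zero +_) (sum1-map f suc (allFin n)) ⟨
  sum1 f (zero ∷ map suc (allFin n))    ≡⟨ cong (sum1 f) (allFin-suc n) ⟨
  sum1 f (allFin (suc n))               ∎
  where
  open ≡-Reasoning
  f = λ x → bit (does (Q? ⁅ x ⁆))

countSubsets-2 : ∀ {n} {Q : Pred (Subset n) 0ℓ} (Q? : Decidable Q) → (∀ {p} → Q p → ∣ p ∣ ≡ 2) →
                 countSubsets Q? ≡ sum2 (λ x y → bit (does (Q? (pair x y)))) (allFin n)
countSubsets-2 {zero}  Q? card with Q? []
... | yes q = case card q of λ ()
... | no _  = refl
countSubsets-2 {suc n} Q? card = begin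
  countSubsets Q?                       ≡⟨ countSubsets-suc Q? ⟩
  _                                     ≡⟨ cong₂ _+_ (countSubsets-2 (Q? ∘ (outside ∷_)) card)
                                                     (countSubsets-1 (Q? ∘ (inside ∷_)) (suc-injective ∘ card)) ⟩
  sum2 (λ x y → f (suc x) (suc y)) (allFin n) + sum1 (λ x → bit (does (Q? (inside ∷ ⁅ x ⁆)))) (allFin n)
    ≡⟨ +-comm (sum2 (λ x y → f (suc x) (suc y)) (allFin n)) _ ⟩
  sum1 (λ x → bit (does (Q? (inside ∷ ⁅ x ⁆)))) (allFin n) + sum2 (λ x y → f (suc x) (suc y)) (allFin n)
    ≡⟨ cong₂ _+_ (trans (sum1-cong (allFin n) λ x → does-≡ Q? (cong (inside ∷_) (sym (∪-identityˡ ⁅ x ⁆))))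
                        (sym (sum1-map (f zero) suc (allFin n))))
                 (sym (sum2-map f suc (allFin n))) ⟩
  sum2 f (zero ∷ map suc (allFin n))    ≡⟨ cong (sum2 f) (allFin-suc n) ⟨
  sum2 f (allFin (suc n))               ∎
  where
  open ≡-Reasoning
  f = λ x y → bit (does (Q? (pair x y)))

countSubsets-3 : ∀ {n} {Q : Pred (Subset n) 0ℓ} (Q? : Decidable Q) → (∀ {p} → Q p → ∣ p ∣ ≡ 3) →
                 countSubsets Q? ≡ sum3 (λ x y z → bit (does (Q? (triple x y z)))) (allFin n)
countSubsets-3 {zero}  Q? card with Q? []
... | yes q = case card q of λ ()
... | no _  = refl
countSubsets-3 {suc n} Q? card = begin
  countSubsets Q?                       ≡⟨ countSubsets-suc Q? ⟩
  _                                     ≡⟨ cong₂ _+_ (countSubsets-3 (Q? ∘ (outside ∷_)) card)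
                                                     (countSubsets-2 (Q? ∘ (inside ∷_)) (suc-injective ∘ card)) ⟩
  sum3 (λ x y z → f (suc x) (suc y) (suc z)) (allFin n) + sum2 (λ x y → bit (does (Q? (inside ∷ pair x y)))) (allFin n)
    ≡⟨ +-comm (sum3 (λ x y z → f (suc x) (suc y) (suc z)) (allFin n)) _ ⟩
  sum2 (λ x y → bit (does (Q? (inside ∷ pair x y)))) (allFin n) + sum3 (λ x y z → f (suc x) (suc y) (suc z)) (allFin n)
    ≡⟨ cong₂ _+_ (trans (sum2-cong (allFin n) λ x y → does-≡ Q? (cong (inside ∷_) (sym (∪-identityˡ (pair x y)))))
                        (sym (sum2-map (f zero) suc (allFin n))))
                 (sym (sum3-map f suc (allFin n))) ⟩
  sum3 f (zero ∷ map suc (allFin n))    ≡⟨ cong (sum3 f) (allFin-suc n) ⟨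
  sum3 f (allFin (suc n))               ∎
  where
  open ≡-Reasoning
  f = λ x y z → bit (does (Q? (triple x y z)))

-- Subsets of size three.

triple-swap₁₂ : ∀ (x y z : Fin n) → triple x y z ≡ triple y x z
triple-swap₁₂ x y z = trans (sym (∪-assoc ⁅ x ⁆ ⁅ y ⁆ ⁅ z ⁆))
  (trans (cong (_∪ ⁅ z ⁆) (∪-comm ⁅ x ⁆ ⁅ y ⁆)) (∪-assoc ⁅ y ⁆ ⁅ x ⁆ ⁅ z ⁆))

triple-swap₂₃ : ∀ (x y z : Fin n) → triple x y z ≡ triple x z y
triple-swap₂₃ x y z = cong (⁅ x ⁆ ∪_) (∪-comm ⁅ y ⁆ ⁅ z ⁆)

∣insert∣ : ∀ {x : Fin n} {p} → x ∉ˢ p → ∣ ⁅ x ⁆ ∪ p ∣ ≡ suc ∣ p ∣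
∣insert∣ {x = zero}  {inside  ∷ p} x∉ = ⊥-elim (x∉ Vec.here)
∣insert∣ {x = zero}  {outside ∷ p} x∉ = cong (suc ∘ ∣_∣) (∪-identityˡ p)
∣insert∣ {x = suc x} {inside  ∷ p} x∉ = cong suc (∣insert∣ (x∉ ∘ Vec.there))
∣insert∣ {x = suc x} {outside ∷ p} x∉ = ∣insert∣ (x∉ ∘ Vec.there)

∈-triple⁻ : ∀ {x y z t : Fin n} → t ∈ˢ triple x y z → t ≡ x ⊎ t ≡ y ⊎ t ≡ z
∈-triple⁻ {x = x} {y} {z} t∈ with x∈p∪q⁻ ⁅ x ⁆ (pair y z) t∈
... | inj₁ p = inj₁ (x∈⁅y⁆⇒x≡y x p)
... | inj₂ q with x∈p∪q⁻ ⁅ y ⁆ ⁅ z ⁆ q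
... | inj₁ p = inj₂ (inj₁ (x∈⁅y⁆⇒x≡y y p))
... | inj₂ p = inj₂ (inj₂ (x∈⁅y⁆⇒x≡y z p))

∈-triple⁺ : ∀ {x y z t : Fin n} → t ≡ x ⊎ t ≡ y ⊎ t ≡ z → t ∈ˢ triple x y z
∈-triple⁺ {x = x} (inj₁ refl)        = x∈p∪q⁺ (inj₁ (x∈⁅x⁆ x))
∈-triple⁺ {y = y} (inj₂ (inj₁ refl)) = x∈p∪q⁺ (inj₂ (x∈p∪q⁺ (inj₁ (x∈⁅x⁆ y))))
∈-triple⁺ {z = z} (inj₂ (inj₂ refl)) = x∈p∪q⁺ (inj₂ (x∈p∪q⁺ (inj₂ (x∈⁅x⁆ z))))

∣triple∣ : ∀ {x y z : Fin n} → x ≢ y → x ≢ z → y ≢ z → ∣ triple x y z ∣ ≡ 3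
∣triple∣ {x = x} {y} {z} x≢y x≢z y≢z =
  trans (∣insert∣ x∉) (cong suc (trans (∣insert∣ (y≢z ∘ x∈⁅y⁆⇒x≡y z)) (cong suc (∣⁅x⁆∣≡1 z))))
  where
  x∉ : x ∉ˢ pair y z
  x∉ x∈ with x∈p∪q⁻ ⁅ y ⁆ ⁅ z ⁆ x∈
  ... | inj₁ p = x≢y (x∈⁅y⁆⇒x≡y y p)
  ... | inj₂ p = x≢z (x∈⁅y⁆⇒x≡y z p)

∣triple-repeated∣ : ∀ (x z : Fin n) → ∣ triple x x z ∣ ≢ 3
∣triple-repeated∣ x z eq with x ≟ᶠ z
... | yes refl = case trans (sym eq) (trans (cong ∣_∣ (trans (cong (⁅ x ⁆ ∪_) (∪-idem ⁅ x ⁆)) (∪-idem ⁅ x ⁆))) (∣⁅x⁆∣≡1 x)) of λ ()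
... | no x≢z = case trans (sym eq) (trans (cong ∣_∣ (trans (sym (∪-assoc ⁅ x ⁆ ⁅ x ⁆ ⁅ z ⁆)) (cong (_∪ ⁅ z ⁆) (∪-idem ⁅ x ⁆))))
                     (trans (∣insert∣ (x≢z ∘ x∈⁅y⁆⇒x≡y z)) (cong suc (∣⁅x⁆∣≡1 z)))) of λ ()

private
  as-empty : ∀ (p : Subset n) → ∣ p ∣ ≡ 0 → p ≡ ∅
  as-empty []            _  = refl
  as-empty (outside ∷ p) eq = cong (outside ∷_) (as-empty p eq)

  as-singleton : ∀ (p : Subset n) → ∣ p ∣ ≡ 1 → ∃[ x ] p ≡ ⁅ x ⁆
  as-singleton (inside  ∷ p) eq = zero , cong (inside ∷_) (as-empty p (suc-injective eq))
  as-singleton (outside ∷ p) eq = let x , e = as-singleton p eq in suc x , cong (outside ∷_) e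

  as-pair : ∀ (p : Subset n) → ∣ p ∣ ≡ 2 → ∃[ x ] ∃[ y ] p ≡ pair x y
  as-pair (inside  ∷ p) eq = let y , e = as-singleton p (suc-injective eq)
                             in zero , suc y , cong (inside ∷_) (trans e (sym (∪-identityˡ ⁅ y ⁆)))
  as-pair (outside ∷ p) eq = let x , y , e = as-pair p eq in suc x , suc y , cong (outside ∷_) e

as-triple : ∀ (p : Subset n) → ∣ p ∣ ≡ 3 → ∃[ x ] ∃[ y ] ∃[ z ] p ≡ triple x y z
as-triple (inside  ∷ p) eq = let y , z , e = as-pair p (suc-injective eq)
                             in zero , suc y , suc z , cong (inside ∷_) (trans e (sym (∪-identityˡ (pair y z))))
as-triple (outside ∷ p) eq = let x , y , z , e = as-triple p eq in suc x , suc y , suc z , cong (outside ∷_) e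

∈-image⁻ : ∀ (f : Fin m → Fin n) e {y} → y ∈ˢ image f e → ∃[ x ] x ∈ˢ e × f x ≡ y
∈-image⁻ f e {y} y∈ with any? (λ x → (x ∈ˢ? e) ×-dec (f x ≟ᶠ y)) in eq
... | yes w = w
... | no _  = case trans (sym ([]=⇒lookup y∈)) (trans (lookup∘tabulate _ y) (cong does eq)) of λ ()

∈-image⁺ : ∀ (f : Fin m → Fin n) e {x} → x ∈ˢ e → f x ∈ˢ image f e
∈-image⁺ f e {x} x∈ = lookup⇒[]= (f x) _ (trans (lookup∘tabulate _ (f x)) (dec-true (any? λ x′ → (x′ ∈ˢ? e) ×-dec (f x′ ≟ᶠ f x)) (x , x∈ , refl)))

image-triple : ∀ (f : Fin m → Fin n) x y z → image f (triple x y z) ≡ triple (f x) (f y) (f z)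
image-triple f x y z = ⊆-antisym to from
  where
  to : image f (triple x y z) ⊆ˢ triple (f x) (f y) (f z)
  to t∈ with ∈-image⁻ f (triple x y z) t∈
  ... | u , u∈ , refl with ∈-triple⁻ u∈
  ... | inj₁ refl        = ∈-triple⁺ (inj₁ refl)
  ... | inj₂ (inj₁ refl) = ∈-triple⁺ (inj₂ (inj₁ refl))
  ... | inj₂ (inj₂ refl) = ∈-triple⁺ (inj₂ (inj₂ refl))
  from : triple (f x) (f y) (f z) ⊆ˢ image f (triple x y z)
  from t∈ with ∈-triple⁻ {x = f x} {f y} {f z} t∈
  ... | inj₁ refl        = ∈-image⁺ f (triple x y z) (∈-triple⁺ (inj₁ refl))
  ... | inj₂ (inj₁ refl) = ∈-image⁺ f (triple x y z) (∈-triple⁺ (inj₂ (inj₁ refl)))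
  ... | inj₂ (inj₂ refl) = ∈-image⁺ f (triple x y z) (∈-triple⁺ (inj₂ (inj₂ refl)))

image-inverse : ∀ (f : Fin m → Fin n) (g : Fin n → Fin m) → (∀ x → g (f x) ≡ x) → ∀ e → image g (image f e) ≡ e
image-inverse f g inv e = ⊆-antisym to from
  where
  to : image g (image f e) ⊆ˢ e
  to t∈ with ∈-image⁻ g (image f e) t∈
  ... | y , y∈ , refl with ∈-image⁻ f e y∈
  ... | x , x∈ , refl = subst (_∈ˢ e) (sym (inv x)) x∈
  from : e ⊆ˢ image g (image f e)
  from {x} x∈ = subst (_∈ˢ image g (image f e)) (inv x) (∈-image⁺ g (image f e) (∈-image⁺ f e x∈))

toGraph : Graph³ n → 3Graph (Fin n)
toGraph H = record
  { edge   = λ x y z → does (edge? H (triple x y z))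
  ; symm   = record { swap12 = λ x y z → cong (does ∘ edge? H) (triple-swap₁₂ x y z)
                    ; swap23 = λ x y z → cong (does ∘ edge? H) (triple-swap₂₃ x y z) }
  ; irrefl = λ x y → dec-false (edge? H (triple x x y)) (∣triple-repeated∣ x y ∘ uniform H)
  }

module _ (H : Graph³ n) where
  open 3Graph (toGraph H)

  Adj⁺ : ∀ {x y z} → Edge H (triple x y z) → Adj x y z
  Adj⁺ {x} {y} {z} e = dec-true (edge? H (triple x y z)) e

  Adj⁻ : ∀ {x y z} → Adj x y z → Edge H (triple x y z)
  Adj⁻ {x} {y} {z} a with edge? H (triple x y z)
  ... | yes e = e

  size-count : size H ≡ count (allFin n)
  size-count = countSubsets-3 (edge? H) (uniform H)

  Contains⁺ : ∀ {K} (v : Vec (Fin n) m) → Unique (toList v) → Vertices.Present (toGraph H) v K →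
              (G : Graph³ m) → (∀ {e} → Edge G e → ∃[ t ] t ∈ K × e ≡ triple (proj₁ t) (proj₁ (proj₂ t)) (proj₂ (proj₂ t))) →
              H Contains G
  Contains⁺ v u K✓ G edges = lookup v , lookup-inj {v = v} u , λ e → place (edges e)
    where
    place : ∀ {e} → ∃[ t ] t ∈ _ × e ≡ triple (proj₁ t) (proj₁ (proj₂ t)) (proj₂ (proj₂ t)) → Edge H (image (lookup v) e)
    place ((i , j , k) , t∈ , refl) = subst (Edge H) (sym (image-triple (lookup v) i j k)) (Adj⁻ (All.lookup K✓ t∈))

  module _ (free : ¬ (H Contains P)) where
    P-free⁺ : PathFree
    P-free⁺ {a} {b} {c} {d} {e} {f} {g} u x y z =
      free (Contains⁺ {K = (0F , 1F , 2F) ∷ (2F , 3F , 4F) ∷ (4F , 5F , 6F) ∷ []} (a ∷ b ∷ c ∷ d ∷ e ∷ f ∷ g ∷ []) u (x ∷ y ∷ z ∷ []) P λ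
        { (here refl) → _ , here refl , refl ; (there (here refl)) → _ , there (here refl) , refl
        ; (there (there (here refl))) → _ , there (there (here refl)) , refl })

  P-free⁻ : PathFree → ¬ (H Contains P)
  P-free⁻ pf (f , inj , edges) = pf (Uniqueₚ.map⁺ inj (Uniqueₚ.allFin⁺ 7))
    (at 0F 1F 2F (here refl)) (at 2F 3F 4F (there (here refl))) (at 4F 5F 6F (there (there (here refl))))
    where
    at : ∀ i j k → Edge P (triple i j k) → Adj (f i) (f j) (f k)
    at i j k e = Adj⁺ (subst (Edge H) (image-triple f i j k) (edges e))

  M⁺ : H Contains M → Vertices.Occurs (toGraph H) {6} disjoint (allFin n)
  M⁺ (f , inj , edges) = Vec.map f (Vec.allFin 6) , Uniqueₚ.map⁺ inj (Uniqueₚ.allFin⁺ 6) , All.tabulate (λ {x} _ → ∈-allFin x) ,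
    at 0F 1F 2F (here refl) ∷ at 3F 4F 5F (there (here refl)) ∷ []
    where
    at : ∀ i j k → Edge M (triple i j k) → Adj (f i) (f j) (f k)
    at i j k e = Adj⁺ (subst (Edge H) (image-triple f i j k) (edges e))

  M⁻ : Vertices.Occurs (toGraph H) {6} disjoint (allFin n) → H Contains M
  M⁻ (v , u , _ , K✓) = Contains⁺ v u K✓ M λ
    { (here refl) → _ , here refl , refl ; (there (here refl)) → _ , there (here refl) , refl }

-- Equality of counts forces equality of edges.

length-allFin : ∀ n → length (allFin n) ≡ n
length-allFin n = length-tabulate id

complete-↭ : ∀ {xs : List (Fin n)} → Unique xs → (∀ x → x ∈ xs) → xs ↭ allFin n
complete-↭ {n} {xs} u all with split-off u (All.tabulate λ {x} _ → ∈-allFin x)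
... | []    , p = ↭-sym (subst (allFin n ↭_) (++-identityʳᴸ xs) p)
... | w ∷ W , p = ⊥-elim (Unique-++-disjoint xs (Unique-↭ p (Uniqueₚ.allFin⁺ n)) (all w) (here refl))

-- A single strict inequality, moved to the front of the list as its first summand, would make the
-- whole sum strictly smaller.
sum3-tight : ∀ {A : Set} {f g : A → A → A → ℕ} {xs} → Sym3 f → Sym3 g → Unique xs →
             (∀ {x y z} → x ∈ xs → y ∈ xs → z ∈ xs → x ≢ y → x ≢ z → y ≢ z → f x y z ≤ g x y z) →
             sum3 g xs ≤ sum3 f xs →
             ∀ {x y z} → x ∈ xs → y ∈ xs → z ∈ xs → x ≢ y → x ≢ z → y ≢ z → g x y z ≤ f x y z
sum3-tight {f = f} {g} {xs} sf sg u f≤g tight {x} {y} {z} x∈ y∈ z∈ x≢y x≢z y≢z =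
  ≮⇒≥ λ lt → <⇒≱ (strict lt (split-off {xs = x ∷ y ∷ z ∷ []} ((x≢y ∷ x≢z ∷ []) ∷ (y≢z ∷ []) ∷ [] ∷ []) (x∈ ∷ y∈ ∷ z∈ ∷ []))) tight
  where
  strict : f x y z < g x y z → ∃[ ys ] xs ↭ x ∷ y ∷ z ∷ ys → sum3 f xs < sum3 g xs
  strict lt (ys , p) = subst₂ _<_ (sym (sum3-↭ sf p)) (sym (sum3-↭ sg p)) (go (Unique-↭ p u))
    where
    le : ∀ {a b c} → a ∈ x ∷ y ∷ z ∷ ys → b ∈ x ∷ y ∷ z ∷ ys → c ∈ x ∷ y ∷ z ∷ ys → a ≢ b → a ≢ c → b ≢ c → f a b c ≤ g a b c
    le a∈ b∈ c∈ = f≤g (∈-resp-↭ (↭-sym p) a∈) (∈-resp-↭ (↭-sym p) b∈) (∈-resp-↭ (↭-sym p) c∈)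
    go : Unique (x ∷ y ∷ z ∷ ys) → sum3 f (x ∷ y ∷ z ∷ ys) < sum3 g (x ∷ y ∷ z ∷ ys)
    go ((_ ∷ _ ∷ x∉) ∷ (_ ∷ y∉) ∷ uz@(_ ∷ _)) =
      +-mono-<-≤ (+-mono-<-≤
        (+-mono-<-≤ lt (sum1-mono ys λ c∈ → le (here refl) (there (here refl)) (there (there (there c∈))) x≢y (All.lookup x∉ c∈) (All.lookup y∉ c∈)))
        (sum2-mono uz λ b∈ c∈ b≢c → le (here refl) (there (there b∈)) (there (there c∈)) (x≢ b∈) (x≢ c∈) b≢c))
        (sum3-mono {xs = y ∷ z ∷ ys} ((y≢z ∷ y∉) ∷ uz) λ a∈ b∈ c∈ → le (there a∈) (there b∈) (there c∈))
      where
      x≢ : ∀ {b} → b ∈ z ∷ ys → x ≢ b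
      x≢ (here refl) = x≢z
      x≢ (there b∈)  = All.lookup x∉ b∈

private
  bit-≤⇒ : ∀ {b c} → (b ≡ true → c ≡ true) → bit b ≤ bit c
  bit-≤⇒ {true}  h rewrite h refl = ≤-refl
  bit-≤⇒ {false} h = z≤n

  bit-antisym : ∀ {b c} → bit b ≤ bit c → bit c ≤ bit b → b ≡ c
  bit-antisym {true}  {true}  _ _ = refl
  bit-antisym {false} {false} _ _ = refl
  bit-antisym {true}  {false} () _
  bit-antisym {false} {true}  _ ()

module G {n} (H : Graph³ n) = 3Graph (toGraph H)

-- Isomorphisms.

module _ {m n} {H : Graph³ n} {G : Graph³ m} (iso : H ≅ G) where
  private
    σ : Permutation n m
    σ = proj₁ iso

    to : Fin n → Fin m
    to = σ ⟨$⟩ʳ_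

    to-inj : ∀ {x y} → to x ≡ to y → x ≡ y
    to-inj {x} {y} eq = trans (sym (inverseˡ σ)) (trans (cong (σ ⟨$⟩ˡ_) eq) (inverseˡ σ))

  edge-≅ : ∀ x y z → G.edge H x y z ≡ G.edge G (to x) (to y) (to z)
  edge-≅ x y z = does-⇔ (subst (λ e → Edge H (triple x y z) ⇔ Edge G e) (image-triple to x y z) (proj₂ iso (triple x y z)))
                        (edge? H (triple x y z)) (edge? G (triple (to x) (to y) (to z)))

  size-≅ : size H ≡ size G
  size-≅ = begin
    size H                                                   ≡⟨ size-count H ⟩
    G.count H (allFin n)                                     ≡⟨ sum3-cong (allFin n) (λ x y z → cong bit (edge-≅ x y z)) ⟩
    sum3 (λ x y z → G.wt G (to x) (to y) (to z)) (allFin n)  ≡⟨ sum3-map (G.wt G) to (allFin n) ⟨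
    G.count G (map to (allFin n))                            ≡⟨ sum3-↭ (G.wt-sym G) (complete-↭ (Uniqueₚ.map⁺ to-inj (Uniqueₚ.allFin⁺ n))
                                                                 λ y → subst (_∈ map to (allFin n)) (inverseʳ σ) (∈-map⁺ to (∈-allFin (σ ⟨$⟩ˡ y)))) ⟩
    G.count G (allFin m)                                     ≡⟨ size-count G ⟨
    size G                                                   ∎
    where open ≡-Reasoning

  pathFree-≅ : G.PathFree G → G.PathFree H
  pathFree-≅ pf u x y z = pf (Uniqueₚ.map⁺ to-inj u) (move x) (move y) (move z)
    where
    move : ∀ {x y z} → G.Adj H x y z → G.Adj G (to x) (to y) (to z)
    move {x} {y} {z} a = trans (sym (edge-≅ x y z)) a

  occurs-≅ : ∀ {k} {K : List (Triple (Fin k))} → Vertices.Occurs (toGraph G) K (allFin m) → Vertices.Occurs (toGraph H) K (allFin n)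
  occurs-≅ (v , u , _ , K✓) = Vec.map from v , subst Unique (sym (toList-map from v)) (Uniqueₚ.map⁺ from-inj u)
                            , All.tabulate (λ {x} _ → ∈-allFin x) , All.map move K✓
    where
    from : Fin m → Fin n
    from = σ ⟨$⟩ˡ_
    from-inj : ∀ {x y} → from x ≡ from y → x ≡ y
    from-inj {x} {y} eq = trans (sym (inverseʳ σ)) (trans (cong to eq) (inverseʳ σ))
    to-lookup : ∀ i → to (lookup (Vec.map from v) i) ≡ lookup v i
    to-lookup i = trans (cong to (lookup-map i from v)) (inverseʳ σ)
    move : ∀ {t} → 3Graph.valueAt (toGraph G) v t ≡ true → 3Graph.valueAt (toGraph H) (Vec.map from v) t ≡ true
    move {i , j , k} a = trans (edge-≅ _ _ _) (trans (cong₂ (λ x (y , z) → G.edge G x y z) (to-lookup i) (cong₂ _,_ (to-lookup j) (to-lookup k))) a)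

module _ {m n} (H : Graph³ n) (G : Graph³ m) where
  open G H using () renaming (Adj to Adjᴴ; wt to wtᴴ)
  open G G using () renaming (Adj to Adjᴳ; wt to wtᴳ)

  SubGraph : Vec (Fin n) m → Set
  SubGraph v = ∀ i j k → i ≢ j → i ≢ k → j ≢ k → Adjᴴ (lookup v i) (lookup v j) (lookup v k) → Adjᴳ i j k

  ≅-from-labelling : (v : Vec (Fin n) m) → Unique (toList v) → (∀ x → ∃[ i ] lookup v i ≡ x) →
                     (∀ i j k → i ≢ j → i ≢ k → j ≢ k → G.edge H (lookup v i) (lookup v j) (lookup v k) ≡ G.edge G i j k) → H ≅ G
  ≅-from-labelling v u index same = σ , λ e → mk⇔ (there′ e) (back e)
    where
    ix : Fin n → Fin m
    ix x = proj₁ (index x)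
    v-ix : ∀ x → lookup v (ix x) ≡ x
    v-ix x = proj₂ (index x)
    ix-v : ∀ i → ix (lookup v i) ≡ i
    ix-v i = lookup-inj {v = v} u (v-ix (lookup v i))
    ix-inj : ∀ {x y} → x ≢ y → ix x ≢ ix y
    ix-inj x≢y eq = x≢y (trans (sym (v-ix _)) (trans (cong (lookup v) eq) (v-ix _)))
    σ : Permutation n m
    σ = permutation ix (lookup v) ix-v v-ix
    there′ : ∀ e → Edge H e → Edge G (image ix e)
    there′ e h with as-triple e (uniform H h)
    ... | x , y , z , refl = subst (Edge G) (sym (image-triple ix x y z)) (Adj⁻ G
            (trans (sym (same (ix x) (ix y) (ix z) (ix-inj x≢y) (ix-inj x≢z) (ix-inj y≢z)))
                   (trans (cong₂ (λ x (y , z) → G.edge H x y z) (v-ix x) (cong₂ _,_ (v-ix y) (v-ix z))) (Adj⁺ H h))))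
      where
      d : x ≢ y × x ≢ z × y ≢ z
      d = G.edge-distinct H (Adj⁺ H h)
      x≢y = proj₁ d
      x≢z = proj₁ (proj₂ d)
      y≢z = proj₂ (proj₂ d)
    back : ∀ e → Edge G (image ix e) → Edge H e
    back e g with as-triple (image ix e) (uniform G g)
    ... | i , j , k , eq = subst (Edge H)
            (trans (sym (image-triple (lookup v) i j k)) (trans (cong (image (lookup v)) (sym eq)) (image-inverse ix (lookup v) v-ix e)))
            (Adj⁻ H (trans (same i j k (proj₁ d) (proj₁ (proj₂ d)) (proj₂ (proj₂ d))) a))
      where
      a : Adjᴳ i j k
      a = Adj⁺ G (subst (Edge G) eq g)
      d : i ≢ j × i ≢ k × j ≢ k
      d = G.edge-distinct G a

  -- The labelling sends edges of `H` to edges of `G`, and `H` has no fewer, so `sum3-tight` leaves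
  -- no triple on which they differ.
  ≅-from-subgraph : (v : Vec (Fin n) m) → toList v ↭ allFin n → SubGraph v → size G ≤ size H → H ≅ G
  ≅-from-subgraph v p sub le = ≅-from-labelling v uv index λ i j k i≢j i≢k j≢k →
    bit-antisym (pulled-≤ i≢j i≢k j≢k)
      (sum3-tight pulled-sym (G.wt-sym G) (Uniqueₚ.allFin⁺ m) (λ _ _ _ → pulled-≤) counts (∈-allFin i) (∈-allFin j) (∈-allFin k) i≢j i≢k j≢k)
    where
    uv : Unique (toList v)
    uv = Unique-↭ (↭-sym p) (Uniqueₚ.allFin⁺ n)
    index : ∀ x → ∃[ i ] lookup v i ≡ x
    index x = lookup-index {v = v} (∈-resp-↭ (↭-sym p) (∈-allFin x))
    pulled : Fin m → Fin m → Fin m → ℕ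
    pulled i j k = wtᴴ (lookup v i) (lookup v j) (lookup v k)
    pulled-sym : Sym3 pulled
    pulled-sym = record { swap12 = λ i j k → swap12 (G.wt-sym H) (lookup v i) (lookup v j) (lookup v k)
                        ; swap23 = λ i j k → swap23 (G.wt-sym H) (lookup v i) (lookup v j) (lookup v k) }
    pulled-≤ : ∀ {i j k} → i ≢ j → i ≢ k → j ≢ k → pulled i j k ≤ wtᴳ i j k
    pulled-≤ i≢j i≢k j≢k = bit-≤⇒ (sub _ _ _ i≢j i≢k j≢k)
    counts : sum3 wtᴳ (allFin m) ≤ sum3 pulled (allFin m)
    counts = begin
      G.count G (allFin m)                 ≡⟨ size-count G ⟨
      size G                               ≤⟨ le ⟩
      size H                               ≡⟨ size-count H ⟩
      G.count H (allFin n)                 ≡⟨ sum3-↭ (G.wt-sym H) p ⟨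
      G.count H (toList v)                 ≡⟨ cong (G.count H) (toList-lookup v) ⟩
      G.count H (map (lookup v) (allFin m)) ≡⟨ sum3-map wtᴴ (lookup v) (allFin m) ⟩
      sum3 pulled (allFin m)               ∎
      where open ≤-Reasoning

-- Disjoint unions.

private
  ⁅↑ˡ⁆ : ∀ {m} k (i : Fin m) → ⁅ i ↑ˡ k ⁆ ≡ ⁅ i ⁆ Vec.++ ∅ {k}
  ⁅↑ˡ⁆ {suc m} k zero    = cong (inside ∷_) (∅-++ m k)
    where
    ∅-++ : ∀ m k → ∅ {m + k} ≡ ∅ {m} Vec.++ ∅ {k}
    ∅-++ zero    k = refl
    ∅-++ (suc m) k = cong (outside ∷_) (∅-++ m k)
  ⁅↑ˡ⁆ {suc m} k (suc i) = cong (outside ∷_) (⁅↑ˡ⁆ k i)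

  ⁅↑ʳ⁆ : ∀ m {k} (i : Fin k) → ⁅ m ↑ʳ i ⁆ ≡ ∅ {m} Vec.++ ⁅ i ⁆
  ⁅↑ʳ⁆ zero    i = refl
  ⁅↑ʳ⁆ (suc m) i = cong (outside ∷_) (⁅↑ʳ⁆ m i)

  ∪-++ : ∀ {m k} (p p′ : Subset m) (q q′ : Subset k) → (p Vec.++ q) ∪ (p′ Vec.++ q′) ≡ (p ∪ p′) Vec.++ (q ∪ q′)
  ∪-++ p p′ q q′ = zipWith-++ _ p q p′ q′

  ∈-++ˢˡ : ∀ {m k} (p : Subset m) (q : Subset k) {i} → (i ↑ˡ k) ∈ˢ p Vec.++ q → i ∈ˢ p
  ∈-++ˢˡ p q {i} i∈ = lookup⇒[]= i p (trans (sym (lookup-++ˡ p q i)) ([]=⇒lookup i∈))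

  ∈-++ˢʳ : ∀ {m k} (p : Subset m) (q : Subset k) {i} → (m ↑ʳ i) ∈ˢ p Vec.++ q → i ∈ˢ q
  ∈-++ˢʳ p q {i} i∈ = lookup⇒[]= i q (trans (sym (lookup-++ʳ p q i)) ([]=⇒lookup i∈))

  ∈-++ˢˡ⁺ : ∀ {m k} (p : Subset m) (q : Subset k) {i} → i ∈ˢ p → (i ↑ˡ k) ∈ˢ p Vec.++ q
  ∈-++ˢˡ⁺ {k = k} p q {i} i∈ = lookup⇒[]= (i ↑ˡ k) _ (trans (lookup-++ˡ p q i) ([]=⇒lookup i∈))

  ∈-++ˢʳ⁺ : ∀ {m k} (p : Subset m) (q : Subset k) {i} → i ∈ˢ q → (m ↑ʳ i) ∈ˢ p Vec.++ q
  ∈-++ˢʳ⁺ {m} p q {i} i∈ = lookup⇒[]= (m ↑ʳ i) _ (trans (lookup-++ʳ p q i) ([]=⇒lookup i∈))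

  triple-↑ˡ : ∀ {m} k (i j l : Fin m) → triple (i ↑ˡ k) (j ↑ˡ k) (l ↑ˡ k) ≡ triple i j l Vec.++ ∅ {k}
  triple-↑ˡ k i j l rewrite ⁅↑ˡ⁆ k i | ⁅↑ˡ⁆ k j | ⁅↑ˡ⁆ k l =
    trans (cong ((⁅ i ⁆ Vec.++ ∅) ∪_) (∪-++ ⁅ j ⁆ ⁅ l ⁆ ∅ ∅))
          (trans (∪-++ ⁅ i ⁆ _ ∅ _) (cong (triple i j l Vec.++_) (trans (cong (∅ ∪_) (∪-identityˡ ∅)) (∪-identityˡ ∅))))

  triple-↑ʳ : ∀ m {k} (i j l : Fin k) → triple (m ↑ʳ i) (m ↑ʳ j) (m ↑ʳ l) ≡ ∅ {m} Vec.++ triple i j l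
  triple-↑ʳ m i j l rewrite ⁅↑ʳ⁆ m i | ⁅↑ʳ⁆ m j | ⁅↑ʳ⁆ m l =
    trans (cong ((∅ Vec.++ ⁅ i ⁆) ∪_) (∪-++ ∅ ∅ ⁅ j ⁆ ⁅ l ⁆))
          (trans (∪-++ ∅ _ ⁅ i ⁆ _) (cong (Vec._++ triple i j l) (trans (cong (∅ ∪_) (∪-identityˡ ∅)) (∪-identityˡ ∅))))

  take-drop-++ : ∀ {m k} (p : Subset m) (q : Subset k) → Vec.take m (p Vec.++ q) ≡ p × Vec.drop m (p Vec.++ q) ≡ q
  take-drop-++ {m} p q = ++-injective (Vec.take m (p Vec.++ q)) p (take++drop≡id m (p Vec.++ q))

  side : ∀ m {k} (x : Fin (m + k)) → (∃[ i ] i ↑ˡ k ≡ x) ⊎ (∃[ j ] m ↑ʳ j ≡ x)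
  side zero    x       = inj₂ (x , refl)
  side (suc m) zero    = inj₁ (zero , refl)
  side (suc m) (suc x) with side m x
  ... | inj₁ (i , refl) = inj₁ (suc i , refl)
  ... | inj₂ (j , refl) = inj₂ (j , refl)

  ↑ˡ≢↑ʳ : ∀ {m k} {i : Fin m} {j : Fin k} → i ↑ˡ k ≢ m ↑ʳ j
  ↑ˡ≢↑ʳ {suc m} {i = suc i} eq = ↑ˡ≢↑ʳ {m} {i = i} (Finₚ.suc-injective eq)

  allFin-+ : ∀ m k → allFin (m + k) ≡ map (_↑ˡ k) (allFin m) ++ map (m ↑ʳ_) (allFin k)
  allFin-+ m k = trans (tabulate-+ m id)
    (sym (cong₂ _++_ (map-tabulate id (_↑ˡ k)) (map-tabulate id (m ↑ʳ_))))
    where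
    tabulate-+ : ∀ m {k} {A : Set} (f : Fin (m + k) → A) → tabulate f ≡ tabulate (λ i → f (i ↑ˡ k)) ++ tabulate (λ j → f (m ↑ʳ j))
    tabulate-+ zero    f = refl
    tabulate-+ (suc m) f = cong (f zero ∷_) (tabulate-+ m (f ∘ suc))

module Union {m k} (G₁ : Graph³ m) (G₂ : Graph³ k) where
  open G (G₁ ∪ᴳ G₂) hiding (edge)

  edge-left : ∀ i j l → G.edge (G₁ ∪ᴳ G₂) (i ↑ˡ k) (j ↑ˡ k) (l ↑ˡ k) ≡ G.edge G₁ i j l
  edge-left i j l = does-⇔ (mk⇔ to from) (edge? (G₁ ∪ᴳ G₂) _) (edge? G₁ (triple i j l))
    where
    td : Vec.take m (triple (i ↑ˡ k) (j ↑ˡ k) (l ↑ˡ k)) ≡ triple i j l × Vec.drop m (triple (i ↑ˡ k) (j ↑ˡ k) (l ↑ˡ k)) ≡ ∅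
    td rewrite triple-↑ˡ k i j l = take-drop-++ (triple i j l) ∅
    to : Edge (G₁ ∪ᴳ G₂) (triple (i ↑ˡ k) (j ↑ˡ k) (l ↑ˡ k)) → Edge G₁ (triple i j l)
    to (inj₁ (e , _)) = subst (Edge G₁) (proj₁ td) e
    to (inj₂ (_ , e)) = case trans (sym (uniform G₂ e)) (trans (cong ∣_∣ (proj₂ td)) (∣⊥∣≡0 k)) of λ ()
    from : Edge G₁ (triple i j l) → Edge (G₁ ∪ᴳ G₂) (triple (i ↑ˡ k) (j ↑ˡ k) (l ↑ˡ k))
    from e = inj₁ (subst (Edge G₁) (sym (proj₁ td)) e , proj₂ td)

  edge-right : ∀ i j l → G.edge (G₁ ∪ᴳ G₂) (m ↑ʳ i) (m ↑ʳ j) (m ↑ʳ l) ≡ G.edge G₂ i j l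
  edge-right i j l = does-⇔ (mk⇔ to from) (edge? (G₁ ∪ᴳ G₂) _) (edge? G₂ (triple i j l))
    where
    td : Vec.take m (triple (m ↑ʳ i) (m ↑ʳ j) (m ↑ʳ l)) ≡ ∅ × Vec.drop m (triple (m ↑ʳ i) (m ↑ʳ j) (m ↑ʳ l)) ≡ triple i j l
    td rewrite triple-↑ʳ m i j l = take-drop-++ ∅ (triple i j l)
    to : Edge (G₁ ∪ᴳ G₂) (triple (m ↑ʳ i) (m ↑ʳ j) (m ↑ʳ l)) → Edge G₂ (triple i j l)
    to (inj₂ (_ , e)) = subst (Edge G₂) (proj₂ td) e
    to (inj₁ (e , _)) = case trans (sym (uniform G₁ e)) (trans (cong ∣_∣ (proj₁ td)) (∣⊥∣≡0 m)) of λ ()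
    from : Edge G₂ (triple i j l) → Edge (G₁ ∪ᴳ G₂) (triple (m ↑ʳ i) (m ↑ʳ j) (m ↑ʳ l))
    from e = inj₂ (proj₁ td , subst (Edge G₂) (sym (proj₂ td)) e)

  not-mixed : ∀ {i j y} → ¬ Adj (i ↑ˡ k) (m ↑ʳ j) y
  not-mixed {i} {j} {y} a = absurd (Adj⁻ (G₁ ∪ᴳ G₂) a)
    where
    e = triple (i ↑ˡ k) (m ↑ʳ j) y
    parts : Vec.take m e Vec.++ Vec.drop m e ≡ e
    parts = take++drop≡id m e
    i∈ : i ∈ˢ Vec.take m e
    i∈ = ∈-++ˢˡ (Vec.take m e) (Vec.drop m e) (subst ((i ↑ˡ k) ∈ˢ_) (sym parts) (∈-triple⁺ (inj₁ refl)))
    j∈ : j ∈ˢ Vec.drop m e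
    j∈ = ∈-++ˢʳ (Vec.take m e) (Vec.drop m e) (subst ((m ↑ʳ j) ∈ˢ_) (sym parts) (∈-triple⁺ (inj₂ (inj₁ refl))))
    absurd : ¬ Edge (G₁ ∪ᴳ G₂) e
    absurd (inj₁ (_ , d≡∅)) = ∉⊥ (subst (j ∈ˢ_) d≡∅ j∈)
    absurd (inj₂ (t≡∅ , _)) = ∉⊥ (subst (i ∈ˢ_) t≡∅ i∈)

  data Side : Fin (m + k) → Fin (m + k) → Fin (m + k) → Set where
    left  : ∀ {i j l} → G.Adj G₁ i j l → Side (i ↑ˡ k) (j ↑ˡ k) (l ↑ˡ k)
    right : ∀ {i j l} → G.Adj G₂ i j l → Side (m ↑ʳ i) (m ↑ʳ j) (m ↑ʳ l)

  sides : ∀ {x y z} → Adj x y z → Side x y z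
  sides {x} {y} {z} a with side m x | side m y | side m z
  ... | inj₁ (i , refl) | inj₁ (j , refl) | inj₁ (l , refl) = left (trans (sym (edge-left i j l)) a)
  ... | inj₂ (i , refl) | inj₂ (j , refl) | inj₂ (l , refl) = right (trans (sym (edge-right i j l)) a)
  ... | inj₁ (_ , refl) | inj₂ (_ , refl) | _               = ⊥-elim (not-mixed a)
  ... | inj₂ (_ , refl) | inj₁ (_ , refl) | _               = ⊥-elim (not-mixed (flip₁ a))
  ... | inj₁ (_ , refl) | inj₁ (_ , refl) | inj₂ (_ , refl) = ⊥-elim (not-mixed (flip₂ a))
  ... | inj₂ (_ , refl) | inj₂ (_ , refl) | inj₁ (_ , refl) = ⊥-elim (not-mixed (flip₁ (flip₂ a)))

  pathFree : G.PathFree G₁ → G.PathFree G₂ → PathFree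
  pathFree pf₁ pf₂ u x y z = go u (sides x) (sides y) (sides z) refl refl
    where
    -- The joints get separate indices with equations between them, because vertices of the forms
    -- `i ↑ˡ k` and `m ↑ʳ j` cannot be unified by matching on two `Side` proofs with a common index.
    go : ∀ {a b c c′ d e e′ f g} → Unique (a ∷ b ∷ c ∷ d ∷ e ∷ f ∷ g ∷ []) → Side a b c → Side c′ d e → Side e′ f g →
         c ≡ c′ → e ≡ e′ → ⊥
    go u (left x)  (right y) z         p q = ↑ˡ≢↑ʳ p
    go u (right x) (left y)  z         p q = ↑ˡ≢↑ʳ (sym p)
    go u (left x)  (left y)  (right z) p q = ↑ˡ≢↑ʳ q
    go u (right x) (right y) (left z)  p q = ↑ˡ≢↑ʳ (sym q)
    go u (left {a} {b} {c} x) (left {c′} {d} {e} y) (left {e′} {f} {g} z) p q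
      with Finₚ.↑ˡ-injective k c c′ p | Finₚ.↑ˡ-injective k e e′ q
    ... | refl | refl = pf₁ {a} {b} {c} {d} {e} {f} {g} (Uniqueₚ.map⁻ {f = _↑ˡ k} u) x y z
    go u (right {a} {b} {c} x) (right {c′} {d} {e} y) (right {e′} {f} {g} z) p q
      with Finₚ.↑ʳ-injective m c c′ p | Finₚ.↑ʳ-injective m e e′ q
    ... | refl | refl = pf₂ {a} {b} {c} {d} {e} {f} {g} (Uniqueₚ.map⁻ {f = m ↑ʳ_} u) x y z

  size-∪ : size (G₁ ∪ᴳ G₂) ≡ size G₁ + size G₂
  size-∪ = begin
    size (G₁ ∪ᴳ G₂)            ≡⟨ size-count (G₁ ∪ᴳ G₂) ⟩
    count (allFin (m + k))     ≡⟨ count-closed (toGraph (G₁ ∪ᴳ G₂)) (Uniqueₚ.allFin⁺ (m + k))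
                                    (subst (allFin (m + k) ↭_) (allFin-+ m k) ↭-refl) closed ⟩
    count (map (_↑ˡ k) (allFin m)) + count (map (m ↑ʳ_) (allFin k))
      ≡⟨ cong₂ _+_ (trans (sum3-map wt (_↑ˡ k) (allFin m)) (sum3-cong (allFin m) λ i j l → cong bit (edge-left i j l)))
                   (trans (sum3-map wt (m ↑ʳ_) (allFin k)) (sum3-cong (allFin k) λ i j l → cong bit (edge-right i j l))) ⟩
    G.count G₁ (allFin m) + G.count G₂ (allFin k) ≡⟨ cong₂ _+_ (size-count G₁) (size-count G₂) ⟨
    size G₁ + size G₂          ∎
    where
    open ≡-Reasoning
    closed : ∀ {x w y} → x ∈ map (_↑ˡ k) (allFin m) → w ∈ map (m ↑ʳ_) (allFin k) → y ∈ allFin (m + k) → ¬ Adj x w y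
    closed x∈ w∈ _ with ∈-map⁻ (_↑ˡ k) x∈ | ∈-map⁻ (m ↑ʳ_) w∈
    ... | _ , _ , refl | _ , _ , refl = not-mixed

  occurs-left : ∀ {l} {K : List (Triple (Fin l))} → Vertices.Occurs (toGraph G₁) K (allFin m) →
                Vertices.Occurs (toGraph (G₁ ∪ᴳ G₂)) K (allFin (m + k))
  occurs-left (v , u , _ , K✓) = Vec.map (_↑ˡ k) v , subst Unique (sym (toList-map (_↑ˡ k) v)) (Uniqueₚ.map⁺ (Finₚ.↑ˡ-injective k _ _) u)
    , All.tabulate (λ {x} _ → ∈-allFin x) , All.map move K✓
    where
    move : ∀ {t} → 3Graph.valueAt (toGraph G₁) v t ≡ true → valueAt (Vec.map (_↑ˡ k) v) t ≡ true
    move {i , j , l} a = trans (cong₂ (λ x (y , z) → G.edge (G₁ ∪ᴳ G₂) x y z) (lookup-map i (_↑ˡ k) v)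
      (cong₂ _,_ (lookup-map j (_↑ˡ k) v) (lookup-map l (_↑ˡ k) v))) (trans (edge-left _ _ _) a)

  module _ {n} (H : Graph³ n) where
    subGraph-++ : ∀ (v : Vec (Fin n) m) (w : Vec (Fin n) k) → SubGraph H G₁ v → SubGraph H G₂ w →
                  (∀ {x y z} → x ∈ toList v → y ∈ toList w → ¬ G.Adj H x y z) →
                  SubGraph H (G₁ ∪ᴳ G₂) (v Vec.++ w)
    subGraph-++ v w sub₁ sub₂ mixed x y z x≢y x≢z y≢z a with side m x | side m y | side m z
    ... | inj₁ (i , refl) | inj₁ (j , refl) | inj₁ (l , refl)
      rewrite lookup-++ˡ v w i | lookup-++ˡ v w j | lookup-++ˡ v w l =
      trans (edge-left i j l) (sub₁ i j l (x≢y ∘ cong (_↑ˡ k)) (x≢z ∘ cong (_↑ˡ k)) (y≢z ∘ cong (_↑ˡ k)) a)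
    ... | inj₂ (i , refl) | inj₂ (j , refl) | inj₂ (l , refl)
      rewrite lookup-++ʳ v w i | lookup-++ʳ v w j | lookup-++ʳ v w l =
      trans (edge-right i j l) (sub₂ i j l (x≢y ∘ cong (m ↑ʳ_)) (x≢z ∘ cong (m ↑ʳ_)) (y≢z ∘ cong (m ↑ʳ_)) a)
    ... | inj₁ (i , refl) | inj₂ (j , refl) | _ rewrite lookup-++ˡ v w i | lookup-++ʳ v w j =
      ⊥-elim (mixed (lookup∈ v i) (lookup∈ w j) a)
    ... | inj₂ (i , refl) | inj₁ (j , refl) | _ rewrite lookup-++ʳ v w i | lookup-++ˡ v w j =
      ⊥-elim (mixed (lookup∈ v j) (lookup∈ w i) (G.flip₁ H a))
    ... | inj₁ (i , refl) | inj₁ (j , refl) | inj₂ (l , refl) rewrite lookup-++ˡ v w i | lookup-++ʳ v w l =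
      ⊥-elim (mixed (lookup∈ v i) (lookup∈ w l) (G.flip₂ H a))
    ... | inj₂ (i , refl) | inj₂ (j , refl) | inj₁ (l , refl) rewrite lookup-++ʳ v w i | lookup-++ˡ v w l =
      ⊥-elim (mixed (lookup∈ v l) (lookup∈ w i) (G.flip₁ H (G.flip₂ H a)))

-- Complete 3-graphs.

K³-adj : ∀ m {i j k : Fin m} → i ≢ j → i ≢ k → j ≢ k → G.Adj (K³ m) i j k
K³-adj m {i} {j} {k} i≢j i≢k j≢k = Adj⁺ (K³ m) {i} {j} {k} (∣triple∣ i≢j i≢k j≢k)

K³-pathFree : ∀ m → m ≤ 6 → G.PathFree (K³ m)
K³-pathFree m m≤6 u _ _ _ with split-off u (All.tabulate λ {x} _ → ∈-allFin x)
... | W , p = <⇒≱ (s≤s m≤6) (≤-trans (m≤m+n 7 (length W)) (≤-reflexive (trans (sym (↭-length p)) (length-allFin m))))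

size-K³ : ∀ m → size (K³ m) ≡ binom3 m
size-K³ m = trans (size-count (K³ m)) (≤-antisym
  (≤-trans (Vertices.count-≤binom3 (toGraph (K³ m)) (Uniqueₚ.allFin⁺ m)) (≤-reflexive (cong binom3 (length-allFin m))))
  (≤-trans (≤-reflexive (trans (cong binom3 (sym (length-allFin m))) (sym (sum3-const1 (allFin m)))))
           (sum3-mono (Uniqueₚ.allFin⁺ m) λ _ _ _ i≢j i≢k j≢k → ≤-reflexive (cong bit (sym (K³-adj m i≢j i≢k j≢k))))))

K³-matching : Vertices.Occurs (toGraph (K³ 6)) {6} disjoint (allFin 6)
K³-matching = Vec.allFin 6 , Uniqueₚ.allFin⁺ 6 , All.tabulate (λ {x} _ → ∈-allFin x) , refl ∷ refl ∷ []

-- Comets.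

short : ∀ {m} (xs : List (Fin m)) → Unique xs → length xs ≤ m
short {m} xs u with split-off u (All.tabulate λ {x} _ → ∈-allFin x)
... | W , p = ≤-trans (≤-trans (m≤m+n (length xs) (length W)) (≤-reflexive (sym (length-++ xs))))
                      (≤-reflexive (trans (sym (↭-length p)) (length-allFin m)))

-- The facts about comets used below. Proving the rest for an arbitrary `Γ` with these properties
-- keeps the subset definition of `comet` from unfolding.
record IsComet (r : ℕ) (Γ : Graph³ (4 + r)) : Set where
  open G Γ
  field
    head-adj : ∀ {i j l : Fin 4} → i ↑ˡ r ≢ j ↑ˡ r → i ↑ˡ r ≢ l ↑ˡ r → j ↑ˡ r ≢ l ↑ˡ r → Adj (i ↑ˡ r) (j ↑ˡ r) (l ↑ˡ r)
    star-adj : ∀ {j l : Fin r} → j ≢ l → Adj 0F (4 ↑ʳ j) (4 ↑ʳ l)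
    heads    : ∀ {i : Fin 3} {j : Fin r} {y} → ¬ Adj (suc i ↑ˡ r) (4 ↑ʳ j) y
    rest     : ∀ {i j l : Fin r} → ¬ Adj (4 ↑ʳ i) (4 ↑ʳ j) (4 ↑ʳ l)

comet-isComet : ∀ r → IsComet r (comet r)
comet-isComet r = record
  { head-adj = λ {i} {j} {l} → head-adj {i} {j} {l}
  ; star-adj = λ {j} {l} → star-adj {j} {l}
  ; heads    = λ {i} {j} {y} → heads {i} {j} {y}
  ; rest     = λ {i} {j} {l} → rest {i} {j} {l}
  }
  where
  open G (comet r)

  head c∪R : Subset (4 + r)
  head = ⊤ {4} Vec.++ ∅ {r}
  c∪R  = ⁅ 0F ⁆ Vec.++ ⊤ {r}

  L : Fin 4 → Fin (4 + r)
  L i = i ↑ˡ r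

  R : Fin r → Fin (4 + r)
  R j = 4 ↑ʳ j

  L∈head : ∀ i → L i ∈ˢ head
  L∈head i = ∈-++ˢˡ⁺ (⊤ {4}) (∅ {r}) ∈⊤

  R∉head : ∀ j → ¬ (R j ∈ˢ head)
  R∉head j = ∉⊥ ∘ ∈-++ˢʳ (⊤ {4}) (∅ {r})

  R∈c∪R : ∀ j → R j ∈ˢ c∪R
  R∈c∪R j = ∈-++ˢʳ⁺ ⁅ 0F ⁆ (⊤ {r}) ∈⊤

  h∉c∪R : ∀ i → ¬ (L (suc i) ∈ˢ c∪R)
  h∉c∪R i h∈ = case x∈⁅y⁆⇒x≡y {x = suc i} 0F (∈-++ˢˡ ⁅ 0F ⁆ (⊤ {r}) h∈) of λ ()

  triple⊆ : ∀ {x y z} {p : Subset (4 + r)} → x ∈ˢ p → y ∈ˢ p → z ∈ˢ p → triple x y z ⊆ˢ p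
  triple⊆ {x} {y} {z} x∈ y∈ z∈ t∈ with ∈-triple⁻ {x = x} {y} {z} t∈
  ... | inj₁ refl        = x∈
  ... | inj₂ (inj₁ refl) = y∈
  ... | inj₂ (inj₂ refl) = z∈

  head-adj : ∀ {i j l} → L i ≢ L j → L i ≢ L l → L j ≢ L l → Adj (L i) (L j) (L l)
  head-adj {i} {j} {l} p q s = Adj⁺ (comet r) {L i} {L j} {L l}
    (∣triple∣ p q s , inj₁ (triple⊆ {L i} {L j} {L l} (L∈head i) (L∈head j) (L∈head l)))

  star-adj : ∀ {j l} → j ≢ l → Adj 0F (R j) (R l)
  star-adj {j} {l} ne = Adj⁺ (comet r) {0F} {R j} {R l}
    (∣triple∣ {x = 0F} {R j} {R l} (λ ()) (λ ()) (ne ∘ Finₚ.↑ʳ-injective 4 j l) ,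
     inj₂ (∈-triple⁺ {x = 0F} {R j} {R l} (inj₁ refl) , triple⊆ {0F} {R j} {R l} Vec.here (R∈c∪R j) (R∈c∪R l)))

  heads : ∀ {i j y} → ¬ Adj (L (suc i)) (R j) y
  heads {i} {j} {y} a with Adj⁻ (comet r) {L (suc i)} {R j} {y} a
  ... | _ , inj₁ ⊆head     = R∉head j (⊆head (∈-triple⁺ {x = L (suc i)} {R j} {y} (inj₂ (inj₁ refl))))
  ... | _ , inj₂ (_ , ⊆cR) = h∉c∪R i (⊆cR (∈-triple⁺ {x = L (suc i)} {R j} {y} (inj₁ refl)))

  rest : ∀ {i j l} → ¬ Adj (R i) (R j) (R l)
  rest {i} {j} {l} a with Adj⁻ (comet r) {R i} {R j} {R l} a
  ... | _ , inj₁ ⊆head   = R∉head i (⊆head (∈-triple⁺ {x = R i} {R j} {R l} (inj₁ refl)))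
  ... | _ , inj₂ (0∈ , _) with ∈-triple⁻ {x = R i} {R j} {R l} 0∈
  ...   | inj₁ ()
  ...   | inj₂ (inj₁ ())
  ...   | inj₂ (inj₂ ())

module Comet {r : ℕ} {Γ : Graph³ (4 + r)} (isComet : IsComet r Γ) where
  open G Γ
  open IsComet isComet

  private
    L : Fin 4 → Fin (4 + r)
    L i = i ↑ˡ r

    R : Fin r → Fin (4 + r)
    R j = 4 ↑ʳ j

    InHead : Fin (4 + r) → Set
    InHead x = ∃[ i ] L i ≡ x

    two-heads : ∀ {i y z} → Adj (L (suc i)) y z → InHead y × InHead z
    two-heads {i} {y} {z} a with side 4 y | side 4 z
    ... | inj₂ (_ , refl) | _               = ⊥-elim (heads a)
    ... | inj₁ _          | inj₂ (_ , refl) = ⊥-elim (heads {i} {_} {y} (flip₂ {L (suc i)} {y} {z} a))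
    ... | inj₁ y          | inj₁ z          = y , z

    head-edge : ∀ {x y z} → x ≢ 0F → y ≢ 0F → z ≢ 0F → Adj x y z → (∃[ i ] L (suc i) ≡ x) × InHead y × InHead z
    head-edge {x} {y} {z} x≢0 y≢0 z≢0 a with side 4 x | side 4 y | side 4 z
    ... | inj₁ (zero , refl)  | _ | _ = ⊥-elim (x≢0 refl)
    ... | inj₁ (suc i , refl) | _ | _ = (i , refl) , two-heads a
    ... | inj₂ (_ , refl) | inj₁ (zero , refl)  | _ = ⊥-elim (y≢0 refl)
    ... | inj₂ (_ , refl) | inj₁ (suc i , refl) | _ = ⊥-elim (heads {i} {_} {z} (flip₁ {x} {y} {z} a))
    ... | inj₂ (_ , refl) | inj₂ (_ , refl) | inj₁ (zero , refl)  = ⊥-elim (z≢0 refl)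
    ... | inj₂ (_ , refl) | inj₂ (_ , refl) | inj₁ (suc i , refl) = ⊥-elim (heads {i} {_} {y} (flip₂ {z} {y} {x} (flip₁₃ {x} {y} {z} a)))
    ... | inj₂ (_ , refl) | inj₂ (_ , refl) | inj₂ (_ , refl) = ⊥-elim (rest a)

    -- An edge avoiding the centre lies in the head, as does every edge meeting it; but the head is too small for two such edges.
    no-tail : ∀ {c d e f g} → Unique (c ∷ d ∷ e ∷ f ∷ g ∷ []) → Adj c d e → Adj e f g → e ≢ 0F → f ≢ 0F → g ≢ 0F → ⊥
    no-tail {c} {d} u x y e≢0 f≢0 g≢0 with head-edge e≢0 f≢0 g≢0 y
    ... | (e , refl) , (f , refl) , (g , refl) with two-heads {e} {c} {d} (rotate {d} {L (suc e)} {c} (rotate {c} {d} {L (suc e)} x))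
    ... | (c , refl) , (d , refl) = <⇒≱ (n<1+n 4) (short _ (Uniqueₚ.map⁻ {f = L} {xs = c ∷ d ∷ suc e ∷ f ∷ g ∷ []} u))

    -- If the centre is on the last edge, it is not on the first, which is disjoint from it. Read
    -- backwards, the path ends in an edge avoiding the centre.
    through-tail : ∀ {a b c d e f g} → Unique (a ∷ b ∷ c ∷ d ∷ e ∷ f ∷ g ∷ []) → Adj a b c → Adj c d e → 0F ∈ e ∷ f ∷ g ∷ [] → ⊥
    through-tail {a} {b} {c} {d} {e} {f} {g} u x y 0∈ =
      no-tail (Unique-↭ (↭-sym (↭-reverse (a ∷ b ∷ c ∷ d ∷ e ∷ []))) (Unique-++ˡ (a ∷ b ∷ c ∷ d ∷ e ∷ []) u))
              (flip₁₃ y) (flip₁₃ x) (≢0 (there (there (here refl)))) (≢0 (there (here refl))) (≢0 (here refl))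
      where
      ≢0 : ∀ {x} → x ∈ a ∷ b ∷ c ∷ [] → x ≢ 0F
      ≢0 x∈ refl = Unique-++-disjoint (a ∷ b ∷ c ∷ d ∷ []) u (∈-++⁺ˡ x∈) 0∈

  pathFree : PathFree
  pathFree {a} {b} {c} {d} {e} {f} {g} u x y z with e ≟ᶠ 0F | f ≟ᶠ 0F | g ≟ᶠ 0F
  ... | yes p  | _      | _      = through-tail u x y (here (sym p))
  ... | _      | yes p  | _      = through-tail u x y (there (here (sym p)))
  ... | _      | _      | yes p  = through-tail u x y (there (there (here (sym p))))
  ... | no e≢0 | no f≢0 | no g≢0 = no-tail (Unique-++ʳ (a ∷ b ∷ []) u) y z e≢0 f≢0 g≢0

  private
    allFin-≡ : allFin (4 + r) ≡ toList (0F ∷ 1F ∷ 2F ∷ 3F ∷ []) ++ map R (allFin r)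
    allFin-≡ = allFin-+ 4 r

    ∈R⁻ : ∀ {x} → x ∈ map R (allFin r) → ∃[ j ] R j ≡ x
    ∈R⁻ x∈ = let j , _ , eq = ∈-map⁻ R x∈ in j , sym eq

  subComet : SubComet (toGraph Γ) (allFin (4 + r))
  subComet = record
    { c = 0F ; h₁ = 1F ; h₂ = 2F ; h₃ = 3F ; R = map R (allFin r)
    ; arrangement = subst (allFin (4 + r) ↭_) allFin-≡ ↭-refl
    ; heads = λ h∈ r∈ _ → no-heads h∈ (∈R⁻ r∈)
    ; rest  = λ x∈ y∈ z∈ → no-rest (∈R⁻ x∈) (∈R⁻ y∈) (∈R⁻ z∈)
    }
    where
    no-heads : ∀ {h x y} → h ∈ 1F ∷ 2F ∷ 3F ∷ [] → ∃[ j ] R j ≡ x → ¬ Adj h x y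
    no-heads (here refl)                 (_ , refl) = heads {0F}
    no-heads (there (here refl))         (_ , refl) = heads {1F}
    no-heads (there (there (here refl))) (_ , refl) = heads {2F}
    no-rest : ∀ {x y z} → ∃[ i ] R i ≡ x → ∃[ j ] R j ≡ y → ∃[ l ] R l ≡ z → ¬ Adj x y z
    no-rest (_ , refl) (_ , refl) (_ , refl) = rest

  size-comet : size Γ ≡ 4 + binom2 r
  size-comet = trans (size-count Γ) (≤-antisym upper lower)
    where
    open ≤-Reasoning
    hs : List (Fin (4 + r))
    hs = 0F ∷ 1F ∷ 2F ∷ 3F ∷ []
    links colinks : ℕ
    links   = sum1 (λ y → sum2 (wt y) hs) (map R (allFin r))
    colinks = sum2 (λ y z → sum1 (λ x → wt x y z) hs) (map R (allFin r))
    R-unique : Unique (map R (allFin r))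
    R-unique = Uniqueₚ.map⁺ (Finₚ.↑ʳ-injective 4 _ _) (Uniqueₚ.allFin⁺ r)
    |R| : length (map R (allFin r)) ≡ r
    |R| = trans (length-map R (allFin r)) (length-allFin r)
    upper : count (allFin (4 + r)) ≤ 4 + binom2 r
    upper = ≤-trans (subComet-count (toGraph Γ) (Uniqueₚ.allFin⁺ (4 + r)) subComet) (≤-reflexive (cong (λ l → 4 + binom2 l) |R|))
    lower : 4 + binom2 r ≤ count (allFin (4 + r))
    lower = begin
      4 + binom2 r
        ≡⟨ cong (λ l → 4 + binom2 l) |R| ⟨
      4 + binom2 (length (map R (allFin r)))
        ≤⟨ +-monoʳ-≤ 4 (≤-trans (≤-reflexive (sym (sum2-const1 (map R (allFin r)))))
             (sum2-mono R-unique λ x∈ y∈ x≢y → ≤-trans (star (∈R⁻ x∈) (∈R⁻ y∈) x≢y) (m≤m+n _ _))) ⟩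
      4 + colinks                                       ≤⟨ +-monoˡ-≤ colinks (m≤m+n 4 links) ⟩
      4 + links + colinks                               ≡⟨ cong (λ l → l + links + colinks) four ⟨
      count hs + links + colinks                        ≤⟨ m≤m+n _ (count (map R (allFin r))) ⟩
      count hs + links + colinks + count (map R (allFin r))
        ≡⟨ sum3-++ wt-sym hs (map R (allFin r)) ⟨
      count (hs ++ map R (allFin r))
        ≡⟨ cong count allFin-≡ ⟨
      count (allFin (4 + r)) ∎
      where
      star : ∀ {x y} → ∃[ i ] R i ≡ x → ∃[ j ] R j ≡ y → x ≢ y → 1 ≤ wt 0F x y
      star (i , refl) (j , refl) ne = ≤-reflexive (cong bit (sym (star-adj {i} {j} (ne ∘ cong R))))
      four : count hs ≡ 4
      four rewrite head-adj {0F} {1F} {2F} (λ ()) (λ ()) (λ ()) | head-adj {0F} {1F} {3F} (λ ()) (λ ()) (λ ())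
                 | head-adj {0F} {2F} {3F} (λ ()) (λ ()) (λ ()) | head-adj {1F} {2F} {3F} (λ ()) (λ ()) (λ ()) = refl

  module _ {n} (H : Graph³ n) {c h₁ h₂ h₃ : Fin n} (w : Vec (Fin n) r)
           (noHeads : ∀ {h x y} → h ∈ h₁ ∷ h₂ ∷ h₃ ∷ [] → x ∈ toList w → ¬ G.Adj H h x y)
           (noRest : ∀ {x y z} → x ∈ toList w → y ∈ toList w → z ∈ toList w → ¬ G.Adj H x y z) where
    private
      v : Vec (Fin n) (4 + r)
      v = c ∷ h₁ ∷ h₂ ∷ h₃ ∷ w

      h∈ : ∀ i → lookup v (L (suc i)) ∈ h₁ ∷ h₂ ∷ h₃ ∷ []
      h∈ 0F = here refl
      h∈ 1F = there (here refl)
      h∈ 2F = there (there (here refl))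

      from-rest : ∀ j y z → R j ≢ y → R j ≢ z → y ≢ z → G.Adj H (lookup w j) (lookup v y) (lookup v z) → Adj (R j) y z
      from-rest j y z j≢y j≢z y≢z a with side 4 y | side 4 z
      ... | inj₁ (zero , refl)  | inj₁ (zero , refl)  = ⊥-elim (y≢z refl)
      ... | inj₁ (suc i , refl) | _                   = ⊥-elim (noHeads (h∈ i) (lookup∈ w j) (G.flip₁ H a))
      ... | _                   | inj₁ (suc i , refl) = ⊥-elim (noHeads (h∈ i) (lookup∈ w j) (G.rotate H (G.rotate H a)))
      ... | inj₂ (i , refl)     | inj₂ (l , refl)     = ⊥-elim (noRest (lookup∈ w j) (lookup∈ w i) (lookup∈ w l) a)
      ... | inj₁ (zero , refl)  | inj₂ (l , refl)     = flip₁ {0F} {R j} {R l} (star-adj {j} {l} (j≢z ∘ cong R))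
      ... | inj₂ (i , refl)     | inj₁ (zero , refl)  = rotate {0F} {R j} {R i} (star-adj {j} {i} (j≢y ∘ cong R))

    subGraph-comet : SubGraph H Γ v
    subGraph-comet x y z x≢y x≢z y≢z a with side 4 x | side 4 y | side 4 z
    ... | inj₂ (j , refl) | _               | _               = from-rest j y z x≢y x≢z y≢z a
    ... | inj₁ _          | inj₂ (j , refl) | _               =
      rotate {z} {x} {R j} (rotate {R j} {z} {x} (from-rest j z x y≢z (x≢y ∘ sym) (x≢z ∘ sym) (G.rotate H a)))
    ... | inj₁ _          | inj₁ _          | inj₂ (j , refl) =
      rotate {R j} {x} {y} (from-rest j x y (x≢z ∘ sym) (y≢z ∘ sym) x≢y (G.rotate H (G.rotate H a)))
    ... | inj₁ (i , refl) | inj₁ (j , refl) | inj₁ (l , refl) = head-adj {i} {j} {l} x≢y x≢z y≢z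

-- The head triple without the centre and one edge of the star; the latter needs two vertices in
-- `R`.
comet-matching : ∀ r → Vertices.Occurs (toGraph (comet (2 + r))) {6} disjoint (allFin (6 + r))
comet-matching r = 1F ∷ 2F ∷ 3F ∷ 0F ∷ 4F ∷ 5F ∷ [] , distinct-sound _ tt , All.tabulate (λ {x} _ → ∈-allFin x)
  , head-adj {1F} {2F} {3F} (λ ()) (λ ()) (λ ()) ∷ star-adj {0F} {1F} (λ ()) ∷ []
  where open IsComet (comet-isComet (2 + r))

-- The conditional Turán numbers and their extremal 3-graphs.

nC2≡binom2 : ∀ n → n C 2 ≡ binom2 n
nC2≡binom2 zero    = refl
nC2≡binom2 (suc n) = trans (sym (nCk+nC[k+1]≡[n+1]C[k+1] n 1)) (cong₂ _+_ (nC1≡n n) (nC2≡binom2 n))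

nC3≡binom3 : ∀ n → n C 3 ≡ binom3 n
nC3≡binom3 zero    = refl
nC3≡binom3 (suc n) = trans (sym (nCk+nC[k+1]≡[n+1]C[k+1] n 2)) (cong₂ _+_ (nC2≡binom2 n) (nC3≡binom3 n))

Feasible : Graph³ n → Set₁
Feasible = Admissible ｛ (7 , P) ｝ ｛ (6 , M) ｝

module _ {n} (H : Graph³ n) where

  feasible⁺ : G.PathFree H → Vertices.Occurs (toGraph H) {6} disjoint (allFin n) → Feasible H
  feasible⁺ pf m = (λ { _ refl → P-free⁻ H pf }) , 6 , M , refl , M⁻ H m

  feasible⁻ : Feasible H → G.PathFree H × Vertices.Occurs (toGraph H) {6} disjoint (allFin n)
  feasible⁻ (free , _ , _ , refl , contains) = P-free⁺ H (free P refl) , M⁺ H contains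

  feasible-outcome : Feasible H → Outcome (toGraph H) (allFin n)
  feasible-outcome f = let pf , m = feasible⁻ f in outcome (toGraph H) pf (<-wellFounded _) (Uniqueₚ.allFin⁺ n) m

  size-≤ : Feasible H → size H ≤ condTurán n
  size-≤ f = ≤-trans (≤-reflexive (size-count H)) (≤-trans (Outcome-≤ (toGraph H) (Uniqueₚ.allFin⁺ n) (feasible-outcome f))
                                                           (≤-reflexive (cong condTurán (length-allFin n))))

  not-below : size H ≡ condTurán n → ¬ (G.count H (allFin n) < condTurán (length (allFin n)))
  not-below eq lt = <⇒≢ lt (trans (sym (size-count H)) (trans eq (cong condTurán (sym (length-allFin n)))))

feasible-≅ : ∀ {H : Graph³ n} {S : Graph³ m} → H ≅ S → G.PathFree S → Vertices.Occurs (toGraph S) {6} disjoint (allFin m) → Feasible H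
feasible-≅ {H = H} {S} iso pf o = feasible⁺ H (pathFree-≅ {H = H} {S} iso pf) (occurs-≅ {H = H} {S} iso {K = disjoint} o)

≅-refl : (H : Graph³ n) → H ≅ H
≅-refl {n} H = ≅-from-subgraph H H (Vec.allFin n)
  (subst (_↭ allFin n) (sym (trans (toList-lookup (Vec.allFin n)) (map-lookup n))) ↭-refl)
  (λ i j k _ _ _ → subst (λ (i , j , k) → G.Adj H i j k) (cong₂ _,_ (lookup∘tabulate id i) (cong₂ _,_ (lookup∘tabulate id j) (lookup∘tabulate id k)))) ≤-refl
  where
  map-lookup : ∀ n → map (lookup (Vec.allFin n)) (allFin n) ≡ allFin n
  map-lookup n = trans (map-cong (lookup∘tabulate id) (allFin n)) (map-id (allFin n))

-- One attained solution shows that the upper bound `condTurán n` is the maximum. An extremal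
-- 3-graph must then reach this size as well, and a solution is extremal because it does.
extremal : ∀ {n} {Solution : Graph³ n → Set} (k : ℕ) → k ≡ condTurán n →
           (∀ H → Feasible H → size H ≡ condTurán n → Solution H) →
           (∀ {H} → Solution H → Feasible H × size H ≡ condTurán n) → ∃ Solution →
           (ex₃[ n , ｛ (7 , P) ｝ ∣ ｛ (6 , M) ｝ ]≡ k) × (∀ H → Ex₃[ n , ｛ (7 , P) ｝ ∣ ｛ (6 , M) ｝ ] H ⇔ Solution H)
extremal k refl solved check (S , s) =
  ((S , check s) , size-≤) ,
  λ H → mk⇔ (λ (f , _ , max) → solved H f (≤-antisym (size-≤ H f) (≤-trans (≤-reflexive (sym (proj₂ (check s)))) (max S (proj₁ (check s))))))
            (λ sol → let f , eq = check sol in f , (H , f , refl) , λ H′ f′ → ≤-trans (size-≤ H′ f′) (≤-reflexive (sym eq)))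

private
  toVec : ∀ {A : Set} {k} (xs : List A) → length xs ≡ k → ∃[ v ] toList {n = k} v ≡ xs
  toVec xs refl = Vec.fromList xs , toList∘fromList xs

  K³-subGraph : ∀ {n} (H : Graph³ n) m (v : Vec (Fin n) m) → SubGraph H (K³ m) v
  K³-subGraph H m v i j k i≢j i≢k j≢k _ = K³-adj m i≢j i≢k j≢k

size-two : ∀ k → size (K³ 6 ∪ᴳ K³ k) ≡ 20 + binom3 k
size-two k = trans (Union.size-∪ (K³ 6) (K³ k)) (cong₂ _+_ (size-K³ 6) (size-K³ k))

size-three : size (K³ 6 ∪ᴳ K³ 6 ∪ᴳ K³ 1) ≡ 40
size-three = trans (Union.size-∪ (K³ 6 ∪ᴳ K³ 6) (K³ 1)) (cong₂ _+_ (size-two 6) (size-K³ 1))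

≅-two : ∀ {k} (H : Graph³ (6 + k)) → Closed6 (toGraph H) (allFin (6 + k)) → 20 + binom3 k ≤ size H → H ≅ K³ 6 ∪ᴳ K³ k
≅-two {k} H c le with toVec (Closed6.U c) (Closed6.size-U c) | toVec (Closed6.W c) (size-W c)
  where
  size-W : (c : Closed6 (toGraph H) (allFin (6 + k))) → length (Closed6.W c) ≡ k
  size-W c = sym (+-cancelˡ-≡ 6 _ _ (trans (sym (length-allFin (6 + k))) (closed6-size (toGraph H) c)))
... | u , u≡ | w , w≡ = ≅-from-subgraph H (K³ 6 ∪ᴳ K³ k) (u Vec.++ w)
  (↭-sym (subst (allFin (6 + k) ↭_) (sym (trans (toList-++ u w) (cong₂ _++_ u≡ w≡))) arrangement))
  (Union.subGraph-++ (K³ 6) (K³ k) H u w (K³-subGraph H 6 u) (K³-subGraph H k w)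
    λ {x} {y} {z} x∈ y∈ → closed (subst (x ∈_) u≡ x∈) (subst (y ∈_) w≡ y∈) (∈-allFin z))
  (≤-trans (≤-reflexive (size-two k)) le)
  where open Closed6 c

private
  -- Stated for variable block sizes and lists, so that nothing in the unions is evaluated. The
  -- concrete sizes 6, 6, 1 enter only when it is applied.
  ≅-three′ : ∀ {n} a b k (H : Graph³ n) {U U′ W : List (Fin n)} → allFin n ↭ U ++ (U′ ++ W) →
             (∀ {x w y} → x ∈ U → w ∈ U′ ++ W → y ∈ allFin n → ¬ G.Adj H x w y) →
             (∀ {x w y} → x ∈ U′ → w ∈ W → y ∈ U′ ++ W → ¬ G.Adj H x w y) →
             (u : Vec (Fin n) a) → toList u ≡ U → (u′ : Vec (Fin n) b) → toList u′ ≡ U′ → (w : Vec (Fin n) k) → toList w ≡ W →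
             size (K³ a ∪ᴳ K³ b ∪ᴳ K³ k) ≤ size H → H ≅ K³ a ∪ᴳ K³ b ∪ᴳ K³ k
  ≅-three′ {n} a b k H {U} {U′} {W} arrangement closed closed′ u refl u′ refl w refl le =
    ≅-from-subgraph H (K³ a ∪ᴳ K³ b ∪ᴳ K³ k) ((u Vec.++ u′) Vec.++ w)
      (↭-sym (subst (allFin n ↭_) (sym lists) arrangement))
      (Union.subGraph-++ (K³ a ∪ᴳ K³ b) (K³ k) H (u Vec.++ u′) w
        (Union.subGraph-++ (K³ a) (K³ b) H u u′ (K³-subGraph H a u) (K³-subGraph H b u′)
          λ {x} {y} {z} x∈ y∈ → closed x∈ (∈-++⁺ˡ y∈) (∈-allFin z))
        (K³-subGraph H k w)
        λ {x} {y} x∈ y∈ → mixed (subst (x ∈_) (toList-++ u u′) x∈) y∈)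
      le
    where
    lists : toList ((u Vec.++ u′) Vec.++ w) ≡ U ++ (U′ ++ W)
    lists = trans (toList-++ (u Vec.++ u′) w) (trans (cong (_++ W) (toList-++ u u′)) (++-assocᴸ U U′ W))
    mixed : ∀ {x y z} → x ∈ U ++ U′ → y ∈ W → ¬ G.Adj H x y z
    mixed {x} {y} {z} x∈ y∈ a with ∈-++⁻ U x∈ | ∈-++⁻ U (∈-resp-↭ arrangement (∈-allFin z))
    ... | inj₁ x∈U  | _         = closed x∈U (∈-++⁺ʳ U′ y∈) (∈-allFin z) a
    ... | inj₂ x∈U′ | inj₁ z∈U  = closed z∈U (∈-++⁺ʳ U′ y∈) (∈-allFin x) (G.flip₁₃ H a)
    ... | inj₂ x∈U′ | inj₂ z∈   = closed′ x∈U′ y∈ z∈ a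

≅-three : (H : Graph³ 13) → Closed66 (toGraph H) (allFin 13) → 40 ≤ size H → H ≅ K³ 6 ∪ᴳ K³ 6 ∪ᴳ K³ 1
≅-three H c le =
  let u  , u≡  = toVec U size-U
      u′ , u′≡ = toVec U′ size-U′
      w  , w≡  = toVec W size-W
  in ≅-three′ 6 6 1 H arrangement closed closed′ u u≡ u′ u′≡ w w≡ (≤-trans (≤-reflexive size-three) le)
  where open Closed66 c

≅-comet : ∀ {r} (H : Graph³ (4 + r)) → SubComet (toGraph H) (allFin (4 + r)) → 4 + binom2 r ≤ size H → H ≅ comet r
≅-comet {r} H s le with toVec (SubComet.R s) (size-R s)
  where
  size-R : (s : SubComet (toGraph H) (allFin (4 + r))) → length (SubComet.R s) ≡ r
  size-R s = sym (+-cancelˡ-≡ 4 _ _ (trans (sym (length-allFin (4 + r))) (↭-length (SubComet.arrangement s))))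
... | w , w≡ = ≅-from-subgraph H (comet r) (c ∷ h₁ ∷ h₂ ∷ h₃ ∷ w)
  (↭-sym (subst (λ xs → allFin (4 + r) ↭ c ∷ h₁ ∷ h₂ ∷ h₃ ∷ xs) (sym w≡) arrangement))
  (Comet.subGraph-comet (comet-isComet r) H w
    (λ {h} {x} {y} h∈ x∈ → heads h∈ (subst (x ∈_) w≡ x∈) (∈-allFin y))
    (λ {x} {y} {z} x∈ y∈ z∈ → rest (subst (x ∈_) w≡ x∈) (subst (y ∈_) w≡ y∈) (subst (z ∈_) w≡ z∈)))
  (≤-trans (≤-reflexive (Comet.size-comet (comet-isComet r))) le)
  where open SubComet s

private
  condTurán-two : ∀ k → 6 + k ≤ 12 → 20 + binom3 k ≡ condTurán (6 + k)
  condTurán-two 0 _ = refl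
  condTurán-two 1 _ = refl
  condTurán-two 2 _ = refl
  condTurán-two 3 _ = refl
  condTurán-two 4 _ = refl
  condTurán-two 5 _ = refl
  condTurán-two 6 _ = refl
  condTurán-two (suc (suc (suc (suc (suc (suc (suc k))))))) (s≤s (s≤s (s≤s (s≤s (s≤s (s≤s (s≤s (s≤s (s≤s (s≤s (s≤s (s≤s ()))))))))))))

  solve-two : ∀ k → 6 + k ≤ 12 → (H : Graph³ (6 + k)) → Feasible H → size H ≡ condTurán (6 + k) → H ≅ K³ 6 ∪ᴳ K³ k
  solve-two k le H f eq = by-cases (feasible-outcome H f)
    where
    by-cases : Outcome (toGraph H) (allFin (6 + k)) → H ≅ K³ 6 ∪ᴳ K³ k
    by-cases (below lt)        = ⊥-elim (not-below H eq lt)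
    by-cases (twoBlocks _ c)   = ≅-two H c (≤-reflexive (trans (condTurán-two k le) (sym eq)))
    by-cases (threeBlocks l _) = ⊥-elim (<⇒≱ (n<1+n 12) (≤-trans (≤-reflexive (trans (sym l) (length-allFin (6 + k)))) le))
    by-cases (inComet l _)     = ⊥-elim (<⇒≱ (n<1+n 12) (≤-trans (≤-trans l (≤-reflexive (length-allFin (6 + k)))) le))

  check-two : ∀ k → 6 + k ≤ 12 → ∀ {H : Graph³ (6 + k)} → H ≅ K³ 6 ∪ᴳ K³ k → Feasible H × size H ≡ condTurán (6 + k)
  check-two k le {H} iso =
    feasible-≅ {H = H} {K³ 6 ∪ᴳ K³ k} iso
      (Union.pathFree (K³ 6) (K³ k) (K³-pathFree 6 ≤-refl) (K³-pathFree k (+-cancelˡ-≤ 6 k 6 le)))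
      (Union.occurs-left (K³ 6) (K³ k) {K = disjoint} K³-matching) ,
    trans (size-≅ {H = H} {K³ 6 ∪ᴳ K³ k} iso) (trans (size-two k) (condTurán-two k le))

  check-three : ∀ {H : Graph³ 13} → H ≅ K³ 6 ∪ᴳ K³ 6 ∪ᴳ K³ 1 → Feasible H × size H ≡ 40
  check-three {H} iso =
    feasible-≅ {H = H} {K³ 6 ∪ᴳ K³ 6 ∪ᴳ K³ 1} iso
      (Union.pathFree (K³ 6 ∪ᴳ K³ 6) (K³ 1) (Union.pathFree (K³ 6) (K³ 6) K₆ K₆) (K³-pathFree 1 (m≤m+n 1 5)))
      (Union.occurs-left (K³ 6 ∪ᴳ K³ 6) (K³ 1) {K = disjoint} (Union.occurs-left (K³ 6) (K³ 6) {K = disjoint} K³-matching)) ,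
    trans (size-≅ {H = H} {K³ 6 ∪ᴳ K³ 6 ∪ᴳ K³ 1} iso) size-three
    where
    K₆ : G.PathFree (K³ 6)
    K₆ = K³-pathFree 6 ≤-refl

  condTurán-comet : ∀ r → 9 ≤ r → 4 + binom2 r ≡ condTurán (4 + r)
  condTurán-comet r 9≤r = subst (λ r → 4 + binom2 r ≡ condTurán (4 + r)) (m+[n∸m]≡n 9≤r) refl

  check-comet : ∀ r → 9 ≤ r → ∀ {H : Graph³ (4 + r)} → H ≅ comet r → Feasible H × size H ≡ condTurán (4 + r)
  check-comet r 9≤r {H} iso =
    feasible-≅ {H = H} {comet r} iso (Comet.pathFree (comet-isComet r)) (matching r 9≤r) ,
    trans (size-≅ {H = H} {comet r} iso) (trans (Comet.size-comet (comet-isComet r)) (condTurán-comet r 9≤r))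
    where
    matching : ∀ r → 9 ≤ r → Vertices.Occurs (toGraph (comet r)) {6} disjoint (allFin (4 + r))
    matching (suc zero)    (s≤s ())
    matching (suc (suc r)) _ = comet-matching r

theorem-two : ∀ k → 6 + k ≤ 12 →
  (ex₃[ 6 + k , ｛ (7 , P) ｝ ∣ ｛ (6 , M) ｝ ]≡ (20 + k C 3)) ×
  (∀ H → Ex₃[ 6 + k , ｛ (7 , P) ｝ ∣ ｛ (6 , M) ｝ ] H ⇔ (H ≅ K³ 6 ∪ᴳ K³ k))
theorem-two k le = extremal {Solution = λ H → H ≅ K³ 6 ∪ᴳ K³ k} (20 + k C 3) (trans (cong (20 +_) (nC3≡binom3 k)) (condTurán-two k le))
  (solve-two k le) (λ {H} → check-two k le {H}) (K³ 6 ∪ᴳ K³ k , ≅-refl (K³ 6 ∪ᴳ K³ k))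

theorem-13 :
  (ex₃[ 13 , ｛ (7 , P) ｝ ∣ ｛ (6 , M) ｝ ]≡ 40) ×
  (∀ H → Ex₃[ 13 , ｛ (7 , P) ｝ ∣ ｛ (6 , M) ｝ ] H ⇔ (H ≅ K³ 6 ∪ᴳ K³ 6 ∪ᴳ K³ 1 ⊎ H ≅ Co 13))
theorem-13 = extremal {Solution = λ H → H ≅ K³ 6 ∪ᴳ K³ 6 ∪ᴳ K³ 1 ⊎ H ≅ Co 13} 40 refl solved
  (λ {H} → [ check-three {H} , check-comet 9 ≤-refl {H} ]′) (Co 13 , inj₂ (≅-refl (Co 13)))
  where
  solved : ∀ H → Feasible H → size H ≡ 40 → H ≅ K³ 6 ∪ᴳ K³ 6 ∪ᴳ K³ 1 ⊎ H ≅ Co 13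
  solved H f eq = by-cases (feasible-outcome H f)
    where
    by-cases : Outcome (toGraph H) (allFin 13) → H ≅ K³ 6 ∪ᴳ K³ 6 ∪ᴳ K³ 1 ⊎ H ≅ Co 13
    by-cases (below lt)        = ⊥-elim (not-below H eq lt)
    by-cases (twoBlocks l _)   = ⊥-elim (<⇒≱ (n<1+n 12) l)
    by-cases (threeBlocks _ c) = inj₁ (≅-three H c (≤-reflexive (sym eq)))
    by-cases (inComet _ s)     = inj₂ (≅-comet H s (≤-reflexive (sym eq)))

theorem-large : ∀ r → 10 ≤ r →
  (ex₃[ 4 + r , ｛ (7 , P) ｝ ∣ ｛ (6 , M) ｝ ]≡ (4 + r C 2)) ×
  (∀ H → Ex₃[ 4 + r , ｛ (7 , P) ｝ ∣ ｛ (6 , M) ｝ ] H ⇔ (H ≅ comet r))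
theorem-large r 10≤r = extremal {Solution = λ H → H ≅ comet r} (4 + r C 2) (trans (cong (4 +_) (nC2≡binom2 r)) (condTurán-comet r 9≤r))
  solved (λ {H} → check-comet r 9≤r {H}) (comet r , ≅-refl (comet r))
  where
  9≤r : 9 ≤ r
  9≤r = ≤-trans (n≤1+n 9) 10≤r
  solved : ∀ H → Feasible H → size H ≡ condTurán (4 + r) → H ≅ comet r
  solved H f eq = by-cases (feasible-outcome H f)
    where
    14≤n : 14 ≤ length (allFin (4 + r))
    14≤n = ≤-trans (+-monoʳ-≤ 4 10≤r) (≤-reflexive (sym (length-allFin (4 + r))))
    by-cases : Outcome (toGraph H) (allFin (4 + r)) → H ≅ comet r
    by-cases (below lt)        = ⊥-elim (not-below H eq lt)
    by-cases (twoBlocks l _)   = ⊥-elim (<⇒≱ (m≤m+n 13 1) (≤-trans 14≤n l))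
    by-cases (threeBlocks l _) = ⊥-elim (<⇒≱ (n<1+n 13) (≤-trans 14≤n (≤-reflexive l)))
    by-cases (inComet _ s)     = ≅-comet H s (≤-reflexive (trans (condTurán-comet r 9≤r) (sym eq)))

mainTheorem5 : (∀ n → 6 ≤ n → n ≤ 12 →
    (ex₃[ n , ｛ (7 , P) ｝ ∣ ｛ (6 , M) ｝ ]≡ (20 + (n ∸ 6) C 3))
    × (∀ (H : Graph³ n) →
    Ex₃[ n , ｛ (7 , P) ｝ ∣ ｛ (6 , M) ｝ ] H ⇔ (H ≅ K³ 6 ∪ᴳ K³ (n ∸ 6))))
    × ( (ex₃[ 13 , ｛ (7 , P) ｝ ∣ ｛ (6 , M) ｝ ]≡ 40)
    × (∀ (H : Graph³ 13) →
    Ex₃[ 13 , ｛ (7 , P) ｝ ∣ ｛ (6 , M) ｝ ] H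
    ⇔ (H ≅ K³ 6 ∪ᴳ K³ 6 ∪ᴳ K³ 1 ⊎ H ≅ Co 13)))
    × (∀ n → 14 ≤ n →
    (ex₃[ n , ｛ (7 , P) ｝ ∣ ｛ (6 , M) ｝ ]≡ (4 + (n ∸ 4) C 2))
    × (∀ (H : Graph³ n) →
    Ex₃[ n , ｛ (7 , P) ｝ ∣ ｛ (6 , M) ｝ ] H ⇔ (H ≅ Co n)))
mainTheorem5 = part-two , theorem-13 , part-large
  where
  Two Large : ℕ → Set₁
  Two n = n ≤ 12 → (ex₃[ n , ｛ (7 , P) ｝ ∣ ｛ (6 , M) ｝ ]≡ (20 + (n ∸ 6) C 3))
        × (∀ (H : Graph³ n) → Ex₃[ n , ｛ (7 , P) ｝ ∣ ｛ (6 , M) ｝ ] H ⇔ (H ≅ K³ 6 ∪ᴳ K³ (n ∸ 6)))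
  Large n = (ex₃[ n , ｛ (7 , P) ｝ ∣ ｛ (6 , M) ｝ ]≡ (4 + (n ∸ 4) C 2))
          × (∀ (H : Graph³ n) → Ex₃[ n , ｛ (7 , P) ｝ ∣ ｛ (6 , M) ｝ ] H ⇔ (H ≅ Co n))
  part-two : ∀ n → 6 ≤ n → Two n
  part-two n 6≤n = subst Two (m+[n∸m]≡n 6≤n) (theorem-two (n ∸ 6))
  part-large : ∀ n → 14 ≤ n → Large n
  part-large n 14≤n = subst Large (m+[n∸m]≡n (≤-trans (m≤m+n 4 10) 14≤n)) (theorem-large (n ∸ 4) (+-cancelˡ-≤ 4 10 (n ∸ 4) (≤-trans 14≤n (≤-reflexive (sym (m+[n∸m]≡n (≤-trans (m≤m+n 4 10) 14≤n)))))))
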